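{- Let $t\ge 3$ be an integer, and let $\alpha_t$ be the positive solution to the quadratic $\alpha = 1-\frac{1}{t-2}\alpha^2$; that is, $\alpha_t = 1-\frac{t-\sqrt{t^2-4}}{2}$. Then $\pi_{rt}(rK_t)\ge\alpha_t$ for all integers $r\ge1$, and $$\lim_{r\to\infty}\pi_{rt}(rK_t)=\alpha_t.$$
   Context: Graphs are finite and simple. An $m$-partite graph $G$ is a graph with a vertex partition $V = V_1\sqcup\dots\sqcup V_m$ into nonempty parts such that no edge has both ends in the same part. For disjoint nonempty vertex sets $X,Y$, the edge density is $d(X,Y) = \frac{e(X,Y)}{|X||Y|}$, where $e(X,Y)$ is the number of edges between $X$ and $Y$. The $m$-partite density of $G$ is $d_m(G) = \min_{1\le i<j\le m} d(V_i,V_j)$. A traversal of $G$ is a subgraph (on $m$ vertices) containing exactly one vertex from each part. For a graph $F$, $G$ contains an $F$-traversal if some traversal of $G$ contains $F$ as a subgraph (up to isomorphism). The critical density is $$\pi_m(F) = \sup\{\alpha\in[0,1] : \text{there exists an } m\text{ -partite graph } G \text{ with } d_m(G)\ge\alpha \text{ and no } F\text{ -traversal}\}.$$ $rK_t$ denotes the graph consisting of $r$ vertex-disjoint copies of the complete graph $K_t$. -}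

module Defs where

open import Data.Bool.Base using (Bool; false; T; _∧_; not)
open import Data.Bool.Properties using (T?; ∧-zeroʳ)
open import Data.Fin.Base as Fin using (Fin; quotient; remainder)
open import Data.Fin.Properties as Fin using (_<?_)
open import Data.Fin.Subset using (Subset; _∈_; ∣_∣; Nonempty)
open import Data.Fin.Subset.Properties using (_∈?_; x∈p⇒∣p-x∣<∣p∣)
open import Data.Integer.Base as ℤ using (+_)
open import Data.List.Base using (allFin; cartesianProduct; filter; length; map)
open import Data.Nat.Base as ℕ using (ℕ; NonZero)
open import Data.Nat.Properties as ℕ using (m*n≢0; m<n⇒0<n∸m)
open import Data.Product using (Σ; ∃; ∃₂; ∃!; _×_; _,_)
open import Data.Rational.Base as ℚ using (ℚ; _/_; 0ℚ; 1ℚ; ½)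
open import Data.Rational.Properties using (≤-decTotalOrder)
open import Data.Sum.Base using (_⊎_)
open import Function.Definitions using (Injective)
open import Level using (Level; 0ℓ; _⊔_) renaming (suc to lsuc)
open import Relation.Binary.Bundles using (DecTotalOrder)
open import Relation.Binary.PropositionalEquality.Core using (_≡_; refl; sym; cong; cong₂; trans)
open import Relation.Nullary using (¬_)
open import Relation.Nullary.Decidable using (does; _×-dec_; dec-true; yes; no)
open import Relation.Nullary.Negation using (contradiction)
open import Relation.Unary using (Pred)

open import Data.List.Extrema (DecTotalOrder.totalOrder ≤-decTotalOrder) using (min)

private
  variable
    a b : Level

------------------------------------------------------------------------
-- Real numbers as Dedekind cuts of ℚ

-- The operations are defined on arbitrary pairs of sets of rationals, by
-- the usual formulas for Dedekind cuts; `IsReal` singles out the genuine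
-- real numbers.

record Cut a : Set (lsuc a) where
  field
    lower : Pred ℚ a   -- the rationals < x
    upper : Pred ℚ a   -- the rationals > x

open Cut public

record IsReal (x : Cut a) : Set a where
  field
    lower-inhabited : ∃ (lower x)
    upper-inhabited : ∃ (upper x)
    lower-closed    : ∀ {p q} → p ℚ.< q → lower x q → lower x p
    upper-closed    : ∀ {p q} → p ℚ.< q → upper x p → upper x q
    lower-open      : ∀ {p} → lower x p → ∃ λ q → p ℚ.< q × lower x q
    upper-open      : ∀ {q} → upper x q → ∃ λ p → p ℚ.< q × upper x p
    disjoint        : ∀ {q} → ¬ (lower x q × upper x q)
    located         : ∀ {p q} → p ℚ.< q → lower x p ⊎ upper x q

infix 4 _≤ᶜ_ _<ᶜ_ _≃ᶜ_
infixl 6 _+ᶜ_ _-ᶜ_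
infixl 7 _*ᶜ_

_≤ᶜ_ : Cut a → Cut b → Set (a ⊔ b)
x ≤ᶜ y = (∀ q → lower x q → lower y q) × (∀ q → upper y q → upper x q)

_<ᶜ_ : Cut a → Cut b → Set (a ⊔ b)
x <ᶜ y = ∃ λ q → upper x q × lower y q

_≃ᶜ_ : Cut a → Cut b → Set (a ⊔ b)
x ≃ᶜ y = x ≤ᶜ y × y ≤ᶜ x

fromℚ : ℚ → Cut 0ℓ
fromℚ p = record { lower = λ q → q ℚ.< p ; upper = λ q → p ℚ.< q }

_+ᶜ_ : Cut a → Cut b → Cut (a ⊔ b)
x +ᶜ y = record
  { lower = λ q → ∃₂ λ r s → lower x r × lower y s × q ≡ r ℚ.+ s
  ; upper = λ q → ∃₂ λ r s → upper x r × upper y s × q ≡ r ℚ.+ s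
  }

-ᶜ_ : Cut a → Cut a
-ᶜ x = record { lower = λ q → upper x (ℚ.- q) ; upper = λ q → lower x (ℚ.- q) }

_-ᶜ_ : Cut a → Cut b → Cut (a ⊔ b)
x -ᶜ y = x +ᶜ (-ᶜ y)

-- If r < x < r′ and s < y < s′, then x y lies strictly between the least
-- and the greatest of the four products of endpoints.
_*ᶜ_ : Cut a → Cut b → Cut (a ⊔ b)
x *ᶜ y = record
  { lower = λ q → ∃₂ λ r r′ → ∃₂ λ s s′ →
      lower x r × upper x r′ × lower y s × upper y s′ ×
      q ℚ.< ((r ℚ.* s) ℚ.⊓ (r ℚ.* s′)) ℚ.⊓ ((r′ ℚ.* s) ℚ.⊓ (r′ ℚ.* s′))
  ; upper = λ q → ∃₂ λ r r′ → ∃₂ λ s s′ →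
      lower x r × upper x r′ × lower y s × upper y s′ ×
      ((r ℚ.* s) ℚ.⊔ (r ℚ.* s′)) ℚ.⊔ ((r′ ℚ.* s) ℚ.⊔ (r′ ℚ.* s′)) ℚ.< q
  }

-- Meant for 0 ≤ p.
√ : ℚ → Cut 0ℓ
√ p = record
  { lower = λ q → q ℚ.< 0ℚ ⊎ q ℚ.* q ℚ.< p
  ; upper = λ q → 0ℚ ℚ.< q × p ℚ.< q ℚ.* q
  }

-- The supremum in the extended reals (so sup ∅ = -∞).  For a nonempty
-- bounded set of reals the result satisfies every clause of `IsReal` except
-- `located`, which in general needs excluded middle.
sup : Pred (Cut a) b → Cut (lsuc a ⊔ b)
sup S = record
  { lower = λ q → ∃ λ x → S x × lower x q
  ; upper = λ q → ∃ λ p → p ℚ.< q × (∀ x → S x → x ≤ᶜ fromℚ p)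
  }

-- x ⟶ l : for every ε > 0, eventually |x n - l| < ε.
infix 4 _⟶_
_⟶_ : (ℕ → Cut a) → Cut b → Set (a ⊔ b)
x ⟶ l = ∀ (ε : ℚ) → 0ℚ ℚ.< ε →
  ∃ λ N → ∀ n → N ℕ.≤ n → x n <ᶜ l +ᶜ fromℚ ε × l <ᶜ x n +ᶜ fromℚ ε

------------------------------------------------------------------------
-- Finite simple graphs

record Graph : Set where
  field
    order       : ℕ
    adj         : Fin order → Fin order → Bool
    symmetric   : ∀ u v → adj u v ≡ adj v u
    irreflexive : ∀ v → adj v v ≡ false

  Vertex : Set
  Vertex = Fin order

  Edge : Vertex → Vertex → Set
  Edge u v = T (adj u v)

open Graph public

-- H ⊑ G : an injective homomorphism, i.e. a subgraph of G (not necessarily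
-- induced) isomorphic to H.
infix 4 _⊑_
record _⊑_ (H G : Graph) : Set where
  field
    embed     : Vertex H → Vertex G
    injective : Injective _≡_ _≡_ embed
    edges     : ∀ {u v} → Edge H u v → Edge G (embed u) (embed v)

open _⊑_ public

private
  does-sym : ∀ {n} (u v : Fin n) → does (u Fin.≟ v) ≡ does (v Fin.≟ u)
  does-sym u v with u Fin.≟ v | v Fin.≟ u
  ... | yes _ | yes _ = refl
  ... | no _  | no _  = refl
  ... | yes p | no ¬p = contradiction (sym p) ¬p
  ... | no ¬p | yes p = contradiction (sym p) ¬p

K : ℕ → Graph
K t = record
  { order       = t
  ; adj         = λ u v → not (does (u Fin.≟ v))
  ; symmetric   = λ u v → cong not (does-sym u v)
  ; irreflexive = λ v → cong not (dec-true (v Fin.≟ v) refl)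
  }

-- r vertex-disjoint copies of G; Fin (r * n) is read as Fin r × Fin n.
infixr 8 _copiesOf_
_copiesOf_ : ℕ → Graph → Graph
r copiesOf G = record
  { order       = r ℕ.* order G
  ; adj         = λ u v → does (copy u Fin.≟ copy v) ∧ adj G (vertex u) (vertex v)
  ; symmetric   = λ u v → cong₂ _∧_ (does-sym (copy u) (copy v))
                                    (symmetric G (vertex u) (vertex v))
  ; irreflexive = λ v → trans (cong (does (copy v Fin.≟ copy v) ∧_)
                                    (irreflexive G (vertex v)))
                              (∧-zeroʳ _)
  }
  where
  copy : Fin (r ℕ.* order G) → Fin r
  copy = quotient (order G)

  vertex : Fin (r ℕ.* order G) → Vertex G
  vertex = remainder {r} (order G)

------------------------------------------------------------------------
-- Densities

-- For disjoint X and Y, the number of edges between X and Y.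
e : (G : Graph) → Subset (order G) → Subset (order G) → ℕ
e G X Y = length
  (filter (λ (x , y) → (x ∈? X) ×-dec (y ∈? Y) ×-dec T? (adj G x y))
          (cartesianProduct (allFin (order G)) (allFin (order G))))

nonempty⇒nonZero : ∀ {n} {X : Subset n} → Nonempty X → NonZero ∣ X ∣
nonempty⇒nonZero (_ , x∈X) = ℕ.>-nonZero (ℕ.≤-<-trans ℕ.z≤n (x∈p⇒∣p-x∣<∣p∣ x∈X))

density : (G : Graph) (X Y : Subset (order G)) → Nonempty X → Nonempty Y → ℚ
density G X Y X≢∅ Y≢∅ = _/_ (+ e G X Y) (∣ X ∣ ℕ.* ∣ Y ∣)
  {{m*n≢0 ∣ X ∣ ∣ Y ∣ {{nonempty⇒nonZero X≢∅}} {{nonempty⇒nonZero Y≢∅}}}}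

record PartiteGraph (m : ℕ) : Set where
  field
    graph       : Graph
    part        : Fin m → Subset (order graph)
    nonempty    : ∀ i → Nonempty (part i)
    partition   : ∀ v → ∃! _≡_ λ i → v ∈ part i
    independent : ∀ i {u v} → u ∈ part i → v ∈ part i → ¬ Edge graph u v

open PartiteGraph public

-- The minimum of the d(Vᵢ , Vⱼ), i < j.  Densities are at most 1, so the
-- default value 1 of `min` only matters when there are no such pairs (m ≤ 1).
d : ∀ {m} → PartiteGraph m → ℚ
d {m} G = min 1ℚ
  (map (λ (i , j) → density (graph G) (part G i) (part G j) (nonempty G i) (nonempty G j))
       (filter (λ (i , j) → i <? j) (cartesianProduct (allFin m) (allFin m))))

------------------------------------------------------------------------
-- Traversals and critical densities

record Traversal {m} (G : PartiteGraph m) : Set where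
  field
    subgraph   : Graph
    inclusion  : subgraph ⊑ graph G
    exactlyOne : ∀ i → ∃! _≡_ λ v → embed inclusion v ∈ part G i

open Traversal public

HasTraversal : ∀ {m} → Graph → PartiteGraph m → Set
HasTraversal F G = Σ (Traversal G) λ H → F ⊑ subgraph H

Attainable : ℕ → Graph → Pred (Cut 0ℓ) 0ℓ
Attainable m F x =
  IsReal x × fromℚ 0ℚ ≤ᶜ x × x ≤ᶜ fromℚ 1ℚ ×
  Σ (PartiteGraph m) λ G → x ≤ᶜ fromℚ (d G) × ¬ HasTraversal F G

π : ℕ → Graph → Cut (lsuc 0ℓ)
π m F = sup (Attainable m F)

------------------------------------------------------------------------
-- The number αₜ

α : ℕ → Cut 0ℓ
α t = fromℚ 1ℚ -ᶜ (fromℚ (+ t / 1) -ᶜ √ ((+ t ℤ.* + t ℤ.- + 4) / 1)) *ᶜ fromℚ ½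

1/[_-2] : ∀ t → 3 ℕ.≤ t → ℚ
1/[ t -2] 3≤t = _/_ (+ 1) (t ℕ.∸ 2) {{ℕ.>-nonZero (m<n⇒0<n∸m 3≤t)}}

IsPositiveSolution : ∀ t → 3 ℕ.≤ t → Pred (Cut 0ℓ) 0ℓ
IsPositiveSolution t 3≤t x =
  IsReal x × fromℚ 0ℚ <ᶜ x × x ≃ᶜ fromℚ 1ℚ -ᶜ fromℚ (1/[ t -2] 3≤t) *ᶜ (x *ᶜ x)

{-# OPTIONS --safe #-}
module Submission where

-- Put s = t - 2, so that α = αₜ is the positive root of α² + s α = s.
--
-- Lower bound: for a rational q < α take a vertex (one whole part of clones) joined to
-- a fraction q of each other part, and let these neighbourhoods induce a complete
-- s-partite graph with equal classes.  Parts then have density q or 1 - q²/s ≥ q, but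
-- the neighbours of the special vertex are s-coloured, so it lies in no K_t, whereas
-- a traversal with r t vertices containing r K_t covers every part by a K_t.
--
-- Upper bound: let all densities be at least p > α and call a t-set of parts an edge if
-- some K_t has one vertex in each of them.  Given a part Vᵢ and M other parts, some
-- v ∈ Vᵢ has neighbourhoods of total density at least p M in them; as p² > s (1 - p),
-- the weighted Turán theorem finds a K_{t-1} there once M is large.  So every part
-- forms an edge together with t - 1 parts of any M others.  By Ramsey's theorem some
-- large set X of parts has all its t-subsets as edges.  Tile the parts outside X greedily
-- until at most M are left, cover each of these using t - 1 parts of X, and split the
-- rest of X arbitrarily: this is a perfect tiling, that is, an r K_t-traversal.

-- Averaging controls only the total degree of v into the M parts, not its degree into each of them,
-- so Turán's theorem is needed for weights. Give every part total weight 1, and let W ≥ p M be the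
-- weight of the neighbours of v. Two distinct parts miss at most a fraction 1 - p of their pairs,
-- so the neighbours span edge weight at least W² - (1 - p) M² - p M, where the last term pays for
-- pairs within one part. A K_{s+1} is forced once W² exceeds s times this loss, to leading order
-- once p² > s (1 - p). This is the same balance as q²/s against 1 - q in the construction, which is
-- why the two bounds meet at α; the linear term decides how large M must be. The argument is
-- constructive. Ramsey's theorem is applied to an arbitrary predicate and therefore holds up to
-- double negation, which is enough against a graph assumed to have no traversal. As π is a
-- supremum, it is not known to be located; comparisons with it rest on the locatedness of α, and α
-- is handled through the rational conditions q² + s q < s and s < q² + s q.

-- Order and arithmetic of the rationals.

module RationalArithmetic where

  open import Data.Integer.Base as ℤ using (ℤ; +_; -[1+_])
  import Data.Integer.Properties as ℤ
  open import Data.List.Base using ([]; _∷_)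
  open import Data.Nat.Base as ℕ using (ℕ; zero; suc)
  import Data.Nat.Properties as ℕ
  open import Data.Product using (∃; _,_)
  open import Data.Rational hiding (_≄_)
  open import Data.Rational.Properties
  import Data.Rational.Unnormalised.Base as ℚᵘ
  import Data.Rational.Unnormalised.Properties as ℚᵘ
  open import Data.Sum.Base using (inj₁; inj₂)
  open import Level using (0ℓ)
  open import Relation.Binary.PropositionalEquality
  open import Relation.Nullary using (¬_; yes; no)
  open import Relation.Nullary.Decidable using (dec⇒maybe; toWitness)
  open import Relation.Nullary.Negation using (contradiction)

  open import Tactic.RingSolver using (solve)
  import Tactic.RingSolver.Core.AlmostCommutativeRing as ACR

  ring : ACR.AlmostCommutativeRing 0ℓ 0ℓ
  ring = ACR.fromCommutativeRing +-*-commutativeRing (λ p → dec⇒maybe (0ℚ ≟ p))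

  -- An order relation between polynomial expressions is proved by writing the
  -- difference of its two sides as a combination of quantities of known sign.

  private
    variable
      p q r : ℚ

    cancel-- : ∀ p q → (q - p) + p ≡ q
    cancel-- p q = solve (p ∷ q ∷ []) ring

  <⇒0<- : p < q → 0ℚ < q - p
  <⇒0<- {p} {q} p<q = subst (_< q - p) (+-inverseʳ p) (+-monoˡ-< (- p) p<q)

  ≤⇒0≤- : p ≤ q → 0ℚ ≤ q - p
  ≤⇒0≤- {p} {q} p≤q = subst (_≤ q - p) (+-inverseʳ p) (+-monoˡ-≤ (- p) p≤q)

  0<-⇒< : 0ℚ < q - p → p < q
  0<-⇒< {q} {p} 0<q-p = subst₂ _<_ (+-identityˡ p) (cancel-- p q) (+-monoˡ-< p 0<q-p)

  0≤-⇒≤ : 0ℚ ≤ q - p → p ≤ q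
  0≤-⇒≤ {q} {p} 0≤q-p = subst₂ _≤_ (+-identityˡ p) (cancel-- p q) (+-monoˡ-≤ p 0≤q-p)

  <-from : ∀ {e} → 0ℚ < e → q - p ≡ e → p < q
  <-from 0<e q-p≡e = 0<-⇒< (subst (0ℚ <_) (sym q-p≡e) 0<e)

  ≤-from : ∀ {e} → 0ℚ ≤ e → q - p ≡ e → p ≤ q
  ≤-from 0≤e q-p≡e = 0≤-⇒≤ (subst (0ℚ ≤_) (sym q-p≡e) 0≤e)

  0<+ : 0ℚ < p → 0ℚ < q → 0ℚ < p + q
  0<+ = +-mono-<

  0<+≤ : 0ℚ < p → 0ℚ ≤ q → 0ℚ < p + q
  0<+≤ = +-mono-<-≤

  0≤+ : 0ℚ ≤ p → 0ℚ ≤ q → 0ℚ ≤ p + q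
  0≤+ = +-mono-≤

  0<* : 0ℚ < p → 0ℚ < q → 0ℚ < p * q
  0<* {p} {q} 0<p 0<q = positive⁻¹ _ {{pos*pos⇒pos p {{positive 0<p}} q {{positive 0<q}}}}

  0≤* : 0ℚ ≤ p → 0ℚ ≤ q → 0ℚ ≤ p * q
  0≤* {p} {q} 0≤p 0≤q = nonNegative⁻¹ _ {{nonNeg*nonNeg⇒nonNeg p {{nonNegative 0≤p}} q {{nonNegative 0≤q}}}}

  0≤p² : ∀ p → 0ℚ ≤ p * p
  0≤p² p with ≤-total 0ℚ p
  ... | inj₁ 0≤p = 0≤* 0≤p 0≤p
  ... | inj₂ p≤0 = subst (0ℚ ≤_) (neg² p) (0≤* (≤⇒0≤- p≤0) (≤⇒0≤- p≤0))
    where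
    neg² : ∀ p → (0ℚ - p) * (0ℚ - p) ≡ p * p
    neg² p = solve (p ∷ []) ring

  0<1 : 0ℚ < 1ℚ
  0<1 = toWitness {a? = 0ℚ <? 1ℚ} _

  0<½ : 0ℚ < ½
  0<½ = toWitness {a? = 0ℚ <? ½} _

  *-cancel-< : 0ℚ < r → r * p < r * q → p < q
  *-cancel-< {r} 0<r = *-cancelˡ-<-nonNeg r {{nonNegative (<⇒≤ 0<r)}}

  *-mono-< : 0ℚ < r → p < q → r * p < r * q
  *-mono-< {r} 0<r = *-monoʳ-<-pos r {{positive 0<r}}

  *-mono-≤ : 0ℚ ≤ r → p ≤ q → r * p ≤ r * q
  *-mono-≤ {r} 0≤r = *-monoˡ-≤-nonNeg r {{nonNegative 0≤r}}

  0<⇒nonZero : 0ℚ < p → NonZero p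
  0<⇒nonZero {p} 0<p = pos⇒nonZero p {{positive 0<p}}

  0<1/ : (0<p : 0ℚ < p) → 0ℚ < (1/ p) {{0<⇒nonZero 0<p}}
  0<1/ {p} 0<p = positive⁻¹ _ {{1/pos⇒pos p {{positive 0<p}}}}

  <-square⁻¹ : 0ℚ ≤ q → p * p < q * q → p < q
  <-square⁻¹ {q} {p} 0≤q p²<q² with p <? q
  ... | yes p<q = p<q
  ... | no p≮q = contradiction p²<q² (≤⇒≯ (≤-from
      (0≤+ (0≤* (≤⇒0≤- (≮⇒≥ p≮q)) (≤-trans 0≤q (≮⇒≥ p≮q))) (0≤* (≤⇒0≤- (≮⇒≥ p≮q)) 0≤q))
      (eq p q)))
    where
    eq : ∀ p q → p * p - q * q ≡ (p - q) * p + (p - q) * q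
    eq p q = solve (p ∷ q ∷ []) ring
    ≤⇒≯ : ∀ {p q} → p ≤ q → ¬ (q < p)
    ≤⇒≯ p≤q q<p = <-irrefl refl (<-≤-trans q<p p≤q)

  ≤-square : 0ℚ ≤ p → p ≤ q → p * p ≤ q * q
  ≤-square {p} {q} 0≤p p≤q = ≤-from
    (0≤+ (0≤* (≤⇒0≤- p≤q) (≤-trans 0≤p p≤q)) (0≤* (≤⇒0≤- p≤q) 0≤p)) (eq p q)
    where
    eq : ∀ p q → q * q - p * p ≡ (q - p) * q + (q - p) * p
    eq p q = solve (p ∷ q ∷ []) ring

  ι : ℕ → ℚ
  ι n = + n / 1

  toℚᵘ-/ : ∀ i n .{{_ : ℕ.NonZero n}} → toℚᵘ (i / n) ℚᵘ.≃ (i ℚᵘ./ n)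
  toℚᵘ-/ i (suc n) = toℚᵘ-fromℚᵘ (i ℚᵘ./ suc n)

  ι-+ : ∀ m n → ι (m ℕ.+ n) ≡ ι m + ι n
  ι-+ m n = toℚᵘ-injective (begin
    toℚᵘ (ι (m ℕ.+ n))              ≈⟨ toℚᵘ-/ (+ (m ℕ.+ n)) 1 ⟩
    + (m ℕ.+ n) ℚᵘ./ 1              ≈⟨ ℚᵘ.*≡* (cong (ℤ._* + 1) (sym (cong₂ ℤ._+_ (ℤ.*-identityʳ (+ m)) (ℤ.*-identityʳ (+ n))))) ⟩
    (+ m ℚᵘ./ 1) ℚᵘ.+ (+ n ℚᵘ./ 1)  ≈⟨ ℚᵘ.+-cong (toℚᵘ-/ (+ m) 1) (toℚᵘ-/ (+ n) 1) ⟨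
    toℚᵘ (ι m) ℚᵘ.+ toℚᵘ (ι n)      ≈⟨ toℚᵘ-homo-+ (ι m) (ι n) ⟨
    toℚᵘ (ι m + ι n)                ∎)
    where open ℚᵘ.≃-Reasoning

  ι-* : ∀ m n → ι (m ℕ.* n) ≡ ι m * ι n
  ι-* m n = toℚᵘ-injective (begin
    toℚᵘ (ι (m ℕ.* n))              ≈⟨ toℚᵘ-/ (+ (m ℕ.* n)) 1 ⟩
    + (m ℕ.* n) ℚᵘ./ 1              ≈⟨ ℚᵘ.*≡* (cong (ℤ._* + 1) (ℤ.pos-* m n)) ⟩
    (+ m ℚᵘ./ 1) ℚᵘ.* (+ n ℚᵘ./ 1)  ≈⟨ ℚᵘ.*-cong (toℚᵘ-/ (+ m) 1) (toℚᵘ-/ (+ n) 1) ⟨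
    toℚᵘ (ι m) ℚᵘ.* toℚᵘ (ι n)      ≈⟨ toℚᵘ-homo-* (ι m) (ι n) ⟨
    toℚᵘ (ι m * ι n)                ∎)
    where open ℚᵘ.≃-Reasoning

  0<ι : ∀ n .{{_ : ℕ.NonZero n}} → 0ℚ < ι n
  0<ι n@(suc _) = positive⁻¹ (ι n) {{normalize-pos n 1}}

  0≤ι : ∀ n → 0ℚ ≤ ι n
  0≤ι zero = ≤-refl
  0≤ι n@(suc _) = <⇒≤ (0<ι n)

  ι-mono-≤ : ∀ {m n} → m ℕ.≤ n → ι m ≤ ι n
  ι-mono-≤ {m} {n} m≤n = ≤-from (0≤ι (n ℕ.∸ m)) (begin
    ι n - ι m                      ≡⟨ cong (λ k → ι k - ι m) (ℕ.m+[n∸m]≡n m≤n) ⟨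
    ι (m ℕ.+ (n ℕ.∸ m)) - ι m      ≡⟨ cong (_- ι m) (ι-+ m (n ℕ.∸ m)) ⟩
    (ι m + ι (n ℕ.∸ m)) - ι m      ≡⟨ eq (ι m) (ι (n ℕ.∸ m)) ⟩
    ι (n ℕ.∸ m)                    ∎)
    where
    open ≡-Reasoning
    eq : ∀ p q → (p + q) - p ≡ q
    eq p q = solve (p ∷ q ∷ []) ring

  /-*-cancel : ∀ i n .{{_ : ℕ.NonZero n}} → (+ i / n) * ι n ≡ ι i
  /-*-cancel i n@(suc k) = toℚᵘ-injective (begin
    toℚᵘ ((+ i / n) * ι n)                ≈⟨ toℚᵘ-homo-* (+ i / n) (ι n) ⟩
    toℚᵘ (+ i / n) ℚᵘ.* toℚᵘ (ι n)        ≈⟨ ℚᵘ.*-cong (toℚᵘ-/ (+ i) n) (toℚᵘ-/ (+ n) 1) ⟩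
    (+ i ℚᵘ./ n) ℚᵘ.* (+ n ℚᵘ./ 1)        ≈⟨ ℚᵘ.*≡* (trans (ℤ.*-identityʳ _) (cong (λ d → + i ℤ.* + suc d) (sym (ℕ.*-identityʳ k)))) ⟩
    + i ℚᵘ./ 1                            ≈⟨ toℚᵘ-/ (+ i) 1 ⟨
    toℚᵘ (ι i)                            ∎)
    where open ℚᵘ.≃-Reasoning

  archimedean : ∀ p → ∃ λ n → p < ι n
  archimedean p@(mkℚ -[1+ n ] _ _) = 0 , negative⁻¹ p
  archimedean p@(mkℚ (+ n) _ _) = suc n , *-cancel-< {ι (↧ₙ p)} (0<ι (↧ₙ p)) (begin-strict
    ι (↧ₙ p) * p                ≡⟨ cong (ι (↧ₙ p) *_) (sym (↥p/↧p≡p p)) ⟩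
    ι (↧ₙ p) * (+ n / ↧ₙ p)     ≡⟨ *-comm (ι (↧ₙ p)) _ ⟩
    (+ n / ↧ₙ p) * ι (↧ₙ p)     ≡⟨ /-*-cancel n (↧ₙ p) ⟩
    ι n                         <⟨ <-from 0<1 (trans (cong (_- ι n) (ι-+ 1 n)) (e (ι n))) ⟩
    ι (suc n)                   ≤⟨ ι-mono-≤ (ℕ.m≤m+n (suc n) _) ⟩
    ι (↧ₙ p ℕ.* suc n)          ≡⟨ ι-* (↧ₙ p) (suc n) ⟩
    ι (↧ₙ p) * ι (suc n)        ∎)
    where
    open ≤-Reasoning
    e : ∀ x → (1ℚ + x) - x ≡ 1ℚ
    e x = solve (x ∷ []) ring

  archimedean-* : ∀ p → 0ℚ < q → ∃ λ n → p < ι n * q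
  archimedean-* {q} p 0<q with archimedean (p * (1/ q) {{0<⇒nonZero 0<q}})
  ... | n , p/q<n = n , subst₂ _<_ eq (*-comm q (ι n)) (*-mono-< 0<q p/q<n)
    where
    instance _ = 0<⇒nonZero 0<q
    eq : q * (p * 1/ q) ≡ p
    eq = trans (cong (q *_) (*-comm p (1/ q))) (trans (sym (*-assoc q (1/ q) p))
         (trans (cong (_* p) (*-inverseʳ q)) (*-identityˡ p)))

-- Finite sums of rationals.

module Sums where

  open RationalArithmetic

  open import Data.Bool.Base using (Bool; true; false; T; if_then_else_)
  open import Data.List.Base using (List; []; _∷_; _++_; map; length)
  open import Data.List.Membership.Propositional using (_∈_)
  open import Data.List.Relation.Unary.All as All using (All; []; _∷_)
  open import Data.List.Relation.Unary.AllPairs using (AllPairs; []; _∷_)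
  open import Data.List.Relation.Unary.Any using (here; there)
  open import Data.Nat.Base as ℕ using (ℕ; zero; suc)
  open import Data.Product using (∃; _×_; _,_; proj₁; proj₂)
  open import Data.Rational hiding (_≄_)
  open import Data.Rational.Properties
  open import Data.Sum.Base using (_⊎_; inj₁; inj₂)
  open import Function.Base using (_∘_)
  open import Relation.Binary.PropositionalEquality
  open import Relation.Nullary using (¬_; yes; no; Dec)
  open import Relation.Nullary.Negation using (contradiction)
  open import Tactic.RingSolver using (solve-∀)

  private
    variable
      A B : Set

  ∑ : List A → (A → ℚ) → ℚ
  ∑ []       f = 0ℚ
  ∑ (x ∷ xs) f = f x + ∑ xs f

  ∑-cong : ∀ (xs : List A) {f g} → (∀ {x} → x ∈ xs → f x ≡ g x) → ∑ xs f ≡ ∑ xs g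
  ∑-cong []       f≡g = refl
  ∑-cong (x ∷ xs) f≡g = cong₂ _+_ (f≡g (here refl)) (∑-cong xs (f≡g ∘ there))

  ∑-mono : ∀ (xs : List A) {f g} → (∀ {x} → x ∈ xs → f x ≤ g x) → ∑ xs f ≤ ∑ xs g
  ∑-mono []       f≤g = ≤-refl
  ∑-mono (x ∷ xs) f≤g = +-mono-≤ (f≤g (here refl)) (∑-mono xs (f≤g ∘ there))

  ∑-0 : ∀ (xs : List A) → ∑ xs (λ _ → 0ℚ) ≡ 0ℚ
  ∑-0 []       = refl
  ∑-0 (x ∷ xs) = trans (+-identityˡ _) (∑-0 xs)

  ∑-nonneg : ∀ (xs : List A) {f} → (∀ {x} → x ∈ xs → 0ℚ ≤ f x) → 0ℚ ≤ ∑ xs f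
  ∑-nonneg xs {f} 0≤f = subst (_≤ ∑ xs f) (∑-0 xs) (∑-mono xs 0≤f)

  ∑-+ : ∀ (xs : List A) f g → ∑ xs (λ x → f x + g x) ≡ ∑ xs f + ∑ xs g
  ∑-+ []       f g = refl
  ∑-+ (x ∷ xs) f g = trans (cong (f x + g x +_) (∑-+ xs f g)) (eq (f x) (g x) (∑ xs f) (∑ xs g))
    where
    eq : ∀ a b c d → a + b + (c + d) ≡ a + c + (b + d)
    eq = solve-∀ ring

  ∑-*ˡ : ∀ (xs : List A) c f → ∑ xs (λ x → c * f x) ≡ c * ∑ xs f
  ∑-*ˡ []       c f = sym (*-zeroʳ c)
  ∑-*ˡ (x ∷ xs) c f = trans (cong (c * f x +_) (∑-*ˡ xs c f)) (sym (*-distribˡ-+ c _ _))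

  ∑-*ʳ : ∀ (xs : List A) c f → ∑ xs (λ x → f x * c) ≡ ∑ xs f * c
  ∑-*ʳ xs c f = trans (∑-cong xs λ _ → *-comm _ c) (trans (∑-*ˡ xs c f) (*-comm c _))

  ∑-const : ∀ (xs : List A) c → ∑ xs (λ _ → c) ≡ ι (length xs) * c
  ∑-const []       c = sym (*-zeroˡ c)
  ∑-const (x ∷ xs) c = trans (cong (c +_) (∑-const xs c))
    (trans (eq c (ι (length xs))) (cong (_* c) (sym (ι-+ 1 (length xs)))))
    where
    eq : ∀ c n → c + n * c ≡ (1ℚ + n) * c
    eq = solve-∀ ring

  ∑-++ : ∀ (xs ys : List A) f → ∑ (xs ++ ys) f ≡ ∑ xs f + ∑ ys f
  ∑-++ []       ys f = sym (+-identityˡ _)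
  ∑-++ (x ∷ xs) ys f = trans (cong (f x +_) (∑-++ xs ys f)) (sym (+-assoc (f x) _ _))

  ∑-map : ∀ (h : A → B) xs f → ∑ (map h xs) f ≡ ∑ xs (f ∘ h)
  ∑-map h []       f = refl
  ∑-map h (x ∷ xs) f = cong (f (h x) +_) (∑-map h xs f)

  ∑-swap : ∀ (xs : List A) (ys : List B) (f : A → B → ℚ) →
           ∑ xs (λ x → ∑ ys (f x)) ≡ ∑ ys (λ y → ∑ xs (λ x → f x y))
  ∑-swap []       ys f = sym (∑-0 ys)
  ∑-swap (x ∷ xs) ys f = trans (cong (∑ ys (f x) +_) (∑-swap xs ys f)) (sym (∑-+ ys _ _))

  ∑-*-∑ : ∀ (xs : List A) (ys : List B) f g → ∑ xs f * ∑ ys g ≡ ∑ xs (λ x → ∑ ys (λ y → f x * g y))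
  ∑-*-∑ xs ys f g = trans (sym (∑-*ʳ xs (∑ ys g) f)) (∑-cong xs λ {x} _ → sym (∑-*ˡ ys (f x) g))

  -- The second alternative takes the place of a nonemptiness assumption: in `turán` it is the case
  -- of a vanishing weight, in `largeDegree` it is refuted by the nonemptiness of the part.
  maximal : ∀ {P : A → Set} (P? : ∀ x → Dec (P x)) (f : A → ℚ) xs →
            (∃ λ u → u ∈ xs × P u × (∀ {v} → v ∈ xs → P v → f v ≤ f u)) ⊎
            (∀ {v} → v ∈ xs → ¬ P v)
  maximal P? f [] = inj₂ λ ()
  maximal P? f (x ∷ xs) with P? x | maximal P? f xs
  ... | no ¬Px | inj₂ ¬P = inj₂ λ { (here refl) → ¬Px ; (there v∈) → ¬P v∈ }
  ... | no ¬Px | inj₁ (u , u∈ , Pu , max) =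
    inj₁ (u , there u∈ , Pu , λ { (here refl) Pv → contradiction Pv ¬Px ; (there v∈) → max v∈ })
  ... | yes Px | inj₂ ¬P =
    inj₁ (x , here refl , Px , λ { (here refl) _ → ≤-refl ; (there v∈) Pv → contradiction Pv (¬P v∈) })
  ... | yes Px | inj₁ (u , u∈ , Pu , max) with ≤-total (f x) (f u)
  ...   | inj₁ fx≤fu = inj₁ (u , there u∈ , Pu , λ { (here refl) _ → fx≤fu ; (there v∈) → max v∈ })
  ...   | inj₂ fu≤fx =
    inj₁ (x , here refl , Px , λ { (here refl) _ → ≤-refl ; (there v∈) Pv → ≤-trans (max v∈ Pv) fu≤fx })

  𝟙 : Bool → ℚ
  𝟙 b = if b then 1ℚ else 0ℚ

  0≤𝟙 : ∀ b → 0ℚ ≤ 𝟙 b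
  0≤𝟙 false = ≤-refl
  0≤𝟙 true  = <⇒≤ 0<1

  𝟙≤1 : ∀ b → 𝟙 b ≤ 1ℚ
  𝟙≤1 false = <⇒≤ 0<1
  𝟙≤1 true  = ≤-refl

  -- Turán's theorem for weighted graphs.

  module Turán {A : Set} (adjacent : A → A → Bool)
               (adjacent-sym : ∀ u v → adjacent u v ≡ adjacent v u)
               (vs : List A) where

    Adjacent : A → A → Set
    Adjacent u v = T (adjacent u v)

    degree : (A → ℚ) → A → ℚ
    degree w u = ∑ vs λ v → w v * 𝟙 (adjacent u v)

    -- Ordered pairs are summed, so every edge counts twice.
    edgeWeight : (A → ℚ) → ℚ
    edgeWeight w = ∑ vs λ u → w u * degree w u

    Nonneg : (A → ℚ) → Set
    Nonneg w = ∀ v → 0ℚ ≤ w v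

    -- The weight cut down to the neighbourhood of `u`. The vertex list stays fixed through the
    -- induction of `turán` and only the weight shrinks; its total is `degree w u` by definition.
    restrict : (A → ℚ) → A → A → ℚ
    restrict w u v = w v * 𝟙 (adjacent u v)

    module _ {w : A → ℚ} (0≤w : Nonneg w) where

      restrict-nonneg : ∀ u → Nonneg (restrict w u)
      restrict-nonneg u v = 0≤* (0≤w v) (0≤𝟙 (adjacent u v))

      degree-nonneg : ∀ u → 0ℚ ≤ degree w u
      degree-nonneg u = ∑-nonneg vs λ {v} _ → restrict-nonneg u v

      -- An adjacent pair lies inside the neighbourhood of `u` or has its first or its second member
      -- outside. The vertices outside weigh W - D in total and have degree at most D, so each of
      -- the last two cases contributes at most (W - D) D.
      edgeWeight-restrict : ∀ u → (∀ {v} → v ∈ vs → 0ℚ < w v → degree w v ≤ degree w u) →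
        let W = ∑ vs w ; D = degree w u in
        edgeWeight w ≤ edgeWeight (restrict w u) + ((W - D) * D + (W - D) * D)
      edgeWeight-restrict u max = begin
        edgeWeight w
          ≡⟨ ∑-cong vs (λ {v} _ → ∑-*ˡ vs (w v) _) ⟨
        ∑ vs (λ v → ∑ vs λ x → w v * (w x * a v x))
          ≤⟨ ∑-mono vs (λ {v} _ → ∑-mono vs λ {x} _ → split v x) ⟩
        ∑ vs (λ v → ∑ vs λ x → inside v x + (outside v x + outside x v))
          ≡⟨ ∑-cong vs (λ {v} _ → trans (∑-+ vs _ _) (cong (∑ vs (inside v) +_) (∑-+ vs _ _))) ⟩
        ∑ vs (λ v → ∑ vs (inside v) + (∑ vs (outside v) + ∑ vs (λ x → outside x v)))
          ≡⟨ trans (∑-+ vs _ _) (cong (∑ vs (λ v → ∑ vs (inside v)) +_) (∑-+ vs _ _)) ⟩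
        ∑ vs (λ v → ∑ vs (inside v)) +
          (∑ vs (λ v → ∑ vs (outside v)) + ∑ vs (λ v → ∑ vs λ x → outside x v))
          ≡⟨ cong₂ _+_ (∑-cong vs λ {v} _ → ∑-*ˡ vs (restrict w u v) _)
                       (cong (∑ vs (λ v → ∑ vs (outside v)) +_) (∑-swap vs vs (λ v x → outside x v))) ⟩
        edgeWeight (restrict w u) +
          (∑ vs (λ v → ∑ vs (outside v)) + ∑ vs (λ v → ∑ vs (outside v)))
          ≤⟨ +-monoʳ-≤ (edgeWeight (restrict w u)) (+-mono-≤ outside-≤ outside-≤) ⟩
        edgeWeight (restrict w u) + ((W - D) * D + (W - D) * D) ∎
        where
        open ≤-Reasoning
        W = ∑ vs w
        D = degree w u
        a : A → A → ℚ
        a v x = 𝟙 (adjacent v x)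
        inside outside : A → A → ℚ
        inside v x = restrict w u v * (restrict w u x * a v x)
        outside v x = w v * (1ℚ - a u v) * (w x * a v x)

        split : ∀ v x → w v * (w x * a v x) ≤ inside v x + (outside v x + outside x v)
        -- The excess of the right-hand side comes from the edges with both ends outside the
        -- neighbourhood, which are counted twice.
        split v x rewrite adjacent-sym x v = ≤-from
          (0≤* (0≤* (0≤* (0≤w v) (0≤w x)) (0≤𝟙 (adjacent v x)))
               (0≤* (≤⇒0≤- (𝟙≤1 (adjacent u v))) (≤⇒0≤- (𝟙≤1 (adjacent u x)))))
          (eq (w v) (w x) (a v x) (a u v) (a u x))
          where
          eq : ∀ wv wx e b c →
               wv * b * (wx * c * e) + (wv * (1ℚ - b) * (wx * e) + wx * (1ℚ - c) * (wv * e)) - wv * (wx * e)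
               ≡ wv * wx * e * ((1ℚ - b) * (1ℚ - c))
          eq = solve-∀ ring

        outside-≤ : ∑ vs (λ v → ∑ vs (outside v)) ≤ (W - D) * D
        outside-≤ = begin
          ∑ vs (λ v → ∑ vs (outside v))                  ≡⟨ ∑-cong vs (λ {v} _ → ∑-*ˡ vs (w v * (1ℚ - a u v)) _) ⟩
          ∑ vs (λ v → w v * (1ℚ - a u v) * degree w v)   ≤⟨ ∑-mono vs degree-≤ ⟩
          ∑ vs (λ v → w v * (1ℚ - a u v) * D)            ≡⟨ ∑-*ʳ vs D _ ⟩
          ∑ vs (λ v → w v * (1ℚ - a u v)) * D            ≡⟨ cong (_* D) (∑-cong vs λ {v} _ → eq (w v) (a u v)) ⟩
          ∑ vs (λ v → w v + - 1ℚ * restrict w u v) * D   ≡⟨ cong (_* D) (trans (∑-+ vs w _) (cong (W +_) (∑-*ˡ vs (- 1ℚ) _))) ⟩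
          (W + - 1ℚ * D) * D                             ≡⟨ cong (λ x → (W + x) * D) (eq′ D) ⟩
          (W - D) * D ∎
          where
          eq : ∀ x y → x * (1ℚ - y) ≡ x + - 1ℚ * (x * y)
          eq = solve-∀ ring
          eq′ : ∀ x → - 1ℚ * x ≡ - x
          eq′ = solve-∀ ring
          degree-≤ : ∀ {v} → v ∈ vs → w v * (1ℚ - a u v) * degree w v ≤ w v * (1ℚ - a u v) * D
          degree-≤ {v} v∈vs with 0ℚ <? w v
          ... | yes 0<wv = *-mono-≤ (0≤* (0≤w v) (≤⇒0≤- (𝟙≤1 (adjacent u v)))) (max v∈vs 0<wv)
          ... | no 0≮wv rewrite ≤-antisym (≮⇒≥ 0≮wv) (0≤w v) = ≤-reflexive (zero₃ (1ℚ - a u v) (degree w v) D)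
            where
            zero₃ : ∀ x y z → 0ℚ * x * y ≡ 0ℚ * x * z
            zero₃ = solve-∀ ring

      edgeWeight-≤ : ∀ u → (∀ {v} → v ∈ vs → 0ℚ < w v → degree w v ≤ degree w u) →
                     edgeWeight w ≤ ∑ vs w * degree w u
      edgeWeight-≤ u max = ≤-trans (∑-mono vs degree-≤) (≤-reflexive (∑-*ʳ vs (degree w u) w))
        where
        degree-≤ : ∀ {v} → v ∈ vs → w v * degree w v ≤ w v * degree w u
        degree-≤ {v} v∈vs with 0ℚ <? w v
        ... | yes 0<wv = *-mono-≤ (0≤w v) (max v∈vs 0<wv)
        ... | no 0≮wv rewrite ≤-antisym (≮⇒≥ 0≮wv) (0≤w v) =
          ≤-reflexive (trans (*-zeroˡ (degree w v)) (sym (*-zeroˡ (degree w u))))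

    -- Positivity of the weights is what locates a clique: for a restricted weight it gives
    -- adjacency to `u`, and for the weight used later on it gives adjacency to a chosen vertex and
    -- membership in prescribed parts.
    Clique : (A → ℚ) → ℕ → Set
    Clique w k = ∃ λ us → length us ≡ k × AllPairs Adjacent us × All (λ u → u ∈ vs × 0ℚ < w u) us

    -- The hypothesis says that the adjacent ordered pairs weigh more than (1 - 1/s) W²,
    -- where W is the total weight; without division it makes sense for s = 0.
    turán : ∀ s (w : A → ℚ) → Nonneg w →
            ι s * (∑ vs w * ∑ vs w) < ι s * edgeWeight w + ∑ vs w * ∑ vs w → Clique w (suc s)
    turán s w 0≤w dense with maximal (λ v → 0ℚ <? w v) (degree w) vs
    ... | inj₂ w≯0 = contradiction dense (<-irrefl (trans (cong (λ x → ι s * (x * x)) W≡0)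
            (trans (eq (ι s)) (sym (cong₂ (λ e x → ι s * e + x * x) e≡0 W≡0)))))
      where
      w≡0 : ∀ {v} → v ∈ vs → w v ≡ 0ℚ
      w≡0 {v} v∈vs = ≤-antisym (≮⇒≥ (w≯0 v∈vs)) (0≤w v)
      W≡0 : ∑ vs w ≡ 0ℚ
      W≡0 = trans (∑-cong vs w≡0) (∑-0 vs)
      e≡0 : edgeWeight w ≡ 0ℚ
      e≡0 = trans (∑-cong vs λ {v} v∈vs → trans (cong (_* degree w v) (w≡0 v∈vs)) (*-zeroˡ (degree w v))) (∑-0 vs)
      eq : ∀ s → s * (0ℚ * 0ℚ) ≡ s * 0ℚ + 0ℚ * 0ℚ
      eq = solve-∀ ring
    turán zero w 0≤w dense | inj₁ (u , u∈vs , 0<wu , _) = u ∷ [] , refl , [] ∷ [] , (u∈vs , 0<wu) ∷ []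
    -- With `u` of maximal degree, the density condition with one colour less is tested on the
    -- neighbourhood of `u`. If it holds, `u` extends a clique found there; if it fails,
    -- `sparse⇒sparse` shows that the whole weight fails its condition as well.
    turán (suc s) w 0≤w dense | inj₁ (u , u∈vs , 0<wu , max)
      with ι s * (degree w u * degree w u) <? ι s * edgeWeight (restrict w u) + degree w u * degree w u
    ... | yes dense′ with turán s (restrict w u) (restrict-nonneg 0≤w u) dense′
    ...   | us , len , clique , positive =
      u ∷ us , cong suc len , All.map (proj₂ ∘ neighbour ∘ proj₂) positive ∷ clique ,
      (u∈vs , 0<wu) ∷ All.map (λ (v∈vs , 0<w′v) → v∈vs , proj₁ (neighbour 0<w′v)) positive
      where
      neighbour : ∀ {v} → 0ℚ < restrict w u v → 0ℚ < w v × Adjacent u v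
      neighbour {v} 0<w′v with adjacent u v
      ... | true  = subst (0ℚ <_) (*-identityʳ (w v)) 0<w′v , _
      ... | false = contradiction (subst (0ℚ <_) (*-zeroʳ (w v)) 0<w′v) (<-irrefl refl)
    turán (suc s) w 0≤w dense | inj₁ (u , u∈vs , 0<wu , max) | no sparse =
      contradiction (sparse⇒sparse s (≮⇒≥ sparse)) λ h → <-irrefl refl (<-≤-trans dense h)
      where
      W = ∑ vs w
      D = degree w u
      e = edgeWeight w
      e′ = edgeWeight (restrict w u)
      0≤D : 0ℚ ≤ D
      0≤D = degree-nonneg 0≤w u
      sparse⇒sparse : ∀ s → ι s * e′ + D * D ≤ ι s * (D * D) → ι (suc s) * e + W * W ≤ ι (suc s) * (W * W)
      -- The identity of the next clause is multiplied by s, so s = 0 stands apart: here the maximal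
      -- degree D vanishes and no edge has positive weight.
      sparse⇒sparse zero D²≤0 = ≤-from (≤⇒0≤- e≤0) (eq e W)
        where
        eq : ∀ e W → 1ℚ * (W * W) - (1ℚ * e + W * W) ≡ 0ℚ - e
        eq = solve-∀ ring
        D≡0 : D ≡ 0ℚ
        D≡0 = ≤-antisym (≮⇒≥ λ 0<D → <-irrefl refl (<-≤-trans (0<* 0<D 0<D)
                (subst₂ _≤_ (trans (cong (_+ D * D) (*-zeroˡ e′)) (+-identityˡ (D * D))) (*-zeroˡ (D * D)) D²≤0))) 0≤D
        e≤0 : e ≤ 0ℚ
        e≤0 = ≤-trans (edgeWeight-≤ 0≤w u max) (≤-reflexive (trans (cong (W *_) D≡0) (*-zeroʳ W)))
      -- The slack is a combination of the slacks of `edgeWeight-restrict` and of `sparse` plus the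
      -- square of s W - (s + 1) D. That square vanishes at D = s W / (s + 1), the degree in a
      -- balanced complete (s + 1)-partite graph.
      sparse⇒sparse s@(suc s-1) sparse = *-cancelˡ-≤-pos (ι s) {{positive (0<ι s)}} (≤-from
        (0≤+ (0≤+ (0≤* (0≤* 0≤1+σ (0≤ι s)) (≤⇒0≤- (edgeWeight-restrict 0≤w u max)))
                  (0≤* 0≤1+σ (≤⇒0≤- sparse)))
             (0≤p² (ι s * W - (1ℚ + ι s) * D)))
        (trans (cong (λ x → ι s * (x * (W * W)) - ι s * (x * e + W * W)) (ι-+ 1 s)) (eq (ι s) W D e e′)))
        where
        0≤1+σ : 0ℚ ≤ 1ℚ + ι s
        0≤1+σ = 0≤+ (<⇒≤ 0<1) (0≤ι s)
        eq : ∀ σ W D e e′ → σ * ((1ℚ + σ) * (W * W)) - σ * ((1ℚ + σ) * e + W * W) ≡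
             (1ℚ + σ) * σ * (e′ + ((W - D) * D + (W - D) * D) - e) +
             (1ℚ + σ) * (σ * (D * D) - (σ * e′ + D * D)) +
             (σ * W - (1ℚ + σ) * D) * (σ * W - (1ℚ + σ) * D)
        eq = solve-∀ ring

-- Ramsey's theorem and perfect tilings of uniform hypergraphs.

module Hypergraphs where

  open import Data.List.Base using (List; []; _∷_; _++_; length; take; drop)
  import Data.List.Properties as List
  open import Data.List.Membership.Propositional using (_∈_)
  open import Data.List.Membership.Propositional.Properties using (∈-∃++)
  open import Data.List.Relation.Unary.All as All using ([]; _∷_)
  import Data.List.Relation.Unary.All.Properties as All
  open import Data.List.Relation.Unary.AllPairs using ([]; _∷_)
  open import Data.List.Relation.Unary.Any using (here; there)
  open import Data.List.Relation.Unary.Unique.Propositional using (Unique)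
  open import Data.List.Relation.Binary.Permutation.Propositional
    using (_↭_; ↭-refl; ↭-sym; ↭-trans; ↭-prep; ↭-reflexive; ↭⇒↭ₛ)
  import Data.List.Relation.Binary.Permutation.Setoid.Properties as Setoid
  open import Data.List.Relation.Binary.Permutation.Propositional.Properties
  open import Data.List.Relation.Binary.Sublist.Propositional
    using (_⊆_; []; _∷_; _∷ʳ_; ⊆-refl; ⊆-trans; minimum; lookup)
  open import Data.List.Relation.Binary.Sublist.Propositional.Properties
    using (take-⊆; drop-⊆; length-mono-≤)
    renaming (++⁺ˡ to ⊆-++⁺ˡ; ++⁺ʳ to ⊆-++⁺ʳ)
  open import Data.Nat.Base
  open import Data.Nat.Properties
  open import Data.Nat.Divisibility using (_∣_; divides; ∣m+n∣m⇒∣n; ∣-refl)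
  open import Data.Product using (∃; ∃₂; _×_; _,_; proj₁; proj₂)
  open import Data.Sum.Base using (_⊎_; inj₁; inj₂)
  open import Function.Base using (_∘_; case_of_)
  open import Relation.Binary.Definitions using (DecidableEquality)
  open import Relation.Binary.PropositionalEquality
  open import Relation.Nullary using (¬_; yes; no)
  open import Relation.Nullary.Negation using (contradiction)

  private
    variable
      A : Set

  Unique-resp-↭ : ∀ {xs ys : List A} → xs ↭ ys → Unique xs → Unique ys
  Unique-resp-↭ xs↭ys = Setoid.Unique-resp-↭ (setoid _) (↭⇒↭ₛ xs↭ys)

  Unique-resp-⊆ : ∀ {xs ys : List A} → xs ⊆ ys → Unique ys → Unique xs
  Unique-resp-⊆ []            _              = []
  Unique-resp-⊆ (y ∷ʳ xs⊆)    (_ ∷ unique)   = Unique-resp-⊆ xs⊆ unique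
  Unique-resp-⊆ (refl ∷ xs⊆)  (x∉ ∷ unique)  =
    All.tabulate (λ x∈xs → All.lookup x∉ (lookup xs⊆ x∈xs)) ∷ Unique-resp-⊆ xs⊆ unique

  -- Subsets are sublists of one fixed list, hence always listed in its order; this allows an
  -- arbitrary predicate on lists to serve as a colouring of sets.
  Homogeneous : ℕ → (List A → Set) → List A → Set
  Homogeneous k P ys = ∀ {zs} → zs ⊆ ys → length zs ≡ k → P zs

  HomogeneousSublist : ℕ → ℕ → (List A → Set) → List A → Set
  HomogeneousSublist k n P xs = ∃ λ ys → ys ⊆ xs × length ys ≡ n × Homogeneous k P ys

  -- The two colours are `P` and its negation. The double negation is there because `P` is an
  -- arbitrary predicate, with no decision procedure.
  Ramsey : Set → ℕ → ℕ → ℕ → ℕ → Set₁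
  Ramsey A k a b R = ∀ (P : List A → Set) xs → R ≤ length xs →
    ¬ ¬ (HomogeneousSublist k a P xs ⊎ HomogeneousSublist k b (¬_ ∘ P) xs)

  -- The recursion of Erdős and Rado. The k-subsets of the tail are coloured by the colour they get
  -- together with `x`. In a homogeneous set for this link colouring the smaller Ramsey number
  -- applies, and `x` can be added to a set found there in the colour of the link.
  ramsey-step : ∀ {k a b a′ b′ R} → Ramsey A (suc k) a (suc b) a′ → Ramsey A (suc k) (suc a) b b′ →
                Ramsey A k a′ b′ R → Ramsey A (suc k) (suc a) (suc b) (suc R)
  ramsey-step {A = A} {k} a-less b-less link P (x ∷ xs) (s≤s R≤) ¬h = link (P ∘ (x ∷_)) xs R≤ λ
    { (inj₁ (ys , ys⊆ , len , link-hom)) → a-less P ys (≤-reflexive (sym len)) λ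
      { (inj₁ (zs , zs⊆ , len′ , hom)) →
          ¬h (inj₁ (x ∷ zs , refl ∷ ⊆-trans zs⊆ ys⊆ , cong suc len′ , cons {P} link-hom zs⊆ hom))
      ; (inj₂ (zs , zs⊆ , len′ , hom)) →
          ¬h (inj₂ (zs , x ∷ʳ ⊆-trans zs⊆ ys⊆ , len′ , hom)) }
    ; (inj₂ (ys , ys⊆ , len , link-hom)) → b-less P ys (≤-reflexive (sym len)) λ
      { (inj₁ (zs , zs⊆ , len′ , hom)) →
          ¬h (inj₁ (zs , x ∷ʳ ⊆-trans zs⊆ ys⊆ , len′ , hom))
      ; (inj₂ (zs , zs⊆ , len′ , hom)) →
          ¬h (inj₂ (x ∷ zs , refl ∷ ⊆-trans zs⊆ ys⊆ , cong suc len′ , cons {¬_ ∘ P} link-hom zs⊆ hom)) } }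
    where
    cons : ∀ {P : List A → Set} {x ys zs} → Homogeneous k (P ∘ (x ∷_)) ys → zs ⊆ ys →
           Homogeneous (suc k) P zs → Homogeneous (suc k) P (x ∷ zs)
    cons link-hom zs⊆ys hom (_ ∷ʳ us⊆)    len = hom us⊆ len
    cons link-hom zs⊆ys hom (refl ∷ us⊆)  len = link-hom (⊆-trans us⊆ zs⊆ys) (suc-injective len)

  ramsey : ∀ k a b → ∃ λ R → ∀ {A} → Ramsey A k a b R
  -- The only set of size 0 is `[]`, so all lists are homogeneous in the colour of `[]`; a + b
  -- leaves room for a sublist of either length.
  ramsey zero a b = a + b , λ {A} P xs a+b≤ ¬h →
    ¬h (inj₂ (take b xs , take-⊆ b xs , take-length b xs (≤-trans (m≤n+m b a) a+b≤) ,
      λ { {[]} _ _ P[] → ¬h (inj₁ (take a xs , take-⊆ a xs ,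
        take-length a xs (≤-trans (m≤m+n a b) a+b≤) , λ { {[]} _ _ → P[] })) }))
    where
    take-length : ∀ {A : Set} n (xs : List A) → n ≤ length xs → length (take n xs) ≡ n
    take-length n xs n≤ = trans (List.length-take n xs) (m≤n⇒m⊓n≡m n≤)
  ramsey (suc k) zero b = 0 , λ P xs _ ¬h → ¬h (inj₁ ([] , minimum xs , refl , λ { [] () }))
  ramsey (suc k) (suc a) zero = 0 , λ P xs _ ¬h → ¬h (inj₂ ([] , minimum xs , refl , λ { [] () }))
  ramsey (suc k) (suc a) (suc b) with ramsey (suc k) a (suc b) | ramsey (suc k) (suc a) b
  ... | a′ , a-less | b′ , b-less with ramsey k a′ b′
  ...   | R , link = suc R , ramsey-step a-less b-less link

  -- The homogeneous set must cover up to M left-over vertices, spending t of its own on each, and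
  -- still have M to choose from: this is M + M t. In the other colour M + 1 vertices suffice, since
  -- `Extendable` finds an edge among them.
  tilingNumber : ℕ → ℕ → ℕ
  tilingNumber t M = proj₁ (ramsey (suc t) (M + M * t) (suc M))

  module _ (_≟_ : DecidableEquality A) where

    open import Data.List.Membership.DecPropositional _≟_ using (_∈?_)

    -- Homogeneity passes to sublists only, while the vertices to be removed come in an order of
    -- their own. They are therefore re-listed as a sublist `zs`, and the complement `rest` is again
    -- a sublist and stays homogeneous.
    partition-sublist : ∀ {js ys : List A} → Unique js → (∀ {x} → x ∈ js → x ∈ ys) →
      ∃₂ λ zs rest → zs ⊆ ys × rest ⊆ ys × ys ↭ zs ++ rest × zs ↭ js
    partition-sublist {[]} {[]} _ _ = [] , [] , [] , [] , ↭-refl , ↭-refl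
    partition-sublist {j ∷ js} {[]} _ js⊆ys = case js⊆ys (here refl) of λ ()
    partition-sublist {js} {y ∷ ys} unique js⊆ys with y ∈? js
    ... | no y∉js = let zs , rest , zs⊆ , rest⊆ , perm , zs↭js = partition-sublist unique js⊆ys′ in
      zs , y ∷ rest , y ∷ʳ zs⊆ , refl ∷ rest⊆ , ↭-trans (↭-prep y perm) (↭-sym (shift y zs rest)) , zs↭js
      where
      js⊆ys′ : ∀ {x} → x ∈ js → x ∈ ys
      js⊆ys′ x∈js with js⊆ys x∈js
      ... | here refl = contradiction x∈js y∉js
      ... | there x∈ys = x∈ys
    ... | yes y∈js with as , bs , refl ← ∈-∃++ y∈js =
      let zs , rest , zs⊆ , rest⊆ , perm , zs↭ = partition-sublist (tail unique′) js⊆ys′ in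
      y ∷ zs , rest , refl ∷ zs⊆ , y ∷ʳ rest⊆ , ↭-prep y perm , ↭-trans (↭-prep y zs↭) (↭-sym (shift y as bs))
      where
      unique′ : Unique (y ∷ as ++ bs)
      unique′ = Unique-resp-↭ (shift y as bs) unique
      tail : ∀ {x xs} → Unique (x ∷ xs) → Unique {A = A} xs
      tail (_ ∷ u) = u
      js⊆ys′ : ∀ {x} → x ∈ as ++ bs → x ∈ ys
      js⊆ys′ x∈ with js⊆ys (∈-resp-↭ (↭-sym (shift y as bs)) (there x∈)) | unique′
      ... | there x∈ys | _ = x∈ys
      ... | here refl | x∉ ∷ _ = contradiction refl (All.lookup x∉ x∈)

    -- The edges of a (t + 1)-uniform hypergraph; lists stand for vertex sets.
    module Tilings (t : ℕ) (Block : List A → Set)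
                   (Block-resp-↭ : ∀ {js ks} → js ↭ ks → Block js → Block ks) where

      data Tiling : List A → Set where
        []    : Tiling []
        block : ∀ {js rest zs} → Block js → length js ≡ suc t → Tiling rest → zs ↭ js ++ rest → Tiling zs

      Tiling-resp-↭ : ∀ {xs ys} → xs ↭ ys → Tiling xs → Tiling ys
      Tiling-resp-↭ xs↭ys [] rewrite ↭-empty-inv (↭-sym xs↭ys) = []
      Tiling-resp-↭ xs↭ys (block b len rest zs↭) = block b len rest (↭-trans (↭-sym xs↭ys) zs↭)

      Extendable : ℕ → Set
      Extendable M = ∀ i S → Unique (i ∷ S) → M ≤ length S →
        ∃ λ js → length js ≡ t × Unique js × (∀ {j} → j ∈ js → j ∈ S) × Block (i ∷ js)

      homogeneous-tiling : ∀ n X → length X ≡ n * suc t → Homogeneous (suc t) Block X → Tiling X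
      homogeneous-tiling zero [] _ _ = []
      homogeneous-tiling (suc n) X len hom = block (hom (take-⊆ (suc t) X) take-len) take-len
        (homogeneous-tiling n (drop (suc t) X) drop-len λ zs⊆ → hom (⊆-trans zs⊆ (drop-⊆ (suc t) X)))
        (↭-reflexive (sym (List.take++drop≡id (suc t) X)))
        where
        take-len : length (take (suc t) X) ≡ suc t
        take-len = trans (List.length-take (suc t) X)
          (m≤n⇒m⊓n≡m (subst (suc t ≤_) (sym len) (m≤m+n (suc t) (n * suc t))))
        drop-len : length (drop (suc t) X) ≡ n * suc t
        drop-len = trans (List.length-drop (suc t) X) (trans (cong (_∸ suc t) len) (m+n∸m≡n (suc t) (n * suc t)))

      divides-rest : ∀ {js rest zs} → length js ≡ suc t → zs ↭ js ++ rest →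
                     suc t ∣ length zs → suc t ∣ length {A = A} rest
      divides-rest {js} {rest} len zs↭ t∣ = ∣m+n∣m⇒∣n
        (subst (suc t ∣_) (trans (↭-length zs↭) (trans (List.length-++ js) (cong (_+ length rest) len))) t∣)
        ∣-refl

      unique-rest : ∀ {js rest zs} → zs ↭ js ++ rest → Unique zs → Unique {A = A} rest
      unique-rest {js} zs↭ unique = Unique-resp-⊆ (⊆-++⁺ˡ js ⊆-refl) (Unique-resp-↭ zs↭ unique)

      -- Each vertex of `L` takes t vertices out of `X`, which preserves the inequality, so `X` has
      -- at least M elements whenever `ext` is applied to it. Once `L` is exhausted, divisibility
      -- lets the rest of `X` be cut into consecutive blocks.
      cover : ∀ {M} → Extendable M → ∀ L X → Unique (L ++ X) → Homogeneous (suc t) Block X →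
              M + length L * t ≤ length X → suc t ∣ length (L ++ X) → Tiling (L ++ X)
      cover ext [] X _ hom _ (divides n len) = homogeneous-tiling n X len hom
      cover {M} ext (l ∷ L) X unique@(l∉ ∷ uLX) hom M≤ t∣
        with js , len , uniq-js , js⊆X , b ← ext l X (All.++⁻ʳ L l∉ ∷ unique-rest {js = L} ↭-refl uLX) (m+n≤o⇒m≤o M M≤)
        with zs , rest , zs⊆ , rest⊆ , X↭ , zs↭js ← partition-sublist uniq-js js⊆X =
        block b (cong suc len)
          (cover ext L rest (unique-rest {js = l ∷ js} perm unique) (λ ys⊆ → hom (⊆-trans ys⊆ rest⊆))
                 M≤′ (divides-rest {js = l ∷ js} (cong suc len) perm t∣))
          perm
        where
        perm : l ∷ L ++ X ↭ (l ∷ js) ++ (L ++ rest)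
        perm = ↭-prep l (↭-trans (++⁺ˡ L (↭-trans X↭ (++⁺ʳ rest zs↭js))) (shifts L js))
        M≤′ : M + length L * t ≤ length rest
        M≤′ = +-cancelʳ-≤ t (M + length L * t) (length rest) (begin
          M + length L * t + t    ≡⟨ trans (+-assoc M _ t) (cong (M +_) (+-comm _ t)) ⟩
          M + (t + length L * t)  ≤⟨ M≤ ⟩
          length X                ≡⟨ ↭-length X↭ ⟩
          length (zs ++ rest)     ≡⟨ List.length-++ zs ⟩
          length zs + length rest ≡⟨ cong (_+ length rest) (trans (↭-length zs↭js) len) ⟩
          t + length rest         ≡⟨ +-comm t _ ⟩
          length rest + t         ∎)
          where open ≤-Reasoning

      -- As long as `L` has more than M vertices, its first vertex sees at least M others in `L`, so
      -- a block can be taken within `L` and `X` stays whole. The number `n` bounds the recursion,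
      -- because `rest` is not a structural part of `L`.
      greedy : ∀ {M} → Extendable M → ∀ n L X → length L ≤ n → Unique (L ++ X) →
               Homogeneous (suc t) Block X → M + M * t ≤ length X → suc t ∣ length (L ++ X) → Tiling (L ++ X)
      greedy {M} ext n L X ≤n unique hom M≤ t∣ with length L ≤? M
      ... | yes L≤M = cover ext L X unique hom (≤-trans (+-monoʳ-≤ M (*-monoˡ-≤ t L≤M)) M≤) t∣
      greedy ext n [] X ≤n unique hom M≤ t∣ | no L≰M = contradiction z≤n L≰M
      greedy ext (suc n) (l ∷ L) X (s≤s ≤n) unique@(l∉ ∷ uLX) hom M≤ t∣ | no L≰M
        with js , len , uniq-js , js⊆L , b ← ext l L (All.++⁻ˡ L l∉ ∷ Unique-resp-⊆ (⊆-++⁺ʳ X ⊆-refl) uLX) (≤-pred (≰⇒> L≰M))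
        with zs , rest , zs⊆ , rest⊆ , L↭ , zs↭js ← partition-sublist uniq-js js⊆L =
        block b (cong suc len)
          (greedy ext n rest X (≤-trans (length-mono-≤ rest⊆) ≤n) (unique-rest {js = l ∷ js} perm unique)
                  hom M≤ (divides-rest {js = l ∷ js} (cong suc len) perm t∣))
          perm
        where
        perm : l ∷ L ++ X ↭ (l ∷ js) ++ (rest ++ X)
        perm = ↭-prep l (↭-trans (++⁺ʳ X (↭-trans L↭ (++⁺ʳ rest zs↭js))) (↭-reflexive (List.++-assoc js rest X)))

      -- A large set all of whose (t + 1)-subsets are edges absorbs whatever a greedy
      -- tiling of the other vertices leaves over.
      tiling-exists : ∀ {M} → Extendable M → ∀ xs → Unique xs → tilingNumber t M ≤ length xs →
                      suc t ∣ length xs → ¬ ¬ Tiling xs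
      tiling-exists {M} ext xs unique N≤ t∣ ¬tiling =
        proj₂ (ramsey (suc t) (M + M * t) (suc M)) Block xs N≤ λ
        { (inj₁ (X , X⊆ , len , hom)) →
            let zs , rest , zs⊆ , rest⊆ , xs↭ , zs↭X = partition-sublist (Unique-resp-⊆ X⊆ unique) (lookup X⊆)
                perm = ↭-trans xs↭ (↭-trans (++⁺ʳ rest zs↭X) (++-comm X rest))
            in ¬tiling (Tiling-resp-↭ (↭-sym perm)
                 (greedy ext (length rest) rest X ≤-refl (Unique-resp-↭ perm unique) hom
                         (≤-reflexive (sym len)) (subst (suc t ∣_) (↭-length perm) t∣)))
        -- M + 1 vertices without an edge cannot exist: `ext` applied to `y` and the M others gives
        -- an edge among them. It is re-listed in the order of `Y`, which is where invariance of
        -- `Block` under permutation enters.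
        ; (inj₂ (y ∷ Y , Y⊆ , len , hom)) →
            let uY = Unique-resp-⊆ Y⊆ unique
                js , len′ , u-js , js⊆Y , b = ext y Y uY (≤-reflexive (sym (suc-injective len)))
                zs , rest , zs⊆ , _ , _ , zs↭ = partition-sublist (cons-unique uY u-js js⊆Y) (cons-⊆ js⊆Y)
            in hom zs⊆ (trans (↭-length zs↭) (cong suc len′)) (Block-resp-↭ (↭-sym zs↭) b) }
        where
        cons-unique : ∀ {y Y js} → Unique (y ∷ Y) → Unique js → (∀ {j} → j ∈ js → j ∈ Y) → Unique {A = A} (y ∷ js)
        cons-unique (y∉Y ∷ _) u js⊆Y = All.tabulate (λ j∈ → All.lookup y∉Y (js⊆Y j∈)) ∷ u
        cons-⊆ : ∀ {y Y js} → (∀ {j} → j ∈ js → j ∈ Y) → ∀ {j : A} → j ∈ y ∷ js → j ∈ y ∷ Y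
        cons-⊆ js⊆Y (here eq) = here eq
        cons-⊆ js⊆Y (there j∈) = there (js⊆Y j∈)

-- Edge densities as double sums over vertices.

module Densities where

  open import Defs
  open RationalArithmetic
  open Sums

  open import Data.Bool.Base using (true; false; _∧_)
  open import Data.Fin.Base as Fin using (Fin; zero; suc)
  open import Data.Fin.Subset using (Subset; _∈_; ∣_∣; Nonempty; inside; outside)
  open import Data.Fin.Subset.Properties using (_∈?_)
  open import Data.List.Base using (List; []; _∷_; map; length; filter; allFin; cartesianProduct)
  import Data.List.Properties as List
  open import Data.Nat.Base as ℕ using (ℕ; zero; suc)
  open import Data.Product using (_,_)
  open import Data.Rational hiding (∣_∣; _≄_)
  open import Data.Rational.Properties
  open import Data.Vec.Base as Vec using ([]; _∷_)
  open import Function.Base using (_∘_)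
  open import Relation.Binary.PropositionalEquality
  open import Relation.Nullary using (¬_; yes; no; does)
  open import Relation.Nullary.Negation using (contradiction)
  open import Relation.Unary using (Decidable)
  import Data.Nat.Properties as ℕ
  open import Tactic.RingSolver using (solve-∀)

  private
    variable
      A B : Set

  𝟙-∧ : ∀ b c → 𝟙 (b ∧ c) ≡ 𝟙 b * 𝟙 c
  𝟙-∧ false c = sym (*-zeroˡ (𝟙 c))
  𝟙-∧ true  c = sym (*-identityˡ (𝟙 c))

  length-filter : ∀ {P : A → Set} (P? : Decidable P) xs → ι (length (filter P? xs)) ≡ ∑ xs (𝟙 ∘ does ∘ P?)
  length-filter P? [] = refl
  length-filter P? (x ∷ xs) with does (P? x)
  ... | true  = trans (ι-+ 1 (length (filter P? xs))) (cong (1ℚ +_) (length-filter P? xs))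
  ... | false = trans (length-filter P? xs) (sym (+-identityˡ _))

  ∑-cartesianProduct : ∀ (xs : List A) (ys : List B) f →
                       ∑ (cartesianProduct xs ys) f ≡ ∑ xs λ x → ∑ ys λ y → f (x , y)
  ∑-cartesianProduct []       ys f = refl
  ∑-cartesianProduct (x ∷ xs) ys f = trans (∑-++ (map (x ,_) ys) _ f)
    (cong₂ _+_ (∑-map (x ,_) ys f) (∑-cartesianProduct xs ys f))

  member : ∀ {n} → Subset n → Fin n → ℚ
  member X v = 𝟙 (does (v ∈? X))

  ∑-allFin : ∀ n f → ∑ (allFin (suc n)) f ≡ f zero + ∑ (allFin n) (f ∘ suc)
  ∑-allFin n f = cong (f zero +_) (trans (cong (λ xs → ∑ xs f) (sym (List.map-tabulate (λ i → i) suc)))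
                                         (∑-map suc (allFin n) f))

  ∣∣-∑ : ∀ {n} (X : Subset n) → ι ∣ X ∣ ≡ ∑ (allFin n) (member X)
  ∣∣-∑ [] = refl
  ∣∣-∑ {suc n} (outside ∷ X) = trans (∣∣-∑ X) (trans (sym (+-identityˡ _)) (sym (∑-allFin n (member (outside ∷ X)))))
  ∣∣-∑ {suc n} (inside ∷ X) = trans (ι-+ 1 ∣ X ∣)
    (trans (cong (1ℚ +_) (∣∣-∑ X)) (sym (∑-allFin n (member (inside ∷ X)))))

  e-∑ : ∀ G X Y → let V = allFin (order G) in
        ι (e G X Y) ≡ ∑ V λ x → ∑ V λ y → member X x * (member Y y * 𝟙 (adj G x y))
  e-∑ G X Y = trans (length-filter _ (cartesianProduct V V)) (trans (∑-cartesianProduct V V _)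
    (∑-cong V λ {x} _ → ∑-cong V λ {y} _ →
      trans (𝟙-∧ (does (x ∈? X)) _) (cong (member X x *_) (𝟙-∧ (does (y ∈? Y)) (adj G x y)))))
    where V = allFin (order G)

  density-* : ∀ G X Y X≢∅ Y≢∅ → density G X Y X≢∅ Y≢∅ * (ι ∣ X ∣ * ι ∣ Y ∣) ≡ ι (e G X Y)
  density-* G X Y X≢∅ Y≢∅ = trans (cong (density G X Y X≢∅ Y≢∅ *_) (sym (ι-* ∣ X ∣ ∣ Y ∣)))
    (/-*-cancel (e G X Y) (∣ X ∣ ℕ.* ∣ Y ∣)
      {{ℕ.m*n≢0 ∣ X ∣ ∣ Y ∣ {{nonempty⇒nonZero X≢∅}} {{nonempty⇒nonZero Y≢∅}}}})

  0<∣∣ : ∀ {n} {X : Subset n} → Nonempty X → 0ℚ < ι ∣ X ∣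
  0<∣∣ {X = X} X≢∅ = 0<ι ∣ X ∣ {{nonempty⇒nonZero X≢∅}}

  module Parts {m} (G : PartiteGraph m) where

    V : List (Vertex (graph G))
    V = allFin (order (graph G))

    a : Vertex (graph G) → Vertex (graph G) → ℚ
    a u v = 𝟙 (adj (graph G) u v)

    partDensity : Fin m → Fin m → ℚ
    partDensity i j = density (graph G) (part G i) (part G j) (nonempty G i) (nonempty G j)

    abstract

      weight : Fin m → ℚ
      weight i = (1/ ι ∣ part G i ∣) {{0<⇒nonZero (0<∣∣ (nonempty G i))}}

      0<weight : ∀ i → 0ℚ < weight i
      0<weight i = 0<1/ (0<∣∣ (nonempty G i))

      weight-inverse : ∀ i → ι ∣ part G i ∣ * weight i ≡ 1ℚ
      weight-inverse i = *-inverseʳ (ι ∣ part G i ∣) {{0<⇒nonZero (0<∣∣ (nonempty G i))}}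

    -- The uniform probability distribution on the i-th part.
    χ : Fin m → Vertex (graph G) → ℚ
    χ i v = member (part G i) v * weight i

    0≤χ : ∀ i v → 0ℚ ≤ χ i v
    0≤χ i v = 0≤* (0≤𝟙 (does (v ∈? part G i))) (<⇒≤ (0<weight i))

    ∑χ≡1 : ∀ i → ∑ V (χ i) ≡ 1ℚ
    ∑χ≡1 i = trans (∑-*ʳ V (weight i) (member (part G i)))
      (trans (cong (_* weight i) (sym (∣∣-∑ (part G i)))) (weight-inverse i))

    χ-∉ : ∀ {i v} → ¬ v ∈ part G i → χ i v ≡ 0ℚ
    χ-∉ {i} {v} v∉ with v ∈? part G i
    ... | yes v∈ = contradiction v∈ v∉
    ... | no _ = *-zeroˡ (weight i)

    0<χ⇒∈ : ∀ {i v} → 0ℚ < χ i v → v ∈ part G i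
    0<χ⇒∈ {i} {v} 0<χ with v ∈? part G i
    ... | yes v∈ = v∈
    ... | no _ = contradiction (subst (0ℚ <_) (*-zeroˡ (weight i)) 0<χ) (<-irrefl refl)

    -- The density is the probability that independent uniform vertices of the two parts are
    -- adjacent. In this form it is linear in each distribution, and cardinalities disappear from
    -- the estimates.
    partDensity-∑ : ∀ i j → partDensity i j ≡ ∑ V λ u → ∑ V λ v → χ i u * (χ j v * a u v)
    partDensity-∑ i j = begin
      δ                                                   ≡⟨ trans (sym (*-identityʳ δ)) (cong (δ *_) (sym (*-identityʳ 1ℚ))) ⟩
      δ * (1ℚ * 1ℚ)                                       ≡⟨ cong (δ *_) (cong₂ _*_ (weight-inverse i) (weight-inverse j)) ⟨
      δ * ((ι ∣ part G i ∣ * weight i) * (ι ∣ part G j ∣ * weight j))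
        ≡⟨ eq δ (ι ∣ part G i ∣) (ι ∣ part G j ∣) (weight i) (weight j) ⟩
      weight i * (weight j * (δ * (ι ∣ part G i ∣ * ι ∣ part G j ∣)))
        ≡⟨ cong (λ x → weight i * (weight j * x))
             (trans (density-* (graph G) (part G i) (part G j) (nonempty G i) (nonempty G j))
                    (e-∑ (graph G) (part G i) (part G j))) ⟩
      weight i * (weight j * ∑ V λ u → ∑ V λ v → member (part G i) u * (member (part G j) v * a u v))
        ≡⟨ cong (weight i *_) (∑∑-* (weight j) N) ⟨
      weight i * (∑ V λ u → ∑ V λ v → weight j * (member (part G i) u * (member (part G j) v * a u v)))
        ≡⟨ ∑∑-* (weight i) (λ u v → weight j * N u v) ⟨
      (∑ V λ u → ∑ V λ v → weight i * (weight j * (member (part G i) u * (member (part G j) v * a u v))))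
        ≡⟨ ∑-cong V (λ {u} _ → ∑-cong V λ {v} _ →
             eq′ (weight i) (weight j) (member (part G i) u) (member (part G j) v) (a u v)) ⟩
      (∑ V λ u → ∑ V λ v → χ i u * (χ j v * a u v)) ∎
      where
      open ≡-Reasoning
      δ = partDensity i j
      N : Vertex (graph G) → Vertex (graph G) → ℚ
      N u v = member (part G i) u * (member (part G j) v * a u v)
      eq : ∀ d x y v w → d * ((x * v) * (y * w)) ≡ v * (w * (d * (x * y)))
      eq = solve-∀ ring
      eq′ : ∀ v w x y a → v * (w * (x * (y * a))) ≡ x * v * (y * w * a)
      eq′ = solve-∀ ring
      ∑∑-* : ∀ c (f : Vertex (graph G) → Vertex (graph G) → ℚ) →
             (∑ V λ u → ∑ V λ v → c * f u v) ≡ c * (∑ V λ u → ∑ V λ v → f u v)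
      ∑∑-* c f = trans (∑-cong V λ {u} _ → ∑-*ˡ V c (f u)) (∑-*ˡ V c λ u → ∑ V (f u))

    partDensity-sym : ∀ i j → partDensity i j ≡ partDensity j i
    partDensity-sym i j = trans (partDensity-∑ i j) (trans (∑-swap V V _)
      (trans (∑-cong V λ {v} _ → ∑-cong V λ {u} _ → trans
         (cong (λ b → χ i u * (χ j v * 𝟙 b)) (symmetric (graph G) u v)) (eq (χ i u) (χ j v) (a v u)))
       (sym (partDensity-∑ j i))))
      where
      eq : ∀ x y z → x * (y * z) ≡ y * (x * z)
      eq = solve-∀ ring

-- Cliques through a given part of a dense multipartite graph.

module DenseGraphs where

  open import Defs
  open RationalArithmetic
  open Sums
  open Hypergraphs
  open Densities

  open import Data.Bool.Base using (true; false; T)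
  open import Data.Fin.Base using (Fin)
  open import Data.Fin.Properties using (_≟_)
  open import Data.Fin.Subset using (_∈_)
  open import Data.List.Base using (List; []; _∷_; map; length)
  import Data.List.Properties as List
  import Data.List.Membership.Propositional as List
  open import Data.List.Membership.Propositional.Properties using (∈-allFin; ∈-map⁻)
  open import Data.List.Relation.Binary.Permutation.Propositional using (_↭_; ↭-refl; ↭-trans)
  open import Data.List.Relation.Unary.All as All using (All; []; _∷_)
  open import Data.List.Relation.Unary.Any using (here; there)
  open import Data.List.Relation.Unary.AllPairs as AllPairs using (AllPairs; []; _∷_)
  import Data.List.Relation.Unary.AllPairs.Properties as AllPairs
  open import Data.List.Relation.Unary.Unique.Propositional using (Unique)
  open import Data.Nat.Base as ℕ using (ℕ; suc)
  open import Data.Product using (∃; _×_; _,_; proj₁; proj₂)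
  open import Data.Rational hiding (∣_∣; _≟_; _≄_)
  open import Data.Rational.Properties hiding (_≟_)
  open import Data.Sum.Base using ([_,_]′)
  open import Function.Base using (_∘_; case_of_)
  open import Relation.Binary.PropositionalEquality
  open import Relation.Nullary using (yes; no; Dec; does)
  open import Relation.Nullary.Negation using (contradiction)
  open import Data.Fin.Subset.Properties using (_∈?_)
  open import Tactic.RingSolver using (solve-∀)

  module _ {m} (G : PartiteGraph m) where

    open Parts G

    partOf : Vertex (graph G) → Fin m
    partOf v = proj₁ (partition G v)

    ∈-partOf : ∀ v → v ∈ part G (partOf v)
    ∈-partOf v = proj₁ (proj₂ (partition G v))

    partOf-unique : ∀ {v i} → v ∈ part G i → partOf v ≡ i
    partOf-unique {v} = proj₂ (proj₂ (partition G v))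

    adjacent⇒partOf-≢ : ∀ {u v} → Edge (graph G) u v → partOf u ≢ partOf v
    adjacent⇒partOf-≢ {u} {v} uv eq =
      independent G (partOf v) (subst (λ i → u ∈ part G i) eq (∈-partOf u)) (∈-partOf v) uv

    -- The edges of the hypergraph of parts. Matching the parts up to permutation gives the
    -- invariance that `Tilings` asks of blocks.
    CliqueOn : List (Fin m) → Set
    CliqueOn zs = ∃ λ us → AllPairs (Edge (graph G)) us × map partOf us ↭ zs

    CliqueOn-resp-↭ : ∀ {js ks} → js ↭ ks → CliqueOn js → CliqueOn ks
    CliqueOn-resp-↭ js↭ks (us , clique , us↭js) = us , clique , ↭-trans us↭js js↭ks

    open Turán (adj (graph G)) (symmetric (graph G)) V using (edgeWeight; Clique; turán)

    -- Bounds the diagonal in the double sum over S of `edgeWeight-bound`: each row meets it at most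
    -- once.
    ∑𝟙-unique : ∀ (j : Fin m) S → Unique S → ∑ S (λ k → 𝟙 (does (j ≟ k))) ≤ 1ℚ
    ∑𝟙-unique j [] _ = <⇒≤ 0<1
    ∑𝟙-unique j (k ∷ S) (k∉S ∷ unique) with j ≟ k
    ... | no _ = ≤-trans (≤-reflexive (+-identityˡ _)) (∑𝟙-unique j S unique)
    ... | yes refl = ≤-reflexive (trans (cong (1ℚ +_) (trans (∑-cong S ≢-0) (∑-0 S))) (+-identityʳ 1ℚ))
      where
      ≢-0 : ∀ {l} → l List.∈ S → 𝟙 (does (j ≟ l)) ≡ 0ℚ
      ≢-0 {l} l∈S with j ≟ l
      ... | yes refl = contradiction refl (All.lookup k∉S l∈S)
      ... | no _ = refl

    degreeInto : Vertex (graph G) → Fin m → ℚ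
    degreeInto v j = ∑ V λ u → χ j u * a v u

    0≤degreeInto : ∀ v j → 0ℚ ≤ degreeInto v j
    0≤degreeInto v j = ∑-nonneg V λ {u} _ → 0≤* (0≤χ j u) (0≤𝟙 _)

    degreeInto≤1 : ∀ v j → degreeInto v j ≤ 1ℚ
    degreeInto≤1 v j = ≤-trans (∑-mono V λ {u} _ → ≤-trans (*-mono-≤ (0≤χ j u) (𝟙≤1 _)) (≤-reflexive (*-identityʳ _)))
                      (≤-reflexive (∑χ≡1 j))

    module _ {p} (0≤p : 0ℚ ≤ p) (dense : ∀ {i j} → i ≢ j → p ≤ partDensity i j) where

      -- Averaging: over a uniform vertex of the i-th part, the expected total degree into `S` is
      -- the sum of the densities, and a vertex of maximal total degree is at least as good as the
      -- average.
      largeDegree : ∀ i S → All (i ≢_) S → ∃ λ v → v ∈ part G i × p * ι (length S) ≤ ∑ S (degreeInto v)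
      largeDegree i S i∉S = [ found , (λ empty → contradiction (proj₂ (nonempty G i)) (empty (∈-allFin _))) ]′
                              (maximal (_∈? part G i) (λ v → ∑ S (degreeInto v)) V)
        where
        found : (∃ λ v → v List.∈ V × v ∈ part G i × (∀ {u} → u List.∈ V → u ∈ part G i → ∑ S (degreeInto u) ≤ ∑ S (degreeInto v))) →
                ∃ λ v → v ∈ part G i × p * ι (length S) ≤ ∑ S (degreeInto v)
        found (v , _ , v∈ , max) = v , v∈ , (begin
          p * ι (length S)                         ≡⟨ trans (*-comm p _) (sym (∑-const S p)) ⟩
          ∑ S (λ _ → p)                            ≤⟨ ∑-mono S (λ j∈S → dense (All.lookup i∉S j∈S)) ⟩
          ∑ S (partDensity i)                      ≡⟨ ∑-cong S (λ {j} _ → trans (partDensity-∑ i j)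
                                                        (∑-cong V λ {u} _ → ∑-*ˡ V (χ i u) _)) ⟩
          ∑ S (λ j → ∑ V λ u → χ i u * degreeInto u j)      ≡⟨ trans (∑-swap S V _) (∑-cong V λ {u} _ → ∑-*ˡ S (χ i u) (degreeInto u)) ⟩
          ∑ V (λ u → χ i u * ∑ S (degreeInto u))            ≤⟨ ∑-mono V max′ ⟩
          ∑ V (λ u → χ i u * ∑ S (degreeInto v))            ≡⟨ ∑-*ʳ V (∑ S (degreeInto v)) (χ i) ⟩
          ∑ V (χ i) * ∑ S (degreeInto v)                    ≡⟨ trans (cong (_* ∑ S (degreeInto v)) (∑χ≡1 i)) (*-identityˡ _) ⟩
          ∑ S (degreeInto v)                                ∎)
          where
          open ≤-Reasoning
          max′ : ∀ {u} → u List.∈ V → χ i u * ∑ S (degreeInto u) ≤ χ i u * ∑ S (degreeInto v)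
          max′ {u} u∈V = case u ∈? part G i of λ
            { (yes u∈) → *-mono-≤ (0≤χ i u) (max u∈V u∈)
            ; (no u∉) → ≤-reflexive (trans (cong (_* ∑ S (degreeInto u)) (χ-∉ u∉))
                (trans (trans (*-zeroˡ (∑ S (degreeInto u))) (sym (*-zeroˡ (∑ S (degreeInto v))))) (cong (_* ∑ S (degreeInto v)) (sym (χ-∉ u∉))))) }

      module _ (v : Vertex (graph G)) (S : List (Fin m)) (unique : Unique S) where

        y : Fin m → Vertex (graph G) → ℚ
        y j u = χ j u * a v u

        -- The weight for Turán's theorem: the neighbours of `v` in the parts of `S`, normalised so
        -- that a whole part would weigh 1 whatever its size.
        neighbourWeight : Vertex (graph G) → ℚ
        neighbourWeight u = ∑ S λ j → y j u

        0≤y : ∀ j u → 0ℚ ≤ y j u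
        0≤y j u = 0≤* (0≤χ j u) (0≤𝟙 _)

        neighbourWeight-nonneg : ∀ u → 0ℚ ≤ neighbourWeight u
        neighbourWeight-nonneg u = ∑-nonneg S λ {j} _ → 0≤y j u

        ∑-neighbourWeight : ∑ V neighbourWeight ≡ ∑ S (degreeInto v)
        ∑-neighbourWeight = ∑-swap V S _

        crossWeight : Fin m → Fin m → ℚ
        crossWeight j k = ∑ V λ u → ∑ V λ u′ → y j u * (y k u′ * a u u′)

        edgeWeight-crossWeight : edgeWeight neighbourWeight ≡ ∑ S λ j → ∑ S λ k → crossWeight j k
        edgeWeight-crossWeight = begin
          ∑ V (λ u → neighbourWeight u * ∑ V λ u′ → neighbourWeight u′ * a u u′)
            ≡⟨ ∑-cong V (λ {u} _ → cong (neighbourWeight u *_)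
                 (trans (∑-cong V λ {u′} _ → sym (∑-*ʳ S (a u u′) _)) (∑-swap V S _))) ⟩
          ∑ V (λ u → ∑ S (λ j → y j u) * ∑ S λ k → ∑ V λ u′ → y k u′ * a u u′)
            ≡⟨ ∑-cong V (λ {u} _ → ∑-*-∑ S S _ _) ⟩
          ∑ V (λ u → ∑ S λ j → ∑ S λ k → y j u * ∑ V λ u′ → y k u′ * a u u′)
            ≡⟨ trans (∑-swap V S _) (∑-cong S λ {j} _ → ∑-swap V S _) ⟩
          ∑ S (λ j → ∑ S λ k → ∑ V λ u → y j u * ∑ V λ u′ → y k u′ * a u u′)
            ≡⟨ ∑-cong S (λ {j} _ → ∑-cong S λ {k} _ → ∑-cong V λ {u} _ → ∑-*ˡ V (y j u) _) ⟨
          ∑ S (λ j → ∑ S λ k → crossWeight j k) ∎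
          where open ≡-Reasoning

        0≤crossWeight : ∀ j k → 0ℚ ≤ crossWeight j k
        0≤crossWeight j k = ∑-nonneg V λ {u} _ → ∑-nonneg V λ {u′} _ → 0≤* (0≤y j u) (0≤* (0≤y k u′) (0≤𝟙 _))

        -- All but a fraction 1 - p of the pairs between distinct parts are edges.
        degreeInto-*-≤ : ∀ j k (j≟k : Dec (j ≡ k)) → degreeInto v j * degreeInto v k ≤ crossWeight j k + ((1ℚ - p) + p * 𝟙 (does j≟k))
        -- On the diagonal the loss (1 - p) + p is 1, which already bounds a product of two
        -- proportions.
        degreeInto-*-≤ j k (yes refl) = ≤-from
          (0≤+ (0≤crossWeight j j) (0≤+ (≤⇒0≤- (degreeInto≤1 v j)) (0≤* (0≤degreeInto v j) (≤⇒0≤- (degreeInto≤1 v j)))))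
          (eq (degreeInto v j) (crossWeight j j) p)
          where
          eq : ∀ x e p → (e + ((1ℚ - p) + p * 1ℚ)) - x * x ≡ e + ((1ℚ - x) + x * (1ℚ - x))
          eq = solve-∀ ring
        degreeInto-*-≤ j k (no j≢k) = begin
          degreeInto v j * degreeInto v k
            ≡⟨ ∑-*-∑ V V (y j) (y k) ⟩
          ∑ V (λ u → ∑ V λ u′ → y j u * y k u′)
            ≤⟨ ∑-mono V (λ {u} _ → ∑-mono V λ {u′} _ → pointwise u u′) ⟩
          ∑ V (λ u → ∑ V λ u′ → edges′ u u′ + (χ j u * χ k u′ + - 1ℚ * (χ j u * (χ k u′ * a u u′))))
            ≡⟨ ∑∑-+ edges′ _ ⟩
          crossWeight j k + ∑ V (λ u → ∑ V λ u′ → χ j u * χ k u′ + - 1ℚ * (χ j u * (χ k u′ * a u u′)))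
            ≡⟨ cong (crossWeight j k +_) (∑∑-+ _ _) ⟩
          crossWeight j k + (∑ V (λ u → ∑ V λ u′ → χ j u * χ k u′) +
                   ∑ V (λ u → ∑ V λ u′ → - 1ℚ * (χ j u * (χ k u′ * a u u′))))
            ≡⟨ cong (crossWeight j k +_) (cong₂ _+_
                 (trans (sym (∑-*-∑ V V (χ j) (χ k))) (trans (cong₂ _*_ (∑χ≡1 j) (∑χ≡1 k)) (*-identityˡ 1ℚ)))
                 (trans (∑-cong V λ {u} _ → ∑-*ˡ V (- 1ℚ) _)
                   (trans (∑-*ˡ V (- 1ℚ) _) (cong (- 1ℚ *_) (sym (partDensity-∑ j k)))))) ⟩
          crossWeight j k + (1ℚ + - 1ℚ * partDensity j k)
            ≤⟨ ≤-from (≤⇒0≤- (dense j≢k)) (eq (crossWeight j k) (partDensity j k) p) ⟩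
          crossWeight j k + ((1ℚ - p) + p * 0ℚ) ∎
          where
          open ≤-Reasoning
          edges′ : Vertex (graph G) → Vertex (graph G) → ℚ
          edges′ u u′ = y j u * (y k u′ * a u u′)
          ∑∑-+ : ∀ (f g : Vertex (graph G) → Vertex (graph G) → ℚ) →
            ∑ V (λ u → ∑ V λ u′ → f u u′ + g u u′) ≡ ∑ V (λ u → ∑ V (f u)) + ∑ V (λ u → ∑ V (g u))
          ∑∑-+ f g = trans (∑-cong V λ {u} _ → ∑-+ V (f u) (g u)) (∑-+ V _ _)
          eq : ∀ e d p → (e + ((1ℚ - p) + p * 0ℚ)) - (e + (1ℚ + - 1ℚ * d)) ≡ d - p
          eq = solve-∀ ring
          pointwise : ∀ u u′ → y j u * y k u′ ≤ edges′ u u′ + (χ j u * χ k u′ + - 1ℚ * (χ j u * (χ k u′ * a u u′)))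
          -- A pair of neighbours of `v` is an edge or a non-edge, and the non-edges among
          -- neighbours are at most all non-edges between the two parts.
          pointwise u u′ = ≤-from
            (0≤* (0≤* (0≤* (0≤χ j u) (0≤χ k u′)) (≤⇒0≤- (𝟙≤1 (adj (graph G) u u′))))
                 (0≤+ (≤⇒0≤- (𝟙≤1 (adj (graph G) v u)))
                      (0≤* (0≤𝟙 (adj (graph G) v u)) (≤⇒0≤- (𝟙≤1 (adj (graph G) v u′))))))
            (eq′ (χ j u) (χ k u′) (a v u) (a v u′) (a u u′))
            where
            eq′ : ∀ c d b b′ f →
              (c * b * (d * b′ * f) + (c * d + - 1ℚ * (c * (d * f)))) - c * b * (d * b′) ≡
              c * d * (1ℚ - f) * ((1ℚ - b) + b * (1ℚ - b′))
            eq′ = solve-∀ ring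

        -- `degreeInto-*-≤` is summed over S × S. Each of the M² pairs of parts loses 1 - p, and the
        -- M diagonal ones lose p more; this is the linear term that a large M has to outweigh.
        edgeWeight-bound : let M = ι (length S) in
          ∑ S (degreeInto v) * ∑ S (degreeInto v) ≤ edgeWeight neighbourWeight + (M * (M * (1ℚ - p)) + p * M)
        edgeWeight-bound = begin
          ∑ S (degreeInto v) * ∑ S (degreeInto v)
            ≡⟨ ∑-*-∑ S S (degreeInto v) (degreeInto v) ⟩
          ∑ S (λ j → ∑ S λ k → degreeInto v j * degreeInto v k)
            ≤⟨ ∑-mono S (λ {j} _ → ∑-mono S λ {k} _ → degreeInto-*-≤ j k (j ≟ k)) ⟩
          ∑ S (λ j → ∑ S λ k → crossWeight j k + ((1ℚ - p) + p * 𝟙 (does (j ≟ k))))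
            ≡⟨ ∑-cong S (λ {j} _ → trans (∑-+ S (crossWeight j) _) (cong (∑ S (crossWeight j) +_) (trans (∑-+ S _ _)
                 (cong₂ _+_ (∑-const S (1ℚ - p)) (∑-*ˡ S p _))))) ⟩
          ∑ S (λ j → ∑ S (crossWeight j) + (M * (1ℚ - p) + p * ∑ S λ k → 𝟙 (does (j ≟ k))))
            ≤⟨ ∑-mono S (λ {j} _ → +-monoʳ-≤ (∑ S (crossWeight j)) (+-monoʳ-≤ (M * (1ℚ - p))
                 (*-mono-≤ 0≤p (∑𝟙-unique j S unique)))) ⟩
          ∑ S (λ j → ∑ S (crossWeight j) + (M * (1ℚ - p) + p * 1ℚ))
            ≡⟨ trans (∑-+ S (λ j → ∑ S (crossWeight j)) _) (cong₂ _+_ (sym edgeWeight-crossWeight) (∑-const S _)) ⟩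
          edgeWeight neighbourWeight + M * (M * (1ℚ - p) + p * 1ℚ)
            ≡⟨ cong (edgeWeight neighbourWeight +_) (eq M p) ⟩
          edgeWeight neighbourWeight + (M * (M * (1ℚ - p)) + p * M) ∎
          where
          open ≤-Reasoning
          M = ι (length S)
          eq : ∀ M p → M * (M * (1ℚ - p) + p * 1ℚ) ≡ M * (M * (1ℚ - p)) + p * M
          eq = solve-∀ ring

        0<neighbourWeight : ∀ {u} → 0ℚ < neighbourWeight u → Edge (graph G) v u × partOf u List.∈ S
        0<neighbourWeight {u} = splitCase (adj (graph G) v u)
          where
          positiveTerm : ∀ S → 0ℚ < ∑ S (λ j → χ j u) → partOf u List.∈ S
          positiveTerm [] 0<0 = contradiction 0<0 (<-irrefl refl)
          positiveTerm (j ∷ S) 0<Σ with 0ℚ <? χ j u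
          ... | yes 0<χ = here (partOf-unique (0<χ⇒∈ 0<χ))
          ... | no 0≮χ = there (positiveTerm S (subst (0ℚ <_)
                (trans (cong (_+ ∑ S (λ j → χ j u)) (≤-antisym (≮⇒≥ 0≮χ) (0≤χ j u))) (+-identityˡ _)) 0<Σ))
          splitCase : ∀ b → 0ℚ < ∑ S (λ j → χ j u * 𝟙 b) → T b × partOf u List.∈ S
          splitCase false 0<w =
            contradiction (subst (0ℚ <_) (trans (∑-cong S λ {j} _ → *-zeroʳ (χ j u)) (∑-0 S)) 0<w) (<-irrefl refl)
          splitCase true 0<w = _ , positiveTerm S (subst (0ℚ <_) (∑-cong S λ {j} _ → *-identityʳ (χ j u)) 0<w)

      module _ (s M : ℕ) (0<δ : 0ℚ < p * p - ι s * (1ℚ - p)) (large : ι s * p < ι M * (p * p - ι s * (1ℚ - p))) where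

        -- With L parts in `S`, W ≥ p L and the bound on the edge weight, the surplus in Turán's
        -- condition is at least W² - s ((1 - p) L² + p L) ≥ L (L δ - s p), which is positive by
        -- `large` and L ≥ M. The clique of s + 1 vertices found among the neighbours of `v` is
        -- completed by `v`.
        extendable : Tilings.Extendable _≟_ (suc s) CliqueOn CliqueOn-resp-↭ M
        extendable i S (i∉S ∷ unique) M≤S =
          extend (turán s w (neighbourWeight-nonneg v S unique) heavy)
          where
          v = proj₁ (largeDegree i S i∉S)
          w = neighbourWeight v S unique
          W = ∑ S (degreeInto v)
          L = ι (length S)
          δ = p * p - ι s * (1ℚ - p)
          0<gap : 0ℚ < L * δ - ι s * p
          0<gap = <⇒0<- (<-≤-trans large (subst₂ _≤_ (*-comm δ (ι M)) (*-comm δ L) (*-mono-≤ (<⇒≤ 0<δ) (ι-mono-≤ M≤S))))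
          0<L : 0ℚ < L
          0<L = *-cancel-< 0<δ (subst₂ _<_ (sym (*-zeroʳ δ)) (*-comm L δ)
                  (≤-<-trans (0≤* (0≤ι s) 0≤p) (0<-⇒< 0<gap)))
          eq : ∀ s W e L p → (s * e + W * W) - s * (W * W) ≡
            L * (L * (p * p - s * (1ℚ - p)) - s * p) +
            (s * ((e + (L * (L * (1ℚ - p)) + p * L)) - W * W) + (W * W - p * L * (p * L)))
          eq = solve-∀ ring
          heavy : ι s * (∑ V w * ∑ V w) < ι s * edgeWeight w + ∑ V w * ∑ V w
          heavy = subst (λ z → ι s * (z * z) < ι s * edgeWeight w + z * z)
            (sym (∑-neighbourWeight v S unique)) (<-from
              (0<+≤ (0<* 0<L 0<gap)
                (0≤+ (0≤* (0≤ι s) (≤⇒0≤- (edgeWeight-bound v S unique)))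
                     (≤⇒0≤- (≤-square (0≤* 0≤p (0≤ι (length S))) (proj₂ (proj₂ (largeDegree i S i∉S)))))))
              (eq (ι s) W (edgeWeight w) L p))
          extend : Clique w (suc s) → ∃ λ js → length js ≡ suc s × Unique js ×
                   (∀ {j} → j List.∈ js → j List.∈ S) × CliqueOn (i ∷ js)
          extend (us , len , clique , positive) =
            map partOf us , trans (List.length-map partOf us) len ,
            AllPairs.map⁺ (AllPairs.map adjacent⇒partOf-≢ clique) , inS ,
            v ∷ us , All.map (proj₁ ∘ 0<neighbourWeight v S unique ∘ proj₂) positive ∷ clique ,
            subst (λ j → partOf v ∷ map partOf us ↭ j ∷ map partOf us)
                  (partOf-unique (proj₁ (proj₂ (largeDegree i S i∉S)))) ↭-refl
            where
            inS : ∀ {j} → j List.∈ map partOf us → j List.∈ S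
            inS j∈ with u , u∈ , refl ← ∈-map⁻ partOf j∈ =
              proj₂ (0<neighbourWeight v S unique (proj₂ (All.lookup positive u∈)))

-- From perfect tilings to traversals.

module Traversals where

  open import Defs
  open Hypergraphs
  open DenseGraphs

  open import Data.Bool.Base using (T)
  open import Data.Fin.Base using (Fin; zero; suc; quotient; remainder; combine; punchOut)
  open import Data.Fin.Properties using (_≟_; any?; punchOut-injective; injective⇒≤; remQuot-combine)
  open import Data.Fin.Subset using (_∈_)
  open import Data.List.Base using (List; []; _∷_; _++_; length; allFin; lookup)
  import Data.List.Properties as List
  import Data.List.Membership.Propositional as List
  open import Data.List.Membership.Propositional.Properties using (∈-allFin; ∈-map⁻; ∈-lookup; ∈-++⁻)
  open import Data.List.Relation.Binary.Permutation.Propositional using (↭-sym)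
  open import Data.List.Relation.Binary.Permutation.Propositional.Properties using (↭-length; ∈-resp-↭)
  open import Data.List.Relation.Unary.All as All using (All; []; _∷_)
  import Data.List.Relation.Unary.Any as Any
  open import Data.List.Relation.Unary.Any.Properties using (lookup-index)
  open import Data.List.Relation.Unary.AllPairs using (AllPairs; []; _∷_)
  open import Data.Nat.Base
  open import Data.Nat.Properties hiding (_≟_)
  open import Data.Product using (∃; ∃₂; _×_; _,_; proj₁; proj₂)
  open import Data.Sum.Base using (inj₁; inj₂)
  import Data.Vec.Functional as Vector
  open import Function.Base using (_∘_)
  open import Function.Definitions using (Injective)
  open import Relation.Binary.PropositionalEquality
  open import Relation.Nullary using (yes; no)
  open import Relation.Nullary.Negation using (contradiction)

  injective⇒surjective : ∀ {n} {f : Fin n → Fin n} → Injective _≡_ _≡_ f → ∀ y → ∃ λ x → f x ≡ y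
  injective⇒surjective {suc n} {f} f-injective y with any? (λ x → f x ≟ y)
  ... | yes hit = hit
  ... | no miss = contradiction (injective⇒≤ {f = λ x → punchOut (y≢ x)}
                    λ eq → f-injective (punchOut-injective (y≢ _) (y≢ _) eq)) 1+n≰n
    where
    y≢ : ∀ x → y ≢ f x
    y≢ x y≡fx = miss (x , sym y≡fx)

  -- A section is injective, hence surjective by finiteness, hence a two-sided inverse.
  surjective⇒injective : ∀ {n} {f : Fin n → Fin n} → (∀ y → ∃ λ x → f x ≡ y) → Injective _≡_ _≡_ f
  surjective⇒injective {f = f} surj {x} {x′} fx≡fx′ = begin
    x                ≡⟨ section-f x ⟨
    section (f x)    ≡⟨ cong section fx≡fx′ ⟩
    section (f x′)   ≡⟨ section-f x′ ⟩
    x′               ∎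
    where
    open ≡-Reasoning
    section = proj₁ ∘ surj
    section-injective : Injective _≡_ _≡_ section
    section-injective {y} {y′} eq = trans (sym (proj₂ (surj y))) (trans (cong f eq) (proj₂ (surj y′)))
    section-f : ∀ x → section (f x) ≡ x
    section-f x with y , refl ← injective⇒surjective section-injective x = cong section (proj₂ (surj y))

  lookup-AllPairs : ∀ {A : Set} {R : A → A → Set} → (∀ {x y} → R x y → R y x) → ∀ {xs} → AllPairs R xs →
                    ∀ {i j} → i ≢ j → R (lookup xs i) (lookup xs j)
  lookup-AllPairs sym-R (_ ∷ _)   {zero}  {zero}  i≢j = contradiction refl i≢j
  lookup-AllPairs sym-R (r ∷ _)   {zero}  {suc j} i≢j = All.lookup r (∈-lookup j)
  lookup-AllPairs sym-R (r ∷ _)   {suc i} {zero}  i≢j = sym-R (All.lookup r (∈-lookup i))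
  lookup-AllPairs sym-R (_ ∷ rs)  {suc i} {suc j} i≢j = lookup-AllPairs sym-R rs (i≢j ∘ cong suc)

  copies-edge : ∀ r t {u v} → Edge (r copiesOf K t) u v →
                quotient {r} t u ≡ quotient t v × remainder {r} t u ≢ remainder {r} t v
  copies-edge r t {u} {v} uv
    with quotient {r} t u ≟ quotient t v | remainder {r} t u ≟ remainder {r} t v
  ... | yes eq | no ≢ = eq , ≢

  edge-copies : ∀ r t {u v} → quotient {r} t u ≡ quotient t v → remainder {r} t u ≢ remainder {r} t v →
                Edge (r copiesOf K t) u v
  edge-copies r t {u} {v} eq ≢
    with quotient {r} t u ≟ quotient t v | remainder {r} t u ≟ remainder {r} t v
  ... | yes _ | no _ = _
  ... | no ≢′ | _ = contradiction eq ≢′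
  ... | yes _ | yes eq′ = contradiction eq′ ≢

  module _ {m} (G : PartiteGraph m) (t : ℕ) where

    open Tilings _≟_ t (CliqueOn G) (CliqueOn-resp-↭ G)

    Edge-sym : ∀ {u v} → Edge (graph G) u v → Edge (graph G) v u
    Edge-sym {u} {v} = subst T (symmetric (graph G) u v)

    Selection : ∀ n → (Fin n → Vertex (graph G)) → Set
    Selection n g = ∀ {i j} → i ≢ j → Edge (graph G) (g i) (g j)

    clique-selection : ∀ {n js} → CliqueOn G js → length js ≡ n → ∃ λ g → Selection n g ×
                       (∀ {j} → j List.∈ js → ∃ λ k → partOf G (g k) ≡ j)
    clique-selection {n} {js} (us , clique , us↭js) len =
      select (trans (sym (List.length-map (partOf G) us)) (trans (↭-length us↭js) len))
      where
      select : length us ≡ n → ∃ λ g → Selection n g × (∀ {j} → j List.∈ js → ∃ λ k → partOf G (g k) ≡ j)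
      select refl = lookup us , lookup-AllPairs Edge-sym clique , λ j∈js →
        let u , u∈us , j≡ = ∈-map⁻ (partOf G) (∈-resp-↭ (↭-sym us↭js) j∈js)
        in Any.index u∈us , trans (cong (partOf G) (sym (lookup-index u∈us))) (sym j≡)

    -- Only that every part is reached is carried through the induction; that no part is reached
    -- twice follows at the end by counting.
    tiling-selection : ∀ {zs} r → Tiling zs → length zs ≡ r * suc t →
      ∃ λ (f : Fin r → Fin (suc t) → Vertex (graph G)) → (∀ q → Selection (suc t) (f q)) ×
      (∀ {z} → z List.∈ zs → ∃₂ λ q j → partOf G (f q j) ≡ z)
    tiling-selection zero [] _ = (λ ()) , (λ ()) , λ ()
    tiling-selection {zs} r (block {js} {rest} b len tiling zs↭) zs-len = go r (begin
      suc t + length rest     ≡⟨ cong (_+ length rest) len ⟨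
      length js + length rest ≡⟨ List.length-++ js ⟨
      length (js ++ rest)     ≡⟨ ↭-length zs↭ ⟨
      length zs               ≡⟨ zs-len ⟩
      r * suc t               ∎)
      where
      open ≡-Reasoning
      go : ∀ r → suc t + length rest ≡ r * suc t →
        ∃ λ (f : Fin r → Fin (suc t) → Vertex (graph G)) → (∀ q → Selection (suc t) (f q)) ×
        (∀ {z} → z List.∈ zs → ∃₂ λ q j → partOf G (f q j) ≡ z)
      go (suc r) eq with tiling-selection r tiling (+-cancelˡ-≡ (suc t) _ _ eq) | clique-selection b len
      ... | f , selection , onto | g , selection′ , onto′ =
        (g Vector.∷ f) , (λ { zero → selection′ ; (suc q) → selection q }) , onto″
        where
        onto″ : ∀ {z} → z List.∈ zs → ∃₂ λ q j → partOf G ((g Vector.∷ f) q j) ≡ z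
        onto″ z∈zs with ∈-++⁻ js (∈-resp-↭ zs↭ z∈zs)
        ... | inj₁ z∈js = let j , eq = onto′ z∈js in zero , j , eq
        ... | inj₂ z∈rest = let q , j , eq = onto z∈rest in suc q , j , eq

  module _ (r t : ℕ) (G : PartiteGraph (r * suc t)) where

    open Tilings _≟_ t (CliqueOn G) (CliqueOn-resp-↭ G)

    -- The selected vertices are as many as the parts and reach all of them, so each part is met
    -- exactly once. The traversal is taken to be r K_t itself, without further edges of the graph,
    -- and the required copy is then the identity.
    tiling⇒traversal : Tiling (allFin (r * suc t)) → HasTraversal (r copiesOf K (suc t)) G
    tiling⇒traversal tiling = record
      { subgraph = r copiesOf K (suc t)
      ; inclusion = record
        { embed = embedding
        ; injective = bijective ∘ cong (partOf G)
        ; edges = λ uv → let eq , ≢ = copies-edge r (suc t) uv in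
            subst (λ q → Edge (graph G) (embedding _) (f q _)) eq (selection _ ≢)
        }
      ; exactlyOne = λ i → let x , x∈i = onto i in
          x , subst (λ j → embedding x ∈ part G j) x∈i (∈-partOf G (embedding x)) ,
          λ {y} y∈i → bijective (trans x∈i (sym (partOf-unique G y∈i)))
      } , record { embed = λ x → x ; injective = λ eq → eq ; edges = λ uv → uv }
      where
      choice = tiling-selection G t r tiling (List.length-tabulate {A = Fin (r * suc t)} (λ i → i))
      f = proj₁ choice
      selection = proj₁ (proj₂ choice)
      embedding : Fin (r * suc t) → Vertex (graph G)
      embedding x = f (quotient (suc t) x) (remainder {r} (suc t) x)
      onto : ∀ i → ∃ λ x → partOf G (embedding x) ≡ i
      onto i with q , j , eq ← proj₂ (proj₂ choice) (∈-allFin i) = combine q j ,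
        trans (cong (λ (q , j) → partOf G (f q j)) (remQuot-combine {r} {suc t} q j)) eq
      bijective : Injective _≡_ _≡_ (partOf G ∘ embedding)
      bijective = surjective⇒injective onto

-- Densities above the root force a traversal.

module UpperBound where

  open import Defs
  open RationalArithmetic
  open Hypergraphs
  open Densities
  open DenseGraphs
  open Traversals

  open import Data.Fin.Base as Fin using (Fin)
  open import Data.Fin.Properties using (_≟_; _<?_; <-cmp)
  open import Data.List.Base using (List; map; length; allFin; filter; cartesianProduct)
  import Data.List.Properties as List
  open import Data.List.Membership.Propositional.Properties using (∈-allFin; ∈-map⁺; ∈-filter⁺; ∈-filter⁻; ∈-cartesianProduct⁺)
  open import Data.List.Relation.Unary.All as All using (All)
  import Data.List.Relation.Unary.All.Properties as All
  open import Data.List.Relation.Unary.Unique.Propositional.Properties using (allFin⁺)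
  open import Data.Nat.Base as ℕ using (ℕ; suc)
  import Data.Nat.Properties as ℕ
  open import Data.Nat.Divisibility using (divides)
  open import Data.Product using (∃; _×_; _,_; proj₁; proj₂)
  open import Data.Rational using (0ℚ; 1ℚ; _*_; _-_; _≤_; _<_)
  open import Data.Rational.Properties hiding (_≟_; _<?_; <-cmp)
  open import Function.Base using (_∘_; case_of_)
  open import Relation.Binary.Definitions using (tri<; tri≈; tri>)
  open import Relation.Binary.Bundles using (DecTotalOrder)
  open import Relation.Binary.PropositionalEquality
  open import Relation.Nullary using (¬_)
  open import Relation.Nullary.Negation using (contradiction)

  open import Data.List.Extrema (DecTotalOrder.totalOrder ≤-decTotalOrder) using (min≤xs; v≤min⁺)

  module _ {m} (G : PartiteGraph m) where

    open Parts G using (partDensity; partDensity-sym)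

    private
      pairs : List (Fin m × Fin m)
      pairs = filter (λ (i , j) → i <? j) (cartesianProduct (allFin m) (allFin m))

    d≤partDensity-< : ∀ {i j} → i Fin.< j → d G ≤ partDensity i j
    d≤partDensity-< {i} {j} i<j = All.lookup (min≤xs 1ℚ (map (λ (i , j) → partDensity i j) pairs))
      (∈-map⁺ (λ (i , j) → partDensity i j)
        (∈-filter⁺ (λ (i , j) → i <? j) (∈-cartesianProduct⁺ (∈-allFin i) (∈-allFin j)) i<j))

    d≤partDensity : ∀ {i j} → i ≢ j → d G ≤ partDensity i j
    d≤partDensity {i} {j} i≢j = case <-cmp i j of λ
      { (tri< i<j _ _) → d≤partDensity-< i<j
      ; (tri≈ _ i≡j _) → contradiction i≡j i≢j
      ; (tri> _ _ j<i) → ≤-trans (d≤partDensity-< j<i) (≤-reflexive (partDensity-sym j i)) }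

    ≤d : ∀ {q} → q ≤ 1ℚ → (∀ {i j} → i ≢ j → q ≤ partDensity i j) → q ≤ d G
    ≤d q≤1 q≤ = v≤min⁺ {xs = map (λ (i , j) → partDensity i j) pairs} q≤1
      (All.map⁺ (All.tabulate λ {(i , j)} ij∈ → q≤ λ i≡j →
        ℕ.<-irrefl (cong Fin.toℕ i≡j) (proj₂ (∈-filter⁻ (λ (i , j) → i <? j) {xs = cartesianProduct (allFin m) (allFin m)} ij∈))))

  -- M is chosen with s p < M (p² - s (1 - p)), so the threshold depends on s and p alone and serves
  -- all graphs. A list of r t parts is at least as long as r, which brings it above the tiling
  -- number.
  dense⇒traversal : ∀ s {p} → 0ℚ ≤ p → 0ℚ < p * p - ι s * (1ℚ - p) → ∃ λ N → ∀ r → N ℕ.≤ r →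
    (G : PartiteGraph (r ℕ.* suc (suc s))) → p ≤ d G → ¬ ¬ HasTraversal (r copiesOf K (suc (suc s))) G
  dense⇒traversal s {p} 0≤p 0<δ = tilingNumber (suc s) M , λ r N≤r G p≤d ¬traversal →
    Tilings.tiling-exists _≟_ (suc s) (CliqueOn G) (CliqueOn-resp-↭ G)
      (extendable G 0≤p (λ i≢j → ≤-trans p≤d (d≤partDensity G i≢j)) s M 0<δ (proj₂ large))
      (allFin (r ℕ.* suc (suc s))) (allFin⁺ _)
      (subst (tilingNumber (suc s) M ℕ.≤_) (sym (length-allFin r))
             (ℕ.≤-trans N≤r (ℕ.m≤m*n r (suc (suc s)))))
      (divides r (length-allFin r))
      (¬traversal ∘ tiling⇒traversal r (suc s) G)
    where
    large = archimedean-* (ι s * p) 0<δ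
    M = proj₁ large
    length-allFin : ∀ r → length (allFin (r ℕ.* suc (suc s))) ≡ r ℕ.* suc (suc s)
    length-allFin r = List.length-tabulate {A = Fin (r ℕ.* suc (suc s))} (λ i → i)

-- A dense graph without a traversal.

module LowerBound where

  open import Defs
  open RationalArithmetic
  open Sums
  open Densities
  open Traversals using (injective⇒surjective; edge-copies)
  open UpperBound using (≤d)

  open import Data.Bool.Base using (Bool; true; false; T; not; _∧_; if_then_else_)
  open import Data.Fin.Base as Fin using (Fin; zero; suc; quotient; remainder; combine; toℕ; punchIn)
  open import Data.Fin.Properties using (_≟_; pigeonhole; remQuot-combine; combine-remQuot; punchIn-injective; punchInᵢ≢i)
  import Data.Fin.Properties as Fin
  open import Data.Fin.Subset using (Subset; ∣_∣; _∈_)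
  open import Data.Fin.Subset.Properties using (_∈?_)
  open import Data.List.Base using (List; allFin; tabulate)
  import Data.List.Properties as List
  open import Data.Nat.Base as ℕ using (ℕ; zero; suc)
  import Data.Nat.Properties as ℕ
  open import Data.Product using (_×_; _,_; proj₁; proj₂)
  open import Data.Rational using (ℚ; 0ℚ; 1ℚ; _+_; _*_; _-_; -_; _≤_; _<_)
  open import Data.Rational.Properties hiding (_≟_)
  import Data.Vec.Base as Vec
  open import Data.Vec.Properties using (lookup∘tabulate; []=⇒lookup; lookup⇒[]=)
  open import Function.Base using (_∘_; case_of_)
  open import Function.Bundles using (_⇔_; mk⇔; Equivalence)
  open import Function.Definitions using (Injective)
  open import Relation.Binary.PropositionalEquality
  open import Relation.Nullary using (¬_; Dec; yes; no; does)
  open import Relation.Nullary.Decidable using (does-⇔; dec-true; dec-false)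
  open import Relation.Nullary.Negation using (contradiction)
  open import Tactic.RingSolver using (solve-∀)

  ∑-allFin-+ : ∀ m n f → ∑ (allFin (m ℕ.+ n)) f ≡
               ∑ (allFin m) (λ i → f (i Fin.↑ˡ n)) + ∑ (allFin n) (λ j → f (m Fin.↑ʳ j))
  ∑-allFin-+ zero    n f = sym (+-identityˡ _)
  ∑-allFin-+ (suc m) n f = begin
    ∑ (allFin (suc m ℕ.+ n)) f
      ≡⟨ ∑-allFin (m ℕ.+ n) f ⟩
    f zero + ∑ (allFin (m ℕ.+ n)) (f ∘ suc)
      ≡⟨ cong (f zero +_) (∑-allFin-+ m n (f ∘ suc)) ⟩
    f zero + (∑ (allFin m) (λ i → f (suc i Fin.↑ˡ n)) + ∑ (allFin n) (λ j → f (suc m Fin.↑ʳ j)))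
      ≡⟨ +-assoc (f zero) _ _ ⟨
    f zero + ∑ (allFin m) (λ i → f (suc i Fin.↑ˡ n)) + ∑ (allFin n) (λ j → f (suc m Fin.↑ʳ j))
      ≡⟨ cong (_+ ∑ (allFin n) (λ j → f (suc m Fin.↑ʳ j))) (∑-allFin m (λ i → f (i Fin.↑ˡ n))) ⟨
    ∑ (allFin (suc m)) (λ i → f (i Fin.↑ˡ n)) + ∑ (allFin n) (λ j → f (suc m Fin.↑ʳ j)) ∎
    where open ≡-Reasoning

  ∑-allFin-* : ∀ m n (f : Fin (m ℕ.* n) → ℚ) → ∑ (allFin (m ℕ.* n)) f ≡ ∑ (allFin m) λ i → ∑ (allFin n) λ j → f (combine i j)
  ∑-allFin-* zero    n f = refl
  ∑-allFin-* (suc m) n f = trans (∑-allFin-+ n (m ℕ.* n) f) (trans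
    (cong (∑ (allFin n) (λ j → f (j Fin.↑ˡ (m ℕ.* n))) +_) (∑-allFin-* m n (λ x → f (n Fin.↑ʳ x))))
    (sym (∑-allFin m (λ i → ∑ (allFin n) λ j → f (combine i j)))))

  ∑-const-allFin : ∀ n c → ∑ (allFin n) (λ _ → c) ≡ ι n * c
  ∑-const-allFin n c = trans (∑-const (allFin n) c) (cong (λ k → ι k * c) (List.length-tabulate {A = Fin n} (λ i → i)))

  ∑-≟ : ∀ {n} (i : Fin n) (f : Fin n → ℚ) → ∑ (allFin n) (λ j → 𝟙 (does (i ≟ j)) * f j) ≡ f i
  ∑-≟ {suc n} zero f = begin
    ∑ (allFin (suc n)) (λ j → 𝟙 (does (zero ≟ j)) * f j)
      ≡⟨ ∑-allFin n (λ j → 𝟙 (does (zero ≟ j)) * f j) ⟩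
    1ℚ * f zero + ∑ (allFin n) (λ j → 0ℚ * f (suc j))
      ≡⟨ cong₂ _+_ (*-identityˡ (f zero)) (trans (∑-*ˡ (allFin n) 0ℚ (f ∘ suc)) (*-zeroˡ (∑ (allFin n) (f ∘ suc)))) ⟩
    f zero + 0ℚ
      ≡⟨ +-identityʳ (f zero) ⟩
    f zero ∎
    where open ≡-Reasoning
  ∑-≟ {suc n} (suc i) f = trans (∑-allFin n (λ j → 𝟙 (does (suc i ≟ j)) * f j))
    (trans (cong₂ _+_ (*-zeroˡ (f zero)) (∑-≟ i (f ∘ suc))) (+-identityˡ _))

  ∑-initial : ∀ {a b} → a ℕ.≤ b → ∑ (allFin b) (λ i → 𝟙 (toℕ i ℕ.<ᵇ a)) ≡ ι a
  ∑-initial {zero} {b} _ = ∑-0 (allFin b)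
  ∑-initial {suc a} {suc b} (ℕ.s≤s a≤b) = trans (∑-allFin b (λ i → 𝟙 (toℕ i ℕ.<ᵇ suc a)))
    (trans (cong (1ℚ +_) (∑-initial a≤b)) (sym (ι-+ 1 a)))

  𝟙-not : ∀ b → 𝟙 (not b) ≡ 1ℚ - 𝟙 b
  𝟙-not true  = refl
  𝟙-not false = refl

  -- One part i₀ behaves like a single vertex joined to a fraction a / b of each
  -- other part; these neighbourhoods are coloured with s colours and induce a
  -- complete s-partite graph, so no clique on s + 2 vertices meets the part i₀.
  module Construction {m} (i₀ : Fin m) (a b s : ℕ) (a≤b : a ℕ.≤ b) .{{_ : ℕ.NonZero b}} .{{_ : ℕ.NonZero s}} where

    -- A position in a part is a pair of a number below b and a colour below s. The number lies
    -- below a exactly for the neighbours of the special part, so these make up a fraction a / b of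
    -- the part and their colours are equally frequent.
    size : ℕ
    size = b ℕ.* s

    V : Set
    V = Fin (m ℕ.* size)

    home : V → Fin m
    home = quotient size

    position : V → Fin size
    position = remainder {m} size

    inN : Fin size → Bool
    inN x = toℕ (quotient {b} s x) ℕ.<ᵇ a

    colour : Fin size → Fin s
    colour = remainder {b} s

    -- Between ordinary parts everything is joined except equally coloured pairs of neighbours of
    -- the special part; the density lost is a² / (b² s).
    joined : Fin m → Fin m → Fin size → Fin size → Bool
    joined i j x y =
      if does (i ≟ i₀) then (if does (j ≟ i₀) then false else inN y)
      else (if does (j ≟ i₀) then inN x else not (inN x ∧ (inN y ∧ does (colour x ≟ colour y))))

    ≟-sym : ∀ {n} (i j : Fin n) → does (i ≟ j) ≡ does (j ≟ i)
    ≟-sym i j = does-⇔ (mk⇔ sym sym) (i ≟ j) (j ≟ i)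

    joined-sym : ∀ i j x y → joined i j x y ≡ joined j i y x
    joined-sym i j x y with does (i ≟ i₀) | does (j ≟ i₀)
    ... | true  | true  = refl
    ... | true  | false = refl
    ... | false | true  = refl
    ... | false | false rewrite ≟-sym (colour x) (colour y) with inN x | inN y
    ...   | true  | true  = refl
    ...   | true  | false = refl
    ...   | false | true  = refl
    ...   | false | false = refl

    adjacent : V → V → Bool
    adjacent u v = not (does (home u ≟ home v)) ∧ joined (home u) (home v) (position u) (position v)

    G₀ : Graph
    G₀ = record
      { order = m ℕ.* size
      ; adj = adjacent
      ; symmetric = λ u v → cong₂ _∧_ (cong not (≟-sym (home u) (home v)))
                                      (joined-sym (home u) (home v) (position u) (position v))
      ; irreflexive = λ v → cong (λ b → not b ∧ joined (home v) (home v) (position v) (position v))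
                                 (dec-true (home v ≟ home v) refl)
      }

    class : Fin m → Subset (m ℕ.* size)
    class i = Vec.tabulate λ v → does (i ≟ home v)

    ∈-class : ∀ {i v} → v ∈ class i ⇔ i ≡ home v
    ∈-class {i} {v} = mk⇔ to from
      where
      to : v ∈ class i → i ≡ home v
      to v∈ with i ≟ home v | trans (sym (lookup∘tabulate (λ v → does (i ≟ home v)) v)) ([]=⇒lookup v∈)
      ... | yes eq | _ = eq
      from : i ≡ home v → v ∈ class i
      from eq = lookup⇒[]= v (class i)
        (trans (lookup∘tabulate (λ v → does (i ≟ home v)) v) (dec-true (i ≟ home v) eq))

    home-combine : ∀ i x → home (combine i x) ≡ i
    home-combine i x = cong proj₁ (remQuot-combine {m} {size} i x)

    position-combine : ∀ i x → position (combine i x) ≡ x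
    position-combine i x = cong proj₂ (remQuot-combine {m} {size} i x)

    origin : Fin size
    origin = Fin.fromℕ< {0} (ℕ.>-nonZero⁻¹ size {{ℕ.m*n≢0 b s}})

    distinct-homes : ∀ {u v} → Edge G₀ u v → home u ≢ home v
    distinct-homes {u} {v} uv eq with home u ≟ home v
    ... | no ≢ = ≢ eq

    edge⇒joined : ∀ {u v} → Edge G₀ u v → T (joined (home u) (home v) (position u) (position v))
    edge⇒joined {u} {v} uv with home u ≟ home v
    ... | no _ = uv

    G : PartiteGraph m
    G = record
      { graph = G₀
      ; part = class
      ; nonempty = λ i → combine i origin , Equivalence.from ∈-class (sym (home-combine i origin))
      ; partition = λ v → home v , Equivalence.from ∈-class refl , λ v∈ → sym (Equivalence.to ∈-class v∈)
      ; independent = λ i u∈ v∈ uv →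
          distinct-homes uv (trans (sym (Equivalence.to (∈-class {i}) u∈)) (Equivalence.to (∈-class {i}) v∈))
      }

    Vs : List V
    Vs = allFin (m ℕ.* size)

    ∑-class : ∀ i (f : V → ℚ) → ∑ Vs (λ v → member (class i) v * f v) ≡ ∑ (allFin size) λ x → f (combine i x)
    ∑-class i f = begin
      ∑ Vs (λ v → member (class i) v * f v)
        ≡⟨ ∑-cong Vs (λ {v} _ → cong (λ b → 𝟙 b * f v) (does-⇔ ∈-class (v ∈? class i) (i ≟ home v))) ⟩
      ∑ Vs (λ v → 𝟙 (does (i ≟ home v)) * f v)
        ≡⟨ ∑-allFin-* m size (λ v → 𝟙 (does (i ≟ home v)) * f v) ⟩
      ∑ (allFin m) (λ j → ∑ (allFin size) λ x → 𝟙 (does (i ≟ home (combine j x))) * f (combine j x))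
        ≡⟨ ∑-cong (allFin m) (λ {j} _ → trans (∑-cong (allFin size) λ {x} _ →
             cong (λ k → 𝟙 (does (i ≟ k)) * f (combine j x)) (home-combine j x))
             (∑-*ˡ (allFin size) (𝟙 (does (i ≟ j))) (λ x → f (combine j x)))) ⟩
      ∑ (allFin m) (λ j → 𝟙 (does (i ≟ j)) * ∑ (allFin size) λ x → f (combine j x))
        ≡⟨ ∑-≟ i (λ j → ∑ (allFin size) λ x → f (combine j x)) ⟩
      ∑ (allFin size) (λ x → f (combine i x)) ∎
      where open ≡-Reasoning

    ∣class∣ : ∀ i → ι ∣ class i ∣ ≡ ι size
    ∣class∣ i = begin
      ι ∣ class i ∣                        ≡⟨ ∣∣-∑ (class i) ⟩
      ∑ Vs (member (class i))              ≡⟨ ∑-cong Vs (λ {v} _ → *-identityʳ (member (class i) v)) ⟨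
      ∑ Vs (λ v → member (class i) v * 1ℚ) ≡⟨ ∑-class i (λ _ → 1ℚ) ⟩
      ∑ (allFin size) (λ _ → 1ℚ)           ≡⟨ trans (∑-const-allFin size 1ℚ) (*-identityʳ _) ⟩
      ι size                               ∎
      where open ≡-Reasoning

    e-joined : ∀ {i j} → i ≢ j → ι (e G₀ (class i) (class j)) ≡
               ∑ (allFin size) λ x → ∑ (allFin size) λ y → 𝟙 (joined i j x y)
    e-joined {i} {j} i≢j = begin
      ι (e G₀ (class i) (class j))
        ≡⟨ e-∑ G₀ (class i) (class j) ⟩
      ∑ Vs (λ u → ∑ Vs λ v → member (class i) u * (member (class j) v * 𝟙 (adjacent u v)))
        ≡⟨ ∑-cong Vs (λ {u} _ → trans (∑-*ˡ Vs (member (class i) u) (λ v → member (class j) v * 𝟙 (adjacent u v)))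
             (cong (member (class i) u *_) (∑-class j (λ v → 𝟙 (adjacent u v))))) ⟩
      ∑ Vs (λ u → member (class i) u * ∑ (allFin size) λ y → 𝟙 (adjacent u (combine j y)))
        ≡⟨ ∑-class i (λ u → ∑ (allFin size) λ y → 𝟙 (adjacent u (combine j y))) ⟩
      ∑ (allFin size) (λ x → ∑ (allFin size) λ y → 𝟙 (adjacent (combine i x) (combine j y)))
        ≡⟨ ∑-cong (allFin size) (λ {x} _ → ∑-cong (allFin size) λ {y} _ → cong 𝟙 (adjacent-combine x y)) ⟩
      ∑ (allFin size) (λ x → ∑ (allFin size) λ y → 𝟙 (joined i j x y)) ∎
      where
      open ≡-Reasoning
      adjacent-combine : ∀ x y → adjacent (combine i x) (combine j y) ≡ joined i j x y
      adjacent-combine x y = trans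
        (cong₂ _∧_ (cong not (cong₂ (λ (k l : Fin m) → does (k ≟ l)) (home-combine i x) (home-combine j y)))
                   (trans (cong₂ (λ k l → joined k l (position (combine i x)) (position (combine j y))) (home-combine i x) (home-combine j y))
                          (cong₂ (joined i j) (position-combine i x) (position-combine j y))))
        (cong (λ b → not b ∧ joined i j x y) (dec-false (i ≟ j) i≢j))

    ∑-size : ∀ (f : Fin size → ℚ) → ∑ (allFin size) f ≡ ∑ (allFin b) λ β → ∑ (allFin s) λ c → f (combine β c)
    ∑-size = ∑-allFin-* b s

    inN-combine : ∀ β c → inN (combine β c) ≡ (toℕ β ℕ.<ᵇ a)
    inN-combine β c = cong (λ (k , _) → toℕ k ℕ.<ᵇ a) (remQuot-combine {b} {s} β c)

    colour-combine : ∀ β c → colour (combine β c) ≡ c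
    colour-combine β c = cong proj₂ (remQuot-combine {b} {s} β c)

    ∑-inN : ∑ (allFin size) (𝟙 ∘ inN) ≡ ι s * ι a
    ∑-inN = begin
      ∑ (allFin size) (𝟙 ∘ inN)
        ≡⟨ ∑-size (𝟙 ∘ inN) ⟩
      ∑ (allFin b) (λ β → ∑ (allFin s) λ c → 𝟙 (inN (combine β c)))
        ≡⟨ ∑-cong (allFin b) (λ {β} _ → trans (∑-cong (allFin s) λ {c} _ → cong 𝟙 (inN-combine β c))
             (∑-const-allFin s (𝟙 (toℕ β ℕ.<ᵇ a)))) ⟩
      ∑ (allFin b) (λ β → ι s * 𝟙 (toℕ β ℕ.<ᵇ a))
        ≡⟨ ∑-*ˡ (allFin b) (ι s) (λ β → 𝟙 (toℕ β ℕ.<ᵇ a)) ⟩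
      ι s * ∑ (allFin b) (λ β → 𝟙 (toℕ β ℕ.<ᵇ a))
        ≡⟨ cong (ι s *_) (∑-initial a≤b) ⟩
      ι s * ι a ∎
      where open ≡-Reasoning

    ∑-colour : ∀ c → ∑ (allFin size) (λ y → 𝟙 (inN y ∧ does (c ≟ colour y))) ≡ ι a
    ∑-colour c = begin
      ∑ (allFin size) (λ y → 𝟙 (inN y ∧ does (c ≟ colour y)))
        ≡⟨ ∑-size (λ y → 𝟙 (inN y ∧ does (c ≟ colour y))) ⟩
      ∑ (allFin b) (λ β → ∑ (allFin s) λ c′ → 𝟙 (inN (combine β c′) ∧ does (c ≟ colour (combine β c′))))
        ≡⟨ ∑-cong (allFin b) (λ {β} _ → trans (∑-cong (allFin s) λ {c′} _ →
             trans (cong₂ (λ n k → 𝟙 (n ∧ does (c ≟ k))) (inN-combine β c′) (colour-combine β c′))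
               (trans (𝟙-∧ (toℕ β ℕ.<ᵇ a) (does (c ≟ c′))) (*-comm (𝟙 (toℕ β ℕ.<ᵇ a)) (𝟙 (does (c ≟ c′))))))
             (∑-≟ c (λ _ → 𝟙 (toℕ β ℕ.<ᵇ a)))) ⟩
      ∑ (allFin b) (λ β → 𝟙 (toℕ β ℕ.<ᵇ a))
        ≡⟨ ∑-initial a≤b ⟩
      ι a ∎
      where open ≡-Reasoning

    -- The missing pairs: there are s a choices of a special neighbour x, and each of them has a
    -- partners of its own colour among the special neighbours of the other part.
    e-ordinary : ∀ {i j} → i ≢ i₀ → j ≢ i₀ → (∑ (allFin size) λ x → ∑ (allFin size) λ y → 𝟙 (joined i j x y)) ≡
                 ι size * ι size - ι s * (ι a * ι a)
    e-ordinary {i} {j} i≢i₀ j≢i₀ = begin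
      ∑ (allFin size) (λ x → ∑ (allFin size) λ y → 𝟙 (joined i j x y))
        ≡⟨ ∑-cong (allFin size) (λ {x} _ → trans (∑-cong (allFin size) λ {y} _ → pointwise x y)
             (trans (∑-+ (allFin size) (λ _ → 1ℚ) (λ y → - 𝟙 (inN x) * 𝟙 (inN y ∧ does (colour x ≟ colour y))))
               (cong₂ _+_ (trans (∑-const-allFin size 1ℚ) (*-identityʳ (ι size)))
                 (trans (∑-*ˡ (allFin size) (- 𝟙 (inN x)) (λ y → 𝟙 (inN y ∧ does (colour x ≟ colour y))))
                        (cong (- 𝟙 (inN x) *_) (∑-colour (colour x))))))) ⟩
      ∑ (allFin size) (λ x → ι size + - 𝟙 (inN x) * ι a)
        ≡⟨ trans (∑-+ (allFin size) (λ _ → ι size) (λ x → - 𝟙 (inN x) * ι a))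
             (cong₂ _+_ (∑-const-allFin size (ι size))
               (trans (∑-cong (allFin size) λ {x} _ → eq (𝟙 (inN x)) (ι a)) (∑-*ʳ (allFin size) (- ι a) (𝟙 ∘ inN)))) ⟩
      ι size * ι size + ∑ (allFin size) (𝟙 ∘ inN) * - ι a
        ≡⟨ cong (λ z → ι size * ι size + z * - ι a) ∑-inN ⟩
      ι size * ι size + ι s * ι a * - ι a
        ≡⟨ eq′ (ι size) (ι s) (ι a) ⟩
      ι size * ι size - ι s * (ι a * ι a) ∎
      where
      open ≡-Reasoning
      eq : ∀ n a → - n * a ≡ n * - a
      eq = solve-∀ ring
      eq′ : ∀ B s a → B * B + s * a * - a ≡ B * B - s * (a * a)
      eq′ = solve-∀ ring
      eq″ : ∀ n c → 1ℚ - n * c ≡ 1ℚ + - n * c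
      eq″ = solve-∀ ring
      pointwise : ∀ x y → 𝟙 (joined i j x y) ≡ 1ℚ + - 𝟙 (inN x) * 𝟙 (inN y ∧ does (colour x ≟ colour y))
      pointwise x y = trans
        (cong₂ (λ c d → 𝟙 (if c then (if d then false else inN y) else
                            (if d then inN x else not (inN x ∧ (inN y ∧ does (colour x ≟ colour y))))))
               (dec-false (i ≟ i₀) i≢i₀) (dec-false (j ≟ i₀) j≢i₀))
        (trans (𝟙-not (inN x ∧ (inN y ∧ does (colour x ≟ colour y))))
          (trans (cong (λ z → 1ℚ - z) (𝟙-∧ (inN x) (inN y ∧ does (colour x ≟ colour y))))
                 (eq″ (𝟙 (inN x)) (𝟙 (inN y ∧ does (colour x ≟ colour y))))))

    e-special : ∀ {j} → j ≢ i₀ → (∑ (allFin size) λ x → ∑ (allFin size) λ y → 𝟙 (joined i₀ j x y)) ≡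
                ι size * (ι s * ι a)
    e-special {j} j≢i₀ = trans (∑-cong (allFin size) λ {x} _ → trans (∑-cong (allFin size) λ {y} _ →
        cong₂ (λ c d → 𝟙 (if c then (if d then false else inN y) else
                            (if d then inN x else not (inN x ∧ (inN y ∧ does (colour x ≟ colour y))))))
              (dec-true (i₀ ≟ i₀) refl) (dec-false (j ≟ i₀) j≢i₀))
        ∑-inN)
      (∑-const-allFin size (ι s * ι a))

    open Parts G using (partDensity; partDensity-sym)

    module _ {q} (q*b≡a : q * ι b ≡ ι a) (q-small : q * q + ι s * q ≤ ι s) where

      private
        size-b*s : ι size ≡ ι b * ι s
        size-b*s = ι-* b s

        0<size : 0ℚ < ι size
        0<size = 0<ι size {{ℕ.m*n≢0 b s}}

      ≤density : ∀ {i j} → i ≢ j → q * (ι size * ι size) ≤ ι (e G₀ (class i) (class j)) → q ≤ partDensity i j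
      ≤density {i} {j} i≢j q≤e = ≮⇒≥ λ dens<q →
        <-irrefl refl (<-≤-trans
          (subst (λ x → x < q * (ι size * ι size))
            (trans (cong₂ (λ x y → partDensity i j * (x * y)) (sym (∣class∣ i)) (sym (∣class∣ j)))
                   (density-* G₀ (class i) (class j) (nonempty G i) (nonempty G j)))
            (subst₂ _<_ (*-comm _ (partDensity i j)) (*-comm _ q) (*-mono-< (0<* 0<size 0<size) dens<q)))
          q≤e)

      q≤special : ∀ {j} → j ≢ i₀ → q ≤ partDensity i₀ j
      q≤special {j} j≢i₀ = ≤density (j≢i₀ ∘ sym) (≤-reflexive (begin
        q * (ι size * ι size)        ≡⟨ cong (λ x → q * (ι size * x)) size-b*s ⟩
        q * (ι size * (ι b * ι s))   ≡⟨ eq q (ι size) (ι b) (ι s) ⟩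
        ι size * (ι s * (q * ι b))   ≡⟨ cong (λ x → ι size * (ι s * x)) q*b≡a ⟩
        ι size * (ι s * ι a)         ≡⟨ trans (e-joined (j≢i₀ ∘ sym)) (e-special j≢i₀) ⟨
        ι (e G₀ (class i₀) (class j)) ∎))
        where
        open ≡-Reasoning
        eq : ∀ q B b s → q * (B * (b * s)) ≡ B * (s * (q * b))
        eq = solve-∀ ring

      q≤partDensity : ∀ {i j} → i ≢ j → q ≤ partDensity i j
      q≤partDensity {i} {j} i≢j = case (i ≟ i₀) of λ
        { (yes refl) → q≤special (i≢j ∘ sym)
        ; (no i≢i₀) → case (j ≟ i₀) of λ
          { (yes refl) → ≤-trans (q≤special i≢i₀) (≤-reflexive (partDensity-sym j i))
          ; (no j≢i₀) → ≤density i≢j (subst (q * (ι size * ι size) ≤_)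
              (sym (trans (e-joined i≢j) (e-ordinary i≢i₀ j≢i₀)))
              (subst₂ (λ B a → q * (B * B) ≤ B * B - ι s * (a * a)) (sym size-b*s) q*b≡a ordinary)) } }
        where
        -- This is (b s)² (1 - q²/s - q), with the division by s cleared.
        eq : ∀ q b s → (b * s * (b * s) - s * (q * b * (q * b))) - q * (b * s * (b * s)) ≡
             (s * (b * b)) * (s - (q * q + s * q))
        eq = solve-∀ ring
        ordinary : q * (ι b * ι s * (ι b * ι s)) ≤ ι b * ι s * (ι b * ι s) - ι s * (q * ι b * (q * ι b))
        ordinary = ≤-from (0≤* (0≤* (0≤ι s) (0≤p² (ι b))) (≤⇒0≤- q-small)) (eq q (ι b) (ι s))

      q≤d : q ≤ 1ℚ → q ≤ d G
      q≤d q≤1 = ≤d G q≤1 q≤partDensity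

    special-neighbour : ∀ {u v} → home u ≡ i₀ → Edge G₀ u v → T (inN (position v)) × home v ≢ i₀
    special-neighbour {u} {v} u≡i₀ uv = spec (home u ≟ i₀) (home v ≟ i₀) (edge⇒joined uv)
      where
      spec : (du : Dec (home u ≡ i₀)) (dv : Dec (home v ≡ i₀)) →
        T (if does du then (if does dv then false else inN (position v))
           else (if does dv then inN (position u) else
             not (inN (position u) ∧ (inN (position v) ∧ does (colour (position u) ≟ colour (position v)))))) →
        T (inN (position v)) × home v ≢ i₀
      spec (yes _) (no ≢) n = n , ≢
      spec (no ≢) _ _ = contradiction u≡i₀ ≢

    ordinary-colours : ∀ {u v} → home u ≢ i₀ → home v ≢ i₀ → T (inN (position u)) → T (inN (position v)) →
                       Edge G₀ u v → colour (position u) ≢ colour (position v)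
    ordinary-colours {u} {v} u≢ v≢ nu nv uv same = spec (home u ≟ i₀) (home v ≟ i₀)
        (inN (position u)) (inN (position v)) (colour (position u) ≟ colour (position v)) nu nv (edge⇒joined uv)
      where
      spec : (du : Dec (home u ≡ i₀)) (dv : Dec (home v ≡ i₀)) → ∀ nu nv (dc : Dec (colour (position u) ≡ colour (position v))) →
        T nu → T nv →
        ¬ T (if does du then (if does dv then false else nv) else (if does dv then nu else not (nu ∧ (nv ∧ does dc))))
      spec (yes eq) _ _ _ _ _ _ _ = u≢ eq
      spec (no _) (yes eq) _ _ _ _ _ _ = v≢ eq
      spec (no _) (no _) true true (yes _) _ _ ()
      spec (no _) (no _) true true (no ≢) _ _ _ = ≢ same

    -- The other s + 1 vertices of the clique would all be neighbours of the special part, so two of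
    -- them would share one of the s colours and not be adjacent.
    no-special-clique : ∀ (g : Fin (suc (suc s)) → V) → (∀ {k l} → k ≢ l → Edge G₀ (g k) (g l)) →
                        ∀ k₀ → home (g k₀) ≢ i₀
    no-special-clique g clique k₀ special =
      let l , l′ , l<l′ , same = pigeonhole (ℕ.n<1+n s) (λ l → colour (position (others l)))
      in ordinary-colours (proj₂ (neighbour l)) (proj₂ (neighbour l′)) (proj₁ (neighbour l)) (proj₁ (neighbour l′))
           (clique (Fin.<⇒≢ l<l′ ∘ punchIn-injective k₀ l l′)) same
      where
      others : Fin (suc s) → V
      others l = g (punchIn k₀ l)
      neighbour : ∀ l → T (inN (position (others l))) × home (others l) ≢ i₀
      neighbour l = special-neighbour special (clique (punchInᵢ≢i k₀ l ∘ sym))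

  module _ (r a b s : ℕ) (a≤b : a ℕ.≤ b) .{{_ : ℕ.NonZero b}} .{{_ : ℕ.NonZero s}}
           (i₀ : Fin (r ℕ.* suc (suc s))) where

    open Construction i₀ a b s a≤b

    -- The vertices of r K_t lie in distinct parts and are as many as the parts, so one of them lies
    -- in the special part; its copy of K_t contradicts `no-special-clique`.
    no-traversal : ¬ HasTraversal (r copiesOf K (suc (suc s))) G
    no-traversal (H , F) with injective⇒surjective {f = λ x → home (embed (inclusion H) (embed F x))} homes-injective i₀
      where
      homes-injective : Injective _≡_ _≡_ (λ x → home (embed (inclusion H) (embed F x)))
      homes-injective {x} {y} eq = injective F (trans (sym (unique (class-∈ x refl))) (unique (class-∈ y eq)))
        where
        unique = proj₂ (proj₂ (exactlyOne H (home (embed (inclusion H) (embed F x)))))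
        class-∈ : ∀ z {i} → i ≡ home (embed (inclusion H) (embed F z)) → embed (inclusion H) (embed F z) ∈ class i
        class-∈ z = Equivalence.from ∈-class
    ... | x₀ , special = no-special-clique (λ k → embed (inclusion H) (embed F (combine q₀ k))) clique k₀
        (trans (cong (λ x → home (embed (inclusion H) (embed F x))) (combine-remQuot {r} t x₀)) special)
      where
      t = suc (suc s)
      q₀ = quotient {r} t x₀
      k₀ = remainder {r} t x₀
      clique : ∀ {k l} → k ≢ l → Edge G₀ (embed (inclusion H) (embed F (combine q₀ k)))
                                         (embed (inclusion H) (embed F (combine q₀ l)))
      clique {k} {l} k≢l = edges (inclusion H) (edges F (edge-copies r t
        (trans (cong proj₁ (remQuot-combine {r} {t} q₀ k)) (sym (cong proj₁ (remQuot-combine {r} {t} q₀ l))))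
        λ eq → k≢l (trans (sym (cong proj₂ (remQuot-combine {r} {t} q₀ k)))
                     (trans eq (cong proj₂ (remQuot-combine {r} {t} q₀ l))))))

-- Arithmetic of positive Dedekind cuts.

module Cuts where

  open import Defs
  open RationalArithmetic

  open import Data.Product using (∃; ∃₂; _×_; _,_)
  open import Data.Rational hiding (_≄_)
  open import Data.Rational.Properties
  open import Data.Sum.Base using (_⊎_; inj₁; inj₂; [_,_]′)
  open import Function.Base using (case_of_)
  open import Level using (Level)
  open import Relation.Binary.PropositionalEquality
  open import Relation.Nullary using (yes; no)
  open import Relation.Nullary.Negation using (contradiction)
  open import Tactic.RingSolver using (solve-∀)

  private
    variable
      a b : Level
      p q r u v w : ℚ

  2ℚ : ℚ
  2ℚ = 1ℚ + 1ℚ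

  <⊓⇒<ˡ : ∀ q r → p < q ⊓ r → p < q
  <⊓⇒<ˡ q r p< = <-≤-trans p< (p⊓q≤p q r)

  <⊓⇒<ʳ : ∀ q r → p < q ⊓ r → p < r
  <⊓⇒<ʳ q r p< = <-≤-trans p< (p⊓q≤q q r)

  ⊔<⇒<ˡ : ∀ q r → q ⊔ r < p → q < p
  ⊔<⇒<ˡ q r <p = ≤-<-trans (p≤p⊔q q r) <p

  ⊔<⇒<ʳ : ∀ q r → q ⊔ r < p → r < p
  ⊔<⇒<ʳ q r <p = ≤-<-trans (p≤q⊔p q r) <p

  ⊓-closed : (P : ℚ → Set a) → P p → P q → P (p ⊓ q)
  ⊓-closed {p = p} {q} P Pp Pq with ⊓-sel p q
  ... | inj₁ eq = subst P (sym eq) Pp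
  ... | inj₂ eq = subst P (sym eq) Pq

  ⊔-closed : (P : ℚ → Set a) → P p → P q → P (p ⊔ q)
  ⊔-closed {p = p} {q} P Pp Pq with ⊔-sel p q
  ... | inj₁ eq = subst P (sym eq) Pp
  ... | inj₂ eq = subst P (sym eq) Pq

  *-mono-<-≤ : 0ℚ < p → p < q → 0ℚ < r → r ≤ u → p * r < q * u
  *-mono-<-≤ {p} {q} {r} {u} 0<p p<q 0<r r≤u = <-from
    (0<+≤ (0<* (<⇒0<- p<q) 0<r) (0≤* (<⇒≤ (<-trans 0<p p<q)) (≤⇒0≤- r≤u)))
    (eq p q r u)
    where
    eq : ∀ p q r u → q * u - p * r ≡ (q - p) * r + q * (u - r)
    eq = solve-∀ ring

  *-mono₂-≤ : 0ℚ ≤ p → p ≤ q → 0ℚ ≤ r → r ≤ u → p * r ≤ q * u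
  *-mono₂-≤ {p} {q} {r} {u} 0≤p p≤q 0≤r r≤u = ≤-from
    (0≤+ (0≤* (≤⇒0≤- p≤q) 0≤r) (0≤* (≤-trans 0≤p p≤q) (≤⇒0≤- r≤u)))
    (eq p q r u)
    where
    eq : ∀ p q r u → q * u - p * r ≡ (q - p) * r + q * (u - r)
    eq = solve-∀ ring

  quotient : 0ℚ < p → ∀ q → ∃ λ r → p * r ≡ q
  quotient {p} 0<p q = 1/ p * q ,
    trans (sym (*-assoc p (1/ p) q)) (trans (cong (_* q) (*-inverseʳ p)) (*-identityˡ q))
    where instance _ = 0<⇒nonZero 0<p

  -- Strict inequalities leave room to move a factor. This and its variants pass between a bound at
  -- a rational point and the strict bounds that products of cuts ask for.
  *-dense-< : 0ℚ < p → p * q < r → ∃ λ u → q < u × p * u < r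
  *-dense-< {p} {q} {r} 0<p pq<r =
    let r/p , eq = quotient 0<p r
        u , q<u , u<r/p = <-dense {q} {r/p} (*-cancel-< 0<p (subst (p * q <_) (sym eq) pq<r))
    in u , q<u , subst (p * u <_) eq (*-mono-< 0<p u<r/p)

  *-dense-> : 0ℚ < p → 0ℚ < q → r < p * q → ∃ λ u → 0ℚ < u × u < q × r < p * u
  *-dense-> {p} {q} {r} 0<p 0<q r<pq =
    -- `r` may be negative; comparing with its maximum with 0 makes the new factor positive.
    let r/p , eq = quotient 0<p (r ⊔ 0ℚ)
        r⊔0<pq = ⊔-closed (_< p * q) r<pq (0<* 0<p 0<q)
        u , r/p<u , u<q = <-dense {r/p} {q} (*-cancel-< 0<p (subst (_< p * q) (sym eq) r⊔0<pq))
        above = subst (_< p * u) eq (*-mono-< 0<p r/p<u)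
    in u , *-cancel-< 0<p (subst (_< p * u) (sym (*-zeroʳ p)) (⊔<⇒<ʳ r 0ℚ above)) , u<q , ⊔<⇒<ˡ r 0ℚ above

  -- The two factors of the square are enlarged one after the other, and the smaller enlargement
  -- serves for both.
  square-dense-< : 0ℚ < p → p * p < r → ∃ λ q → p < q × q * q < r
  square-dense-< {p} {r} 0<p p²<r =
    let u , p<u , pu<r = *-dense-< 0<p p²<r
        v , p<v , uv<r = *-dense-< {u} {p} (<-trans 0<p p<u) (subst (_< r) (*-comm p u) pu<r)
        p<m = ⊓-closed (p <_) p<u p<v
        0≤m = <⇒≤ (<-trans 0<p p<m)
    in u ⊓ v , p<m , ≤-<-trans (*-mono₂-≤ 0≤m (p⊓q≤p u v) 0≤m (p⊓q≤q u v)) uv<r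

  square-dense-> : 0ℚ < p → r < p * p → ∃ λ q → 0ℚ < q × q < p × r < q * q
  square-dense-> {p} {r} 0<p r<p² =
    let u , 0<u , u<p , r<pu = *-dense-> 0<p 0<p r<p²
        v , 0<v , v<p , r<uv = *-dense-> {u} {p} 0<u 0<p (subst (r <_) (*-comm p u) r<pu)
    in u ⊔ v , <-≤-trans 0<u (p≤p⊔q u v) , ⊔-closed (_< p) u<p v<p ,
       <-≤-trans r<uv (*-mono₂-≤ (<⇒≤ 0<u) (p≤p⊔q u v) (<⇒≤ 0<v) (p≤q⊔p u v))

  -- What the product formula needs of its factors, and stable under products, so that `IsReal` need
  -- not be verified for intermediate cuts.
  record PositiveCut (x : Cut a) : Set a where
    field
      positive-lower : ∃ λ r → 0ℚ < r × lower x r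
      upper-bound    : ∃ (upper x)
      ordered        : lower x p → upper x q → p < q

    0<upper : upper x q → 0ℚ < q
    0<upper q∈ = let _ , 0<r , r∈ = positive-lower in <-trans 0<r (ordered r∈ q∈)

  open PositiveCut

  module _ {x : Cut a} (X : IsReal x) where

    open IsReal X

    real-ordered : lower x p → upper x q → p < q
    real-ordered {p} {q} p∈ q∈ = ≰⇒> λ q≤p → case <-cmp′ q≤p of λ
      { (inj₁ q<p) → disjoint (p∈ , upper-closed q<p q∈)
      ; (inj₂ refl) → disjoint (p∈ , q∈) }
      where
      <-cmp′ : q ≤ p → q < p ⊎ q ≡ p
      <-cmp′ q≤p with q <? p
      ... | yes q<p = inj₁ q<p
      ... | no q≮p = inj₂ (≤-antisym q≤p (≮⇒≥ q≮p))

    real-positive : fromℚ 0ℚ <ᶜ x → PositiveCut x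
    real-positive 0<x = record { positive-lower = 0<x ; upper-bound = upper-inhabited ; ordered = real-ordered }

  -- A rational below y has a larger one still below y. Locatedness of x at these two either puts
  -- the smaller below x or the larger above x, hence above y, against disjointness. The other side
  -- is symmetric.
  ⊆⇒≃ : {x : Cut a} {y : Cut b} → IsReal x → IsReal y →
        (∀ q → lower x q → lower y q) → (∀ q → upper x q → upper y q) → x ≃ᶜ y
  ⊆⇒≃ {x = x} {y} X Y lower⊆ upper⊆ = (lower⊆ , λ q → upper⊇) , ((λ q → lower⊇) , upper⊆)
    where
    lower⊇ : lower y q → lower x q
    lower⊇ q∈ = let q′ , q<q′ , q′∈ = IsReal.lower-open Y q∈ in
      [ (λ q∈x → q∈x) , (λ q′∈x → contradiction (q′∈ , upper⊆ q′ q′∈x) (IsReal.disjoint Y)) ]′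
      (IsReal.located X q<q′)
    upper⊇ : upper y q → upper x q
    upper⊇ q∈ = let q′ , q′<q , q′∈ = IsReal.upper-open Y q∈ in
      [ (λ q′∈x → contradiction (lower⊆ q′ q′∈x , q′∈) (IsReal.disjoint Y)) , (λ q∈x → q∈x) ]′
      (IsReal.located X q′<q)

  fromℚ-positive : 0ℚ < p → PositiveCut (fromℚ p)
  fromℚ-positive {p} 0<p = record
    { positive-lower = <-dense 0<p
    ; upper-bound = p + 1ℚ , <-from 0<1 (eq p)
    ; ordered = <-trans }
    where
    eq : ∀ p → (p + 1ℚ) - p ≡ 1ℚ
    eq = solve-∀ ring

  module _ {x : Cut a} {y : Cut b} (X : PositiveCut x) (Y : PositiveCut y) where

    private
      below-0 : q < 0ℚ → ∃₂ λ r s → 0ℚ < r × 0ℚ < s × lower x r × lower y s × q < r * s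
      below-0 q<0 = let r₀ , 0<r₀ , r₀∈ = positive-lower X ; s₀ , 0<s₀ , s₀∈ = positive-lower Y in
        r₀ , s₀ , 0<r₀ , 0<s₀ , r₀∈ , s₀∈ , <-trans q<0 (0<* 0<r₀ 0<s₀)

    -- If one of the lower endpoints in the witness is not positive, the four-product bound makes q
    -- negative, and then any positive pair of lower elements serves.
    lower-*⁻ : lower (x *ᶜ y) q → ∃₂ λ r s → 0ℚ < r × 0ℚ < s × lower x r × lower y s × q < r * s
    lower-*⁻ {q} (r , r′ , s , s′ , r∈ , r′∈ , s∈ , s′∈ , q<) with 0ℚ <? r | 0ℚ <? s
    ... | yes 0<r | yes 0<s = r , s , 0<r , 0<s , r∈ , s∈ , <⊓⇒<ˡ (r * s) _ (<⊓⇒<ˡ (r * s ⊓ (r * s′)) _ q<)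
    ... | no 0≮r | _ = below-0 (<-≤-trans (<⊓⇒<ʳ (r * s) (r * s′) (<⊓⇒<ˡ (r * s ⊓ (r * s′)) _ q<)) (≤-from
        (0≤* (≤⇒0≤- (≮⇒≥ 0≮r)) (<⇒≤ (0<upper Y s′∈))) (eq r s′)))
      where
      eq : ∀ r s → 0ℚ - r * s ≡ (0ℚ - r) * s
      eq = solve-∀ ring
    ... | yes _ | no 0≮s = below-0 (<-≤-trans (<⊓⇒<ˡ (r′ * s) (r′ * s′) (<⊓⇒<ʳ (r * s ⊓ (r * s′)) _ q<)) (≤-from
        (0≤* (≤⇒0≤- (≮⇒≥ 0≮s)) (<⇒≤ (0<upper X r′∈))) (eq r′ s)))
      where
      eq : ∀ r s → 0ℚ - r * s ≡ (0ℚ - s) * r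
      eq = solve-∀ ring

    lower-*⁺ : 0ℚ < r → 0ℚ < u → lower x r → lower y u → q < r * u → lower (x *ᶜ y) q
    lower-*⁺ {r} {u} {q} 0<r 0<u r∈ u∈ q< =
      let r′ , r′∈ = upper-bound X ; u′ , u′∈ = upper-bound Y
          r≤r′ = <⇒≤ (ordered X r∈ r′∈) ; u≤u′ = <⇒≤ (ordered Y u∈ u′∈)
          <-by : ∀ {v w} → r ≤ v → u ≤ w → q < v * w
          <-by = λ r≤v u≤w → <-≤-trans q< (*-mono₂-≤ (<⇒≤ 0<r) r≤v (<⇒≤ 0<u) u≤w)
      in r , r′ , u , u′ , r∈ , r′∈ , u∈ , u′∈ ,
         ⊓-closed (q <_) (⊓-closed (q <_) q< (<-by ≤-refl u≤u′))
                         (⊓-closed (q <_) (<-by r≤r′ ≤-refl) (<-by r≤r′ u≤u′))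

    upper-*⁻ : upper (x *ᶜ y) q → ∃₂ λ r s → upper x r × upper y s × r * s < q
    upper-*⁻ (r , r′ , s , s′ , r∈ , r′∈ , s∈ , s′∈ , <q) = r′ , s′ , r′∈ , s′∈ , ⊔<⇒<ʳ (r′ * s) (r′ * s′) (⊔<⇒<ʳ (r * s ⊔ (r * s′)) _ <q)

    upper-*⁺ : upper x r → upper y u → r * u < q → upper (x *ᶜ y) q
    upper-*⁺ {r} {u} {q} r∈ u∈ <q =
      let r₀ , 0<r₀ , r₀∈ = positive-lower X ; u₀ , 0<u₀ , u₀∈ = positive-lower Y
          0<r = 0<upper X r∈ ; 0<u = 0<upper Y u∈
          r₀≤r = <⇒≤ (ordered X r₀∈ r∈) ; u₀≤u = <⇒≤ (ordered Y u₀∈ u∈)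
          <-by : ∀ {v w} → 0ℚ < v → 0ℚ < w → v ≤ r → w ≤ u → v * w < q
          <-by = λ 0<v 0<w v≤r w≤u → ≤-<-trans (*-mono₂-≤ (<⇒≤ 0<v) v≤r (<⇒≤ 0<w) w≤u) <q
      in r₀ , r , u₀ , u , r₀∈ , r∈ , u₀∈ , u∈ ,
         ⊔-closed (_< q) (⊔-closed (_< q) (<-by 0<r₀ 0<u₀ r₀≤r u₀≤u) (<-by 0<r₀ 0<u r₀≤r ≤-refl))
                         (⊔-closed (_< q) (<-by 0<r 0<u₀ ≤-refl u₀≤u) <q)

    *-positive : PositiveCut (x *ᶜ y)
    *-positive = record
      { positive-lower =
          let r , 0<r , r∈ = positive-lower X ; u , 0<u , u∈ = positive-lower Y
              v , 0<v , v<ru = <-dense (0<* 0<r 0<u)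
          in v , 0<v , lower-*⁺ 0<r 0<u r∈ u∈ v<ru
      ; upper-bound =
          let r , r∈ = upper-bound X ; u , u∈ = upper-bound Y
          in r * u + 1ℚ , upper-*⁺ r∈ u∈ (<-from 0<1 (eq (r * u)))
      ; ordered = λ p∈ q∈ →
          let r , u , 0<r , 0<u , r∈ , u∈ , p< = lower-*⁻ p∈
              r′ , u′ , r′∈ , u′∈ , <q = upper-*⁻ q∈
          in <-trans (<-≤-trans p< (*-mono₂-≤ (<⇒≤ 0<r) (<⇒≤ (ordered X r∈ r′∈)) (<⇒≤ 0<u) (<⇒≤ (ordered Y u∈ u′∈)))) <q
      }
      where
      eq : ∀ p → (p + 1ℚ) - p ≡ 1ℚ
      eq = solve-∀ ring

  module _ {x : Cut a} {c} (X : PositiveCut x) (0<c : 0ℚ < c) where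

    private
      C = fromℚ-positive 0<c

    lower-scale⁻ : lower (fromℚ c *ᶜ x) q → ∃ λ r → 0ℚ < r × lower x r × q < c * r
    lower-scale⁻ q∈ = let c₀ , r , 0<c₀ , 0<r , c₀<c , r∈ , q< = lower-*⁻ C X q∈ in
      r , 0<r , r∈ , <-trans q< (*-mono-<-≤ 0<c₀ c₀<c 0<r ≤-refl)

    lower-scale⁺ : 0ℚ < r → lower x r → q < c * r → lower (fromℚ c *ᶜ x) q
    lower-scale⁺ {r} {q} 0<r r∈ q< = let c₀ , 0<c₀ , c₀<c , q<′ = *-dense-> 0<r 0<c (subst (q <_) (*-comm c r) q<) in
      lower-*⁺ C X 0<c₀ 0<r c₀<c r∈ (subst (q <_) (*-comm r c₀) q<′)

    upper-scale⁻ : upper (fromℚ c *ᶜ x) q → ∃ λ r → upper x r × c * r < q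
    upper-scale⁻ q∈ = let c₁ , r , c<c₁ , r∈ , <q = upper-*⁻ C X q∈ in
      r , r∈ , <-trans (*-mono-<-≤ 0<c c<c₁ (0<upper X r∈) ≤-refl) <q

    upper-scale⁺ : upper x r → c * r < q → upper (fromℚ c *ᶜ x) q
    upper-scale⁺ {r} {q} r∈ <q = let c₁ , c<c₁ , <q′ = *-dense-< (0<upper X r∈) (subst (_< q) (*-comm c r) <q) in
      upper-*⁺ C X c<c₁ r∈ (subst (_< q) (*-comm r c₁) <q′)

  module _ {x : Cut a} {y : Cut b} (X : PositiveCut x) (Y : PositiveCut y) where

    lower-*-comm : lower (x *ᶜ y) q → lower (y *ᶜ x) q
    lower-*-comm {q} q∈ = let r , s , 0<r , 0<s , r∈ , s∈ , q< = lower-*⁻ X Y q∈ in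
      lower-*⁺ Y X 0<s 0<r s∈ r∈ (subst (q <_) (*-comm r s) q<)

    upper-*-comm : upper (x *ᶜ y) q → upper (y *ᶜ x) q
    upper-*-comm {q} q∈ = let r , s , r∈ , s∈ , <q = upper-*⁻ X Y q∈ in
      upper-*⁺ Y X s∈ r∈ (subst (_< q) (*-comm r s) <q)

  module _ {x : Cut a} (X : PositiveCut x) where

    -- The product rule yields two different elements of the same cut; the larger can take the place
    -- of both, and on the upper side the smaller.
    lower-square⁻ : lower (x *ᶜ x) q → ∃ λ r → 0ℚ < r × lower x r × q < r * r
    lower-square⁻ q∈ = let r , s , 0<r , 0<s , r∈ , s∈ , q< = lower-*⁻ X X q∈ in
      r ⊔ s , <-≤-trans 0<r (p≤p⊔q r s) , ⊔-closed (lower x) r∈ s∈ ,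
      <-≤-trans q< (*-mono₂-≤ (<⇒≤ 0<r) (p≤p⊔q r s) (<⇒≤ 0<s) (p≤q⊔p r s))

    upper-square⁻ : upper (x *ᶜ x) q → ∃ λ r → upper x r × r * r < q
    upper-square⁻ q∈ = let r , s , r∈ , s∈ , <q = upper-*⁻ X X q∈
                           0≤m = <⇒≤ (⊓-closed (0ℚ <_) (0<upper X r∈) (0<upper X s∈)) in
      r ⊓ s , ⊓-closed (upper x) r∈ s∈ , ≤-<-trans (*-mono₂-≤ 0≤m (p⊓q≤p r s) 0≤m (p⊓q≤q r s)) <q

  neg-involutive : ∀ p → - (- p) ≡ p
  neg-involutive = solve-∀ ring

  module _ {x : Cut a} where

    lower-1-⁻ : lower (fromℚ 1ℚ -ᶜ x) q → ∃ λ b → upper x b × b < 1ℚ - q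
    lower-1-⁻ (r , u , r<1 , -u∈ , refl) = - u , -u∈ , <-from (<⇒0<- r<1) (eq r u)
      where
      eq : ∀ r u → (1ℚ - (r + u)) - - u ≡ 1ℚ - r
      eq = solve-∀ ring

    lower-1-⁺ : upper x r → r < 1ℚ - q → lower (fromℚ 1ℚ -ᶜ x) q
    lower-1-⁺ {r} {q} r∈ r< = q + r , - r , <-from (<⇒0<- r<) (eq q r) ,
      subst (upper x) (sym (neg-involutive r)) r∈ , eq′ q r
      where
      eq : ∀ q r → 1ℚ - (q + r) ≡ (1ℚ - q) - r
      eq = solve-∀ ring
      eq′ : ∀ q r → q ≡ q + r + - r
      eq′ = solve-∀ ring

    upper-1-⁻ : upper (fromℚ 1ℚ -ᶜ x) q → ∃ λ b → lower x b × 1ℚ - q < b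
    upper-1-⁻ (r , u , 1<r , -u∈ , refl) = - u , -u∈ , <-from (<⇒0<- 1<r) (eq r u)
      where
      eq : ∀ r u → - u - (1ℚ - (r + u)) ≡ r - 1ℚ
      eq = solve-∀ ring

    upper-1-⁺ : lower x r → 1ℚ - q < r → upper (fromℚ 1ℚ -ᶜ x) q
    upper-1-⁺ {r} {q} r∈ <r = q + r , - r , <-from (<⇒0<- <r) (eq q r) ,
      subst (lower x) (sym (neg-involutive r)) r∈ , eq′ q r
      where
      eq : ∀ q r → (q + r) - 1ℚ ≡ r - (1ℚ - q)
      eq = solve-∀ ring
      eq′ : ∀ q r → q ≡ q + r + - r
      eq′ = solve-∀ ring

  module _ {x : Cut a} {c} (X : PositiveCut x) (0<c : 0ℚ < c) where

    private
      XX = *-positive X X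

    -- Subtraction exchanges the two sides, so a rational below 1 - c x² is witnessed by an r above
    -- x. With its three companions this turns the quadratic equation for cuts into rational
    -- inequalities in a single r.
    lower-rhs⁻ : lower (fromℚ 1ℚ -ᶜ fromℚ c *ᶜ (x *ᶜ x)) q → ∃ λ r → upper x r × c * (r * r) < 1ℚ - q
    lower-rhs⁻ q∈ =
      let b , b∈ , b< = lower-1-⁻ {x = fromℚ c *ᶜ (x *ᶜ x)} q∈
          y , y∈ , cy<b = upper-scale⁻ XX 0<c b∈
          r , r∈ , r²<y = upper-square⁻ X y∈
      in r , r∈ , <-trans (<-trans (*-mono-< 0<c r²<y) cy<b) b<

    lower-rhs⁺ : upper x r → c * (r * r) < 1ℚ - q → lower (fromℚ 1ℚ -ᶜ fromℚ c *ᶜ (x *ᶜ x)) q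
    lower-rhs⁺ r∈ cr²< =
      let b , cr²<b , b< = <-dense cr²<
          y , r²<y , cy<b = *-dense-< 0<c cr²<b
      in lower-1-⁺ {x = fromℚ c *ᶜ (x *ᶜ x)} (upper-scale⁺ XX 0<c (upper-*⁺ X X r∈ r∈ r²<y) cy<b) b<

    upper-rhs⁻ : upper (fromℚ 1ℚ -ᶜ fromℚ c *ᶜ (x *ᶜ x)) q → ∃ λ r → 0ℚ < r × lower x r × 1ℚ - q < c * (r * r)
    upper-rhs⁻ q∈ =
      let b , b∈ , <b = upper-1-⁻ {x = fromℚ c *ᶜ (x *ᶜ x)} q∈
          y , 0<y , y∈ , b<cy = lower-scale⁻ XX 0<c b∈
          r , 0<r , r∈ , y<r² = lower-square⁻ X y∈
      in r , 0<r , r∈ , <-trans <b (<-trans b<cy (*-mono-< 0<c y<r²))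

    upper-rhs⁺ : 0ℚ < r → lower x r → 1ℚ - q < c * (r * r) → upper (fromℚ 1ℚ -ᶜ fromℚ c *ᶜ (x *ᶜ x)) q
    upper-rhs⁺ {r} 0<r r∈ <cr² =
      let b , <b , b<cr² = <-dense <cr²
          y , 0<y , y<r² , b<cy = *-dense-> 0<c (0<* 0<r 0<r) b<cr²
      in upper-1-⁺ {x = fromℚ c *ᶜ (x *ᶜ x)}
           (lower-scale⁺ XX 0<c 0<y (lower-*⁺ X X 0<r 0<r r∈ r∈ y<r²) b<cy) <b

  fromℚ-isReal : ∀ p → IsReal (fromℚ p)
  fromℚ-isReal p = record
    { lower-inhabited = p - 1ℚ , <-from 0<1 (eq p)
    ; upper-inhabited = p + 1ℚ , <-from 0<1 (eq′ p)
    ; lower-closed = <-trans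
    ; upper-closed = λ p<q <p → <-trans <p p<q
    ; lower-open = <-dense
    ; upper-open = λ p<q → let r , p<r , r<q = <-dense p<q in r , r<q , p<r
    ; disjoint = λ (q<p , p<q) → <-asym q<p p<q
    ; located = λ {q} {r} q<r → case q <? p of λ
        { (yes q<p) → inj₁ q<p
        ; (no q≮p) → inj₂ (≤-<-trans (≮⇒≥ q≮p) q<r) }
    }
    where
    eq : ∀ p → p - (p - 1ℚ) ≡ 1ℚ
    eq = solve-∀ ring
    eq′ : ∀ p → (p + 1ℚ) - p ≡ 1ℚ
    eq′ = solve-∀ ring

-- The cut αₜ as the unique positive solution of the quadratic.

module PositiveRoot where

  open import Defs
  open RationalArithmetic
  open Cuts

  open import Data.Product using (∃; _×_; _,_; proj₁; proj₂)
  open import Data.Rational using (ℚ; 0ℚ; 1ℚ; ½; _+_; _*_; _-_; -_; _<_; _≤_; _⊔_)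
  open import Data.Rational.Properties
  open import Data.Sum.Base using (_⊎_; inj₁; inj₂)
  open import Function.Base using (case_of_)
  open import Level using (0ℓ)
  open import Relation.Binary.PropositionalEquality
  open import Relation.Nullary using (yes; no)
  open import Relation.Nullary.Decidable using (toWitness)
  open import Relation.Nullary.Negation using (contradiction)
  open import Tactic.RingSolver using (solve-∀)

  4ℚ : ℚ
  4ℚ = 2ℚ + 2ℚ

  0<2 : 0ℚ < 2ℚ
  0<2 = toWitness {a? = 0ℚ <? 2ℚ} _

  0<4 : 0ℚ < 4ℚ
  0<4 = toWitness {a? = 0ℚ <? 4ℚ} _

  √-ordered : ∀ {D z w} → lower (√ D) z → upper (√ D) w → z < w
  √-ordered (inj₁ z<0)  (0<w , _)    = <-trans z<0 0<w
  √-ordered (inj₂ z²<D) (0<w , D<w²) = <-square⁻¹ (<⇒≤ 0<w) (<-trans z²<D D<w²)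

  -- The cut of αₜ for t = σ + 2, where t² - 4 = σ² + 4σ and c = 1 / σ; it is the
  -- positive root of q² + σ q = σ.
  module Root {σ c : ℚ} (1≤σ : 1ℚ ≤ σ) (c*σ≡1 : c * σ ≡ 1ℚ) where

    τ D : ℚ
    τ = σ + 2ℚ
    D = σ * σ + 4ℚ * σ

    gap root : Cut 0ℓ
    gap = fromℚ τ -ᶜ √ D
    root = fromℚ 1ℚ -ᶜ gap *ᶜ fromℚ ½

    -- The sides of the root in terms of the polynomial alone. On negative q the polynomial is not
    -- increasing, so negative rationals are placed below outright and positivity is demanded above.
    Below Above : ℚ → Set
    Below q = q < 0ℚ ⊎ q * q + σ * q < σ
    Above q = 0ℚ < q × σ < q * q + σ * q

    0<σ : 0ℚ < σ
    0<σ = <-≤-trans 0<1 1≤σ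

    0<c : 0ℚ < c
    0<c = *-cancel-< 0<σ (subst₂ _<_ (sym (*-zeroʳ σ)) (sym (trans (*-comm σ c) c*σ≡1)) 0<1)

    0≤1-c : 0ℚ ≤ 1ℚ - c
    0≤1-c = ≤⇒0≤- (≤-trans (≤-reflexive (sym (*-identityʳ c)))
                    (≤-trans (*-mono-≤ (<⇒≤ 0<c) 1≤σ) (≤-reflexive c*σ≡1)))

    gap-positive : PositiveCut gap
    gap-positive = record
      -- From D = τ² - 4 the root √D lies more than 2 / τ below τ, and 2 / τ exceeds c / 2 because σ
      -- ≥ 1. So w = τ - c / 2 is above √D, while r = τ - c / 4 is below τ, and their difference c /
      -- 4 is a positive lower element.
      { positive-lower = r + - w , <-from (0<* 0<c (0<* 0<½ 0<½)) (eq₁ τ c) ,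
          r , - w , <-from (0<* 0<c (0<* 0<½ 0<½)) (eq₂ τ c) ,
          subst (upper (√ D)) (sym (neg-involutive w))
            (<-from (0<+≤ 0<σ (0≤+ (<⇒≤ 0<1) (0≤+ (<⇒≤ 0<½) (0≤* (<⇒≤ 0<½) 0≤1-c)))) (eq₃ σ c) ,
             <-from (0<+≤ 0<1 (0≤+ (0≤+ (0≤+ 0≤1-c 0≤1-c) (0≤p² (c * ½))) (≤⇒0≤- (≤-reflexive c*σ≡1))))
                    (eq₄ σ c)) ,
          refl
      ; upper-bound = _ , τ + 1ℚ , 1ℚ , <-from 0<1 (eq₅ τ) , inj₁ (toWitness {a? = - 1ℚ <? 0ℚ} _) , refl
      ; ordered = λ { (r , s , r<τ , -s∈ , refl) (r′ , s′ , τ<r′ , -s′∈ , refl) →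
          <-from (0<+ (<⇒0<- (<-trans r<τ τ<r′)) (<⇒0<- (√-ordered -s′∈ -s∈))) (eq₆ r r′ s s′) }
      }
      where
      r = τ - c * ½ * ½
      w = τ - c * ½
      eq₁ : ∀ τ c → (τ - c * ½ * ½ + - (τ - c * ½)) - 0ℚ ≡ c * (½ * ½)
      eq₁ = solve-∀ ring
      eq₂ : ∀ τ c → τ - (τ - c * ½ * ½) ≡ c * (½ * ½)
      eq₂ = solve-∀ ring
      eq₃ : ∀ σ c → (σ + 2ℚ - c * ½) - 0ℚ ≡ σ + (1ℚ + (½ + ½ * (1ℚ - c)))
      eq₃ = solve-∀ ring
      eq₄ : ∀ σ c → (σ + 2ℚ - c * ½) * (σ + 2ℚ - c * ½) - (σ * σ + 4ℚ * σ) ≡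
        1ℚ + (((1ℚ - c) + (1ℚ - c)) + c * ½ * (c * ½) + (1ℚ - c * σ))
      eq₄ = solve-∀ ring
      eq₅ : ∀ τ → (τ + 1ℚ) - τ ≡ 1ℚ
      eq₅ = solve-∀ ring
      eq₆ : ∀ r r′ s s′ → (r′ + s′) - (r + s) ≡ (r′ - r) + (- s - - s′)
      eq₆ = solve-∀ ring

    private
      ½-positive : PositiveCut (fromℚ ½)
      ½-positive = fromℚ-positive 0<½

    -- As τ = σ + 2, the root is (√D - σ) / 2, so q lies below it exactly when 2 q + σ lies below
    -- √D.
    lower-root⁻ : ∀ {q} → lower root q → ∃ λ z → lower (√ D) z × 2ℚ * q + σ < z
    lower-root⁻ {q} q∈ = case lower-1-⁻ {x = gap *ᶜ fromℚ ½} q∈ of λ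
      { (b , b∈ , b<) → case upper-scale⁻ gap-positive 0<½ (upper-*-comm gap-positive ½-positive b∈) of λ
        { (_ , (r , s , τ<r , -s∈ , refl) , <b) → - s , -s∈ ,
          <-from (0<+ (0<* 0<2 (<⇒0<- (<-trans <b b<))) (<⇒0<- τ<r)) (eq q σ r s) } }
      where
      eq : ∀ q σ r s → - s - (2ℚ * q + σ) ≡ 2ℚ * ((1ℚ - q) - ½ * (r + s)) + (r - (σ + 2ℚ))
      eq = solve-∀ ring

    lower-root⁺ : ∀ {q z} → lower (√ D) z → 2ℚ * q + σ < z → lower root q
    lower-root⁺ {q} {z} z∈ <z =
      let r , τ<r , r< = <-dense {τ} {2ℚ * (1ℚ - q) + z} (<-from (<⇒0<- <z) (eq₁ q σ z))
          b , <b , b< = <-dense (<-from (0<* 0<½ (<⇒0<- r<)) (eq₂ q r z))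
      in lower-1-⁺ {x = gap *ᶜ fromℚ ½} (upper-*-comm ½-positive gap-positive
           (upper-scale⁺ gap-positive 0<½
             (r , - z , τ<r , subst (lower (√ D)) (sym (neg-involutive z)) z∈ , refl) <b)) b<
      where
      eq₁ : ∀ q σ z → (2ℚ * (1ℚ - q) + z) - (σ + 2ℚ) ≡ z - (2ℚ * q + σ)
      eq₁ = solve-∀ ring
      eq₂ : ∀ q r z → (1ℚ - q) - ½ * (r + - z) ≡ ½ * ((2ℚ * (1ℚ - q) + z) - r)
      eq₂ = solve-∀ ring

    upper-root⁻ : ∀ {q} → upper root q → ∃ λ w → upper (√ D) w × w < 2ℚ * q + σ
    upper-root⁻ {q} q∈ = case upper-1-⁻ {x = gap *ᶜ fromℚ ½} q∈ of λ
      { (b , b∈ , <b) → case lower-scale⁻ gap-positive 0<½ (lower-*-comm gap-positive ½-positive b∈) of λ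
        { (_ , _ , (r , s , r<τ , -s∈ , refl) , b<) → - s , -s∈ ,
          <-from (0<+ (0<* 0<2 (<⇒0<- (<-trans <b b<))) (<⇒0<- r<τ)) (eq q σ r s) } }
      where
      eq : ∀ q σ r s → (2ℚ * q + σ) - - s ≡ 2ℚ * (½ * (r + s) - (1ℚ - q)) + ((σ + 2ℚ) - r)
      eq = solve-∀ ring

    upper-root⁺ : ∀ {q w} → upper (√ D) w → w < 2ℚ * q + σ → upper root q
    upper-root⁺ {q} {w} w∈ w< =
      let r , <r , r<τ = <-dense {2ℚ * (1ℚ - q) + w} {τ} (<-from (<⇒0<- w<) (eq₁ q σ w))
          -- The element r - w of the gap is not positive for large q, whereas `lower-scale⁺` asks
          -- for a positive one; hence the maximum with r₀.
          r₀ , 0<r₀ , r₀∈ = positive-lower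
          r⊔r₀∈ = ⊔-closed (lower gap)
            (r , - w , r<τ , subst (upper (√ D)) (sym (neg-involutive w)) w∈ , refl) r₀∈
          b , <b , b< = <-dense (<-≤-trans (<-from (0<* 0<½ (<⇒0<- <r)) (eq₂ q r w))
                                           (*-mono-≤ (<⇒≤ 0<½) (p≤p⊔q (r + - w) r₀)))
      in upper-1-⁺ {x = gap *ᶜ fromℚ ½} (lower-*-comm ½-positive gap-positive
           (lower-scale⁺ gap-positive 0<½ (<-≤-trans 0<r₀ (p≤q⊔p (r + - w) r₀)) r⊔r₀∈ b<)) <b
      where
      open PositiveCut gap-positive
      eq₁ : ∀ q σ w → (σ + 2ℚ) - (2ℚ * (1ℚ - q) + w) ≡ (2ℚ * q + σ) - w
      eq₁ = solve-∀ ring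
      eq₂ : ∀ q r w → ½ * (r + - w) - (1ℚ - q) ≡ ½ * (r - (2ℚ * (1ℚ - q) + w))
      eq₂ = solve-∀ ring

    private
      -- D - (2 q + σ)² = 4 (σ - (q² + σ q))
      square⇒ : ∀ q → (2ℚ * q + σ) * (2ℚ * q + σ) < D → q * q + σ * q < σ
      square⇒ q <D = <-from (0<* (0<* 0<½ 0<½) (<⇒0<- <D)) (eq q σ)
        where
        eq : ∀ q σ → σ - (q * q + σ * q) ≡ ½ * ½ * ((σ * σ + 4ℚ * σ) - (2ℚ * q + σ) * (2ℚ * q + σ))
        eq = solve-∀ ring

      square⇐ : ∀ q → q * q + σ * q < σ → (2ℚ * q + σ) * (2ℚ * q + σ) < D
      square⇐ q <σ = <-from (0<* 0<4 (<⇒0<- <σ)) (eq q σ)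
        where
        eq : ∀ q σ → (σ * σ + 4ℚ * σ) - (2ℚ * q + σ) * (2ℚ * q + σ) ≡ 4ℚ * (σ - (q * q + σ * q))
        eq = solve-∀ ring

      square⇒′ : ∀ q → D < (2ℚ * q + σ) * (2ℚ * q + σ) → σ < q * q + σ * q
      square⇒′ q D< = <-from (0<* (0<* 0<½ 0<½) (<⇒0<- D<)) (eq q σ)
        where
        eq : ∀ q σ → (q * q + σ * q) - σ ≡ ½ * ½ * ((2ℚ * q + σ) * (2ℚ * q + σ) - (σ * σ + 4ℚ * σ))
        eq = solve-∀ ring

      square⇐′ : ∀ q → σ < q * q + σ * q → D < (2ℚ * q + σ) * (2ℚ * q + σ)
      square⇐′ q σ< = <-from (0<* 0<4 (<⇒0<- σ<)) (eq q σ)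
        where
        eq : ∀ q σ → (2ℚ * q + σ) * (2ℚ * q + σ) - (σ * σ + 4ℚ * σ) ≡ 4ℚ * ((q * q + σ * q) - σ)
        eq = solve-∀ ring

      0<2q+σ : ∀ {q} → 0ℚ ≤ q → 0ℚ < 2ℚ * q + σ
      0<2q+σ 0≤q = +-mono-≤-< (0≤* (<⇒≤ 0<2) 0≤q) 0<σ

    lower⇒Below : ∀ {q} → lower root q → Below q
    lower⇒Below {q} q∈ with q <? 0ℚ
    ... | yes q<0 = inj₁ q<0
    ... | no q≮0 = case lower-root⁻ q∈ of λ
      { (z , inj₁ z<0 , <z) → contradiction (<-trans (0<2q+σ (≮⇒≥ q≮0)) <z) (<-asym z<0)
      ; (z , inj₂ z²<D , <z) →
          inj₂ (square⇒ q (≤-<-trans (≤-square (<⇒≤ (0<2q+σ (≮⇒≥ q≮0))) (<⇒≤ <z)) z²<D)) }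

    Below⇒lower : ∀ {q} → Below q → lower root q
    Below⇒lower {q} below with q <? 0ℚ
    -- For negative q the point σ separates: 2 q + σ < σ and σ² < D.
    ... | yes q<0 = lower-root⁺ {z = σ} (inj₂ (<-from (0<* 0<4 0<σ) (eq₁ σ))) (<-from (0<* 0<2 (<⇒0<- q<0)) (eq₂ q σ))
      where
      eq₁ : ∀ σ → (σ * σ + 4ℚ * σ) - σ * σ ≡ 4ℚ * σ
      eq₁ = solve-∀ ring
      eq₂ : ∀ q σ → σ - (2ℚ * q + σ) ≡ 2ℚ * (0ℚ - q)
      eq₂ = solve-∀ ring
    ... | no q≮0 = case below of λ
      { (inj₁ q<0) → contradiction q<0 q≮0
      ; (inj₂ <σ) → let z , <z , z²<D = square-dense-< (0<2q+σ (≮⇒≥ q≮0)) (square⇐ q <σ) in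
          lower-root⁺ (inj₂ z²<D) <z }

    upper⇒Above : ∀ {q} → upper root q → Above q
    upper⇒Above {q} q∈ =
      let w , (0<w , D<w²) , w< = upper-root⁻ q∈
          σ< = square⇒′ q (<-≤-trans D<w² (≤-square (<⇒≤ 0<w) (<⇒≤ w<)))
      -- If q ≤ 0, then q + σ is at least 2 q + σ > 0, so q² + σ q = q (q + σ) ≤ 0 < σ.
      in ≰⇒> (λ q≤0 → <-asym σ< (≤-<-trans (≤-from (0≤* (≤⇒0≤- q≤0)
                     (0≤+ (<⇒≤ (<-trans 0<w w<)) (≤⇒0≤- q≤0))) (eq q σ)) 0<σ)) , σ<
      where
      eq : ∀ q σ → 0ℚ - (q * q + σ * q) ≡ (0ℚ - q) * ((2ℚ * q + σ) + (0ℚ - q))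
      eq = solve-∀ ring

    Above⇒upper : ∀ {q} → Above q → upper root q
    Above⇒upper {q} (0<q , σ<) =
      let w , 0<w , w< , D<w² = square-dense-> (0<2q+σ (<⇒≤ 0<q)) (square⇐′ q σ<) in
      upper-root⁺ (0<w , D<w²) w<

    polynomial-mono : ∀ {p q} → 0ℚ ≤ p → p < q → p * p + σ * p < q * q + σ * q
    polynomial-mono {p} {q} 0≤p p<q = <-from
      (0<* (<⇒0<- p<q) (0<+≤ (+-mono-<-≤ (≤-<-trans 0≤p p<q) 0≤p) (<⇒≤ 0<σ))) (eq p q σ)
      where
      eq : ∀ p q σ → (q * q + σ * q) - (p * p + σ * p) ≡ (q - p) * (q + p + σ)
      eq = solve-∀ ring

    root-isReal : IsReal root
    root-isReal = record
      { lower-inhabited = - 1ℚ , Below⇒lower (inj₁ (toWitness {a? = - 1ℚ <? 0ℚ} _))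
      ; upper-inhabited = 1ℚ , Above⇒upper (0<1 , <-from 0<1 (eq₁ σ))
      ; lower-closed = λ p<q q∈ → let z , z∈ , <z = lower-root⁻ q∈ in
          lower-root⁺ z∈ (<-trans (double-mono p<q) <z)
      ; upper-closed = λ p<q p∈ → let w , w∈ , w< = upper-root⁻ p∈ in
          upper-root⁺ w∈ (<-trans w< (double-mono p<q))
      ; lower-open = λ {p} p∈ → let z , z∈ , <z = lower-root⁻ p∈
                                    v , <v , v<z = <-dense <z in
          ½ * (v - σ) , <-from (0<* 0<½ (<⇒0<- <v)) (eq₂ v p σ) ,
          lower-root⁺ z∈ (subst (_< z) (sym (eq₃ v σ)) v<z)
      ; upper-open = λ {q} q∈ → let w , w∈ , w< = upper-root⁻ q∈
                                    v , w<v , v< = <-dense w< in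
          ½ * (v - σ) , <-from (0<* 0<½ (<⇒0<- v<)) (eq₄ v q σ) ,
          upper-root⁺ w∈ (subst (w <_) (sym (eq₃ v σ)) w<v)
      ; disjoint = λ (q∈ , q∈′) → let _ , z∈ , <z = lower-root⁻ q∈ ; _ , w∈ , w< = upper-root⁻ q∈′ in
          <-asym (√-ordered {D} z∈ w∈) (<-trans w< <z)
      ; located = λ {p} {q} p<q → case p <? 0ℚ of λ
          { (yes p<0) → inj₁ (Below⇒lower (inj₁ p<0))
          ; (no p≮0) → case p * p + σ * p <? σ of λ
            { (yes p∈) → inj₁ (Below⇒lower (inj₂ p∈))
            ; (no p∉) → inj₂ (Above⇒upper
                (≤-<-trans (≮⇒≥ p≮0) p<q , ≤-<-trans (≮⇒≥ p∉) (polynomial-mono (≮⇒≥ p≮0) p<q))) } }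
      }
      where
      eq₁ : ∀ σ → (1ℚ * 1ℚ + σ * 1ℚ) - σ ≡ 1ℚ
      eq₁ = solve-∀ ring
      eq₂ : ∀ v p σ → ½ * (v - σ) - p ≡ ½ * (v - (2ℚ * p + σ))
      eq₂ = solve-∀ ring
      eq₃ : ∀ v σ → 2ℚ * (½ * (v - σ)) + σ ≡ v
      eq₃ = solve-∀ ring
      eq₄ : ∀ v q σ → q - ½ * (v - σ) ≡ ½ * ((2ℚ * q + σ) - v)
      eq₄ = solve-∀ ring
      double-mono : ∀ {p q} → p < q → 2ℚ * p + σ < 2ℚ * q + σ
      double-mono p<q = +-monoˡ-< σ (*-mono-< 0<2 p<q)

    0<root : fromℚ 0ℚ <ᶜ root
    0<root = ½ , 0<½ , Below⇒lower (inj₂ (<-from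
      (0<+≤ (0<* 0<½ 0<½) (0≤* (<⇒≤ 0<½) (≤⇒0≤- 1≤σ))) (eq σ)))
      where
      eq : ∀ σ → σ - (½ * ½ + σ * ½) ≡ ½ * ½ + ½ * (σ - 1ℚ)
      eq = solve-∀ ring

    root-positive : PositiveCut root
    root-positive = real-positive root-isReal 0<root

    c*-< : ∀ {p q} → p < σ * q → c * p < q
    c*-< {p} {q} p<σq = subst (c * p <_) (trans (sym (*-assoc c σ q)) (trans (cong (_* q) c*σ≡1) (*-identityˡ q)))
                              (*-mono-< 0<c p<σq)

    c*-> : ∀ {p q} → σ * q < p → q < c * p
    c*-> {p} {q} σq<p = subst (_< c * p) (trans (sym (*-assoc c σ q)) (trans (cong (_* q) c*σ≡1) (*-identityˡ q)))
                              (*-mono-< 0<c σq<p)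

    σ*-< : ∀ {p q} → c * p < q → p < σ * q
    σ*-< {p} {q} cp<q = subst (_< σ * q) (trans (sym (*-assoc σ c p)) (trans (cong (_* p) (trans (*-comm σ c) c*σ≡1)) (*-identityˡ p)))
                              (*-mono-< 0<σ cp<q)

    σ*-> : ∀ {p q} → q < c * p → σ * q < p
    σ*-> {p} {q} q<cp = subst (σ * q <_) (trans (sym (*-assoc σ c p)) (trans (cong (_* p) (trans (*-comm σ c) c*σ≡1)) (*-identityˡ p)))
                              (*-mono-< 0<σ q<cp)

    -- As c = 1 / σ, the hypothesis reads r² + σ q < σ, and for 0 ≤ q < r the left side decreases
    -- when r is replaced by q.
    rhs⇒Below : ∀ {q r} → q < r → c * (r * r) < 1ℚ - q → Below q
    rhs⇒Below {q} {r} q<r cr²< with q <? 0ℚ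
    ... | yes q<0 = inj₁ q<0
    ... | no q≮0 = inj₂ (<-from
        (0<+≤ (<⇒0<- (σ*-< cr²<)) (≤⇒0≤- (≤-square (≮⇒≥ q≮0) (<⇒≤ q<r)))) (eq q r σ))
      where
      eq : ∀ q r σ → σ - (q * q + σ * q) ≡ (σ * (1ℚ - q) - r * r) + (r * r - q * q)
      eq = solve-∀ ring

    rhs⇒Above : ∀ {q r} → 0ℚ < r → r < q → 1ℚ - q < c * (r * r) → Above q
    rhs⇒Above {q} {r} 0<r r<q <cr² = <-trans 0<r r<q , <-from
        (0<+≤ (<⇒0<- (σ*-> <cr²)) (≤⇒0≤- (≤-square (<⇒≤ 0<r) (<⇒≤ r<q)))) (eq q r σ)
      where
      eq : ∀ q r σ → (q * q + σ * q) - σ ≡ (r * r - σ * (1ℚ - q)) + (q * q - r * r)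
      eq = solve-∀ ring

    -- q ↦ σ / (q + σ) exchanges the two sides of the root, which is its fixed point.
    module Reflection {q} (0<q : 0ℚ < q) where

      0<q+σ : 0ℚ < q + σ
      0<q+σ = 0<+ 0<q 0<σ

      0<q+σ-1 : 0ℚ < (q + σ) - 1ℚ
      0<q+σ-1 = subst (0ℚ <_) (eq q σ) (0<+≤ 0<q (≤⇒0≤- 1≤σ))
        where
        eq : ∀ q σ → q + (σ - 1ℚ) ≡ (q + σ) - 1ℚ
        eq = solve-∀ ring

      abstract

        r : ℚ
        r = proj₁ (quotient 0<q+σ σ)

        r-eq : (q + σ) * r ≡ σ
        r-eq = proj₂ (quotient 0<q+σ σ)

      private
        -- The identities below hold modulo the relation `r-eq`; z is the multiple of the relation
        -- that has to be discarded.
        modulo : ∀ {x y z} → x ≡ y + z * ((q + σ) * r - σ) → x ≡ y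
        modulo {x} {y} {z} x≡ = trans x≡ (trans
          (cong (λ e → y + z * e) (trans (cong (_- σ) r-eq) (+-inverseʳ σ)))
          (trans (cong (y +_) (*-zeroʳ z)) (+-identityʳ y)))

        eq₁ : ∀ q r σ → (q + σ) * (r * r + σ * r - σ) ≡ σ * (r - q) + (r + σ) * ((q + σ) * r - σ)
        eq₁ = solve-∀ ring
        eq₂ : ∀ q r σ → (q + σ) * (σ * (1ℚ - q) - r * r) ≡
              σ * ((q + σ - 1ℚ) * (r - q)) + (- (r + σ)) * ((q + σ) * r - σ)
        eq₂ = solve-∀ ring
        eq₃ : ∀ q r σ → (q + σ) * (r - q) ≡ (σ - (q * q + σ * q)) + 1ℚ * ((q + σ) * r - σ)
        eq₃ = solve-∀ ring

        cancel : ∀ {x y} → (q + σ) * x ≡ y → 0ℚ < y → 0ℚ < x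
        cancel {x} eq 0<y = *-cancel-< 0<q+σ (subst₂ _<_ (sym (*-zeroʳ (q + σ))) (sym eq) 0<y)

        cancel′ : ∀ {x y} → (q + σ) * x ≡ y → y < 0ℚ → x < 0ℚ
        cancel′ {x} eq y<0 = *-cancel-< 0<q+σ (subst₂ _<_ (sym eq) (sym (*-zeroʳ (q + σ))) y<0)

        <⇒-<0 : ∀ {x y} → x < y → x - y < 0ℚ
        <⇒-<0 {x} {y} x<y = <-from (<⇒0<- x<y) (eq x y)
          where
          eq : ∀ x y → 0ℚ - (x - y) ≡ y - x
          eq = solve-∀ ring

        -<0⇒< : ∀ {x y} → x - y < 0ℚ → x < y
        -<0⇒< {x} {y} x-y<0 = <-from (<⇒0<- x-y<0) (eq x y)
          where
          eq : ∀ x y → y - x ≡ 0ℚ - (x - y)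
          eq = solve-∀ ring

        *-<0 : ∀ {x y} → 0ℚ < x → y < 0ℚ → x * y < 0ℚ
        *-<0 {x} {y} 0<x y<0 = subst (x * y <_) (*-zeroʳ x) (*-mono-< 0<x y<0)

      0<r : 0ℚ < r
      0<r = cancel r-eq 0<σ

      module _ (below : q * q + σ * q < σ) where

        q<r : 0ℚ < r - q
        q<r = cancel (modulo {z = 1ℚ} (eq₃ q r σ)) (<⇒0<- below)

        r-Above : Above r
        r-Above = 0<r , 0<-⇒< (cancel (modulo {z = r + σ} (eq₁ q r σ)) (0<* 0<σ q<r))

        r-rhs : c * (r * r) < 1ℚ - q
        r-rhs = c*-< (0<-⇒< (cancel (modulo {z = - (r + σ)} (eq₂ q r σ)) (0<* 0<σ (0<* 0<q+σ-1 q<r))))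

      module _ (above : σ < q * q + σ * q) where

        r<q : r - q < 0ℚ
        r<q = cancel′ (modulo {z = 1ℚ} (eq₃ q r σ)) (<⇒-<0 above)

        r-Below : Below r
        r-Below = inj₂ (-<0⇒< (cancel′ (modulo {z = r + σ} (eq₁ q r σ)) (*-<0 0<σ r<q)))

        r-rhs′ : 1ℚ - q < c * (r * r)
        r-rhs′ = c*-> (-<0⇒< (cancel′ (modulo {z = - (r + σ)} (eq₂ q r σ)) (*-<0 0<σ (*-<0 0<q+σ-1 r<q))))

    RHS : ∀ {a} → Cut a → Cut a
    RHS x = fromℚ 1ℚ -ᶜ fromℚ c *ᶜ (x *ᶜ x)

    -- The right-hand side decreases in x, so a point q below the root calls for a point r above the
    -- root with c r² < 1 - q, and conversely. The reflection r = σ / (q + σ) supplies it.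
    root-solves : root ≃ᶜ RHS root
    root-solves = ((λ q → lower⇒) , (λ q → upper⇐)) , ((λ q → lower⇐) , (λ q → upper⇒))
      where
      lower⇒ : ∀ {q} → lower root q → lower (RHS root) q
      -- Reflection needs a positive point, so q is first raised to the maximum with a positive
      -- lower element of the root.
      lower⇒ {q} q∈ = case lower⇒Below (⊔-closed (lower root) q∈ (proj₂ (proj₂ 0<root))) of λ
        { (inj₁ m<0) → contradiction m<0 (<-asym 0<m)
        ; (inj₂ m∈) → lower-rhs⁺ root-positive 0<c (Above⇒upper (r-Above m∈))
            (<-≤-trans (r-rhs m∈) (≤-from (≤⇒0≤- (p≤p⊔q q (proj₁ 0<root))) (eq q m))) }
        where
        m = q ⊔ proj₁ 0<root
        0<m : 0ℚ < m
        0<m = <-≤-trans (proj₁ (proj₂ 0<root)) (p≤q⊔p q (proj₁ 0<root))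
        open Reflection 0<m
        eq : ∀ q m → (1ℚ - q) - (1ℚ - m) ≡ m - q
        eq = solve-∀ ring

      upper⇒ : ∀ {q} → upper root q → upper (RHS root) q
      upper⇒ {q} q∈ = let 0<q , σ< = upper⇒Above q∈ in
        upper-rhs⁺ root-positive 0<c (Reflection.0<r 0<q)
          (Below⇒lower (Reflection.r-Below 0<q σ<)) (Reflection.r-rhs′ 0<q σ<)

      lower⇐ : ∀ {q} → lower (RHS root) q → lower root q
      lower⇐ {q} q∈ = let r , r∈ , cr²< = lower-rhs⁻ root-positive 0<c q∈
                          0<r , σ< = upper⇒Above r∈
                          -- For r above the root 1 - r < c r²; together with c r² < 1 - q this
                          -- gives q < r, as `rhs⇒Below` requires.
                          1-r<cr² = c*-> (<-from (<⇒0<- σ<) (eq r σ)) in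
        Below⇒lower (rhs⇒Below {r = r} (<-from (<⇒0<- (<-trans 1-r<cr² cr²<)) (eq′ q r)) cr²<)
        where
        eq : ∀ r σ → r * r - σ * (1ℚ - r) ≡ (r * r + σ * r) - σ
        eq = solve-∀ ring
        eq′ : ∀ q r → r - q ≡ (1ℚ - q) - (1ℚ - r)
        eq′ = solve-∀ ring

      upper⇐ : ∀ {q} → upper (RHS root) q → upper root q
      upper⇐ {q} q∈ = let r , 0<r , r∈ , <cr² = upper-rhs⁻ root-positive 0<c q∈ in
        case lower⇒Below r∈ of λ
        { (inj₁ r<0) → contradiction r<0 (<-asym 0<r)
        ; (inj₂ <σ) → Above⇒upper (rhs⇒Above {r = r} 0<r
            (<-from (<⇒0<- (<-trans <cr² (c*-< (<-from (<⇒0<- <σ) (eq r σ))))) (eq′ q r)) <cr²) }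
        where
        eq : ∀ r σ → σ * (1ℚ - r) - r * r ≡ σ - (r * r + σ * r)
        eq = solve-∀ ring
        eq′ : ∀ q r → q - r ≡ (1ℚ - r) - (1ℚ - q)
        eq′ = solve-∀ ring

    -- By the equation a point q below x comes with some r above x satisfying c r² < 1 - q. Then q <
    -- r, and `rhs⇒Below` places q below the root. Points above x are treated alike, and `⊆⇒≃` turns
    -- the two inclusions into equality.
    root-unique : ∀ (x : Cut 0ℓ) → IsReal x → fromℚ 0ℚ <ᶜ x → x ≃ᶜ RHS x → x ≃ᶜ root
    root-unique x X 0<x ((lower⇒ , _) , (_ , upper⇒)) = ⊆⇒≃ X root-isReal lower⊆ upper⊆
      where
      P = real-positive X 0<x
      lower⊆ : ∀ q → lower x q → lower root q
      lower⊆ q q∈ = let r , r∈ , cr²< = lower-rhs⁻ P 0<c (lower⇒ q q∈) in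
        Below⇒lower (rhs⇒Below {r = r} (real-ordered X q∈ r∈) cr²<)
      upper⊆ : ∀ q → upper x q → upper root q
      upper⊆ q q∈ = let r , 0<r , r∈ , <cr² = upper-rhs⁻ P 0<c (upper⇒ q q∈) in
        Above⇒upper (rhs⇒Above {r = r} 0<r (real-ordered X r∈ q∈) <cr²)

-- Comparison of the critical densities with the root.

module CriticalDensity where

  open import Defs
  open RationalArithmetic
  open Cuts
  open PositiveRoot
  open UpperBound
  open LowerBound using (no-traversal; module Construction)

  open import Data.Fin.Base using (zero)
  open import Data.Integer.Base as ℤ using (+_; -[1+_])
  import Data.Integer.Properties as ℤ
  open import Data.Nat.Base as ℕ using (ℕ; zero; suc)
  import Data.Nat.Properties as ℕ
  open import Data.Nat.Solver using (module +-*-Solver)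
  open import Data.Product using (∃; ∃₂; _×_; _,_; proj₁; proj₂)
  open import Data.Rational using (ℚ; mkℚ; 0ℚ; 1ℚ; ½; _+_; _*_; _-_; -_; _<_; _≤_; _⊔_; _/_)
  open import Data.Rational.Properties
  open import Data.Sum.Base using (inj₁; inj₂; [_,_]′)
  open import Function.Base using (case_of_)
  open import Relation.Binary.PropositionalEquality
  open import Relation.Nullary.Negation using (contradiction)
  open import Tactic.RingSolver using (solve-∀)

  ι-cancel-≤ : ∀ {m n} → ι m ≤ ι n → m ℕ.≤ n
  ι-cancel-≤ {m} {n} ιm≤ιn = ℕ.≮⇒≥ λ n<m → <-irrefl refl
    (<-≤-trans (<-from 0<1 (trans (cong (_- ι n) (ι-+ 1 n)) (eq (ι n)))) (≤-trans (ι-mono-≤ n<m) ιm≤ιn))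
    where
    eq : ∀ x → (1ℚ + x) - x ≡ 1ℚ
    eq = solve-∀ ring

  fraction : ∀ {p} → 0ℚ ≤ p → ∃₂ λ a b → p * ι (suc b) ≡ ι a
  fraction {p@(mkℚ (+ n) b _)} _ = n , b , trans (cong (_* ι (suc b)) (sym (↥p/↧p≡p p))) (/-*-cancel n (suc b))
  fraction {p@(mkℚ -[1+ n ] _ _)} 0≤p = contradiction (<-≤-trans (negative⁻¹ p) 0≤p) (<-irrefl refl)

  fromℚ-mono : ∀ p q → p ≤ q → fromℚ p ≤ᶜ fromℚ q
  fromℚ-mono p q p≤q = (λ r r<p → <-≤-trans r<p p≤q) , (λ r q<r → ≤-<-trans p≤q q<r)

  -- A walk upwards in steps of δ = ε / 4. Locatedness between p + δ and p + 2 δ either allows a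
  -- step or stops with an interval of length ε / 2. The Archimedean property bounds the steps:
  -- after n of them a point would be on both sides of x.
  approximate : ∀ {a} {x : Cut a} → IsReal x → ∀ {ε} → 0ℚ < ε → ∃₂ λ p q → lower x p × upper x q × q - p < ε
  approximate {x = x} X {ε} 0<ε =
    let p , p∈ = lower-inhabited ; q , q∈ = upper-inhabited
        n , <nδ = archimedean-* (q - p) 0<δ
    in walk n p p∈ (upper-closed (<-from (<⇒0<- <nδ) (eq₀ p q (ι n * δ))) q∈)
    where
    open IsReal X
    δ = ½ * (½ * ε)
    0<δ : 0ℚ < δ
    0<δ = 0<* 0<½ (0<* 0<½ 0<ε)
    eq₀ : ∀ p q d → (p + d) - q ≡ d - (q - p)
    eq₀ = solve-∀ ring
    eq₁ : ∀ p d → (p + (d + d)) - (p + d) ≡ d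
    eq₁ = solve-∀ ring
    eq₂ : ∀ p n d → p + (1ℚ + n) * d ≡ p + d + n * d
    eq₂ = solve-∀ ring
    eq₃ : ∀ p e → e - ((p + (½ * (½ * e) + ½ * (½ * e))) - p) ≡ ½ * e
    eq₃ = solve-∀ ring
    eq₄ : ∀ p d → p + 0ℚ * d ≡ p
    eq₄ = solve-∀ ring
    walk : ∀ n p → lower x p → upper x (p + ι n * δ) → ∃₂ λ p q → lower x p × upper x q × q - p < ε
    walk zero p p∈ ∈ = contradiction (p∈ , subst (upper x) (eq₄ p δ) ∈) disjoint
    walk (suc n) p p∈ ∈ = case located (<-from 0<δ (eq₁ p δ)) of λ
      { (inj₁ p+δ∈) → walk n (p + δ) p+δ∈
          (subst (upper x) (trans (cong (λ k → p + k * δ) (ι-+ 1 n)) (eq₂ p (ι n) δ)) ∈)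
      ; (inj₂ p+2δ∈) → p , p + (δ + δ) , p∈ , p+2δ∈ , <-from (0<* 0<½ 0<ε) (eq₃ p ε) }

  module Critical (n : ℕ) (c : ℚ) (c*n≡1 : c * ι (suc n) ≡ 1ℚ) where

    private
      s t : ℕ
      s = suc n
      t = suc (suc s)

      1≤s : 1ℚ ≤ ι s
      1≤s = ι-mono-≤ {1} {s} (ℕ.s≤s ℕ.z≤n)

    open Root {ι s} {c} 1≤s c*n≡1

    α≡root : α t ≡ root
    α≡root = cong₂ (λ τ D → fromℚ 1ℚ -ᶜ (fromℚ τ -ᶜ √ D) *ᶜ fromℚ ½)
      (trans (cong ι (ℕ.+-comm 2 s)) (ι-+ s 2))
      (trans (cong (_/ 1) square) (trans (ι-+ (s ℕ.* s) (4 ℕ.* s)) (cong₂ _+_ (ι-* s s) (ι-* 4 s))))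
      where
      square : + t ℤ.* + t ℤ.- + 4 ≡ + (s ℕ.* s ℕ.+ 4 ℕ.* s)
      square = begin
        + t ℤ.* + t ℤ.- + 4                       ≡⟨ cong (ℤ._- + 4) (ℤ.pos-* t t) ⟨
        + (t ℕ.* t) ℤ.- + 4                       ≡⟨ cong (λ k → + k ℤ.- + 4) (eq s) ⟩
        + (s ℕ.* s ℕ.+ 4 ℕ.* s ℕ.+ 4) ℤ.- + 4     ≡⟨ ℤ.⊖-≥ (ℕ.m≤n+m 4 (s ℕ.* s ℕ.+ 4 ℕ.* s)) ⟩
        + (s ℕ.* s ℕ.+ 4 ℕ.* s ℕ.+ 4 ℕ.∸ 4)       ≡⟨ cong +_ (ℕ.m+n∸n≡m (s ℕ.* s ℕ.+ 4 ℕ.* s) 4) ⟩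
        + (s ℕ.* s ℕ.+ 4 ℕ.* s)                   ∎
        where
        open ≡-Reasoning
        open +-*-Solver
        eq : ∀ s → (2 ℕ.+ s) ℕ.* (2 ℕ.+ s) ≡ s ℕ.* s ℕ.+ 4 ℕ.* s ℕ.+ 4
        eq = solve 1 (λ s → (con 2 :+ s) :* (con 2 :+ s) := s :* s :+ con 4 :* s :+ con 4) refl

    πᵣ : ℕ → Cut _
    πᵣ r = π (r ℕ.* t) (r copiesOf K t)

    -- Every positive rational m below the root is attained, its numerator and denominator being the
    -- parameters of the construction. It is taken strictly above q, since q has to lie in the lower
    -- set of `fromℚ m`, and at least a positive lower element of the root.
    Attainable-≥ : ∀ r → 1 ℕ.≤ r → ∀ {q} → lower root q →
                   ∃ λ m → q < m × Attainable (r ℕ.* t) (r copiesOf K t) (fromℚ m)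
    Attainable-≥ (suc r) _ {q} q∈ =
      let q′ , q<q′ , q′∈ = IsReal.lower-open root-isReal q∈
          ½₀ , 0<½₀ , ½₀∈ = 0<root
      in q′ ⊔ ½₀ , <-≤-trans q<q′ (p≤p⊔q q′ ½₀) ,
         attained (<-≤-trans 0<½₀ (p≤q⊔p q′ ½₀)) (⊔-closed (lower root) q′∈ ½₀∈)
      where
      attained : ∀ {m} → 0ℚ < m → lower root m → Attainable (suc r ℕ.* t) (suc r copiesOf K t) (fromℚ m)
      attained {m} 0<m m∈ = construct (fraction (<⇒≤ 0<m))
        where
        m²+sm<s : m * m + ι s * m < ι s
        m²+sm<s = [ (λ m<0 → contradiction m<0 (<-asym 0<m)) , (λ <s → <s) ]′ (lower⇒Below m∈)
        m≤1 : m ≤ 1ℚ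
        m≤1 = <⇒≤ (*-cancel-< 0<σ (<-from
          (0<+≤ (<⇒0<- m²+sm<s) (0≤p² m)) (eq m (ι s))))
          where
          eq : ∀ m s → s * 1ℚ - s * m ≡ (s - (m * m + s * m)) + m * m
          eq = solve-∀ ring
        construct : (∃₂ λ a b → m * ι (suc b) ≡ ι a) →
                    Attainable (suc r ℕ.* t) (suc r copiesOf K t) (fromℚ m)
        construct (a , b , mb≡a) = fromℚ-isReal m , fromℚ-mono 0ℚ m (<⇒≤ 0<m) , fromℚ-mono m 1ℚ m≤1 ,
          G , fromℚ-mono m (d G) (q≤d mb≡a (<⇒≤ m²+sm<s) m≤1) , no-traversal (suc r) a (suc b) s a≤b zero
          where
          a≤b : a ℕ.≤ suc b
          a≤b = ι-cancel-≤ {a} {suc b}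
            (subst₂ _≤_ (trans (*-comm (ι (suc b)) m) mb≡a) (*-identityʳ (ι (suc b))) (*-mono-≤ (0≤ι (suc b)) m≤1))
          open Construction {suc r ℕ.* t} zero a (suc b) s a≤b

    root≤π : ∀ r → 1 ℕ.≤ r → root ≤ᶜ πᵣ r
    root≤π r 1≤r =
      (λ q q∈ → let m , q<m , att = Attainable-≥ r 1≤r q∈ in fromℚ m , att , q<m) ,
      -- Here p bounds all attainable values. If p were below the root, a larger value would be
      -- attained, so locatedness of the root leaves only that q is above it.
      (λ { q (p , p<q , bound) → case IsReal.located root-isReal p<q of λ
        { (inj₁ p∈) → let m , p<m , att = Attainable-≥ r 1≤r p∈ in
            contradiction (proj₁ (bound (fromℚ m) att) p p<m) (<-irrefl refl)
        ; (inj₂ q∈) → q∈ } })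

    -- The order of the rationals b and d G is decidable, so the double negation of
    -- `dense⇒traversal` is enough to refute b < d G.
    π-bound : ∀ {b} → upper root b → ∃ λ N → ∀ r → N ℕ.≤ r →
              ∀ x → Attainable (r ℕ.* t) (r copiesOf K t) x → x ≤ᶜ fromℚ b
    π-bound {b} b∈ = N , λ { r N≤r x (_ , _ , _ , G , (lower≤ , upper≤) , no-trav) →
      let d≤b = ≮⇒≥ λ b<d → proj₂ traversal r N≤r G (<⇒≤ b<d) no-trav in
      (λ q q∈ → <-≤-trans (lower≤ q q∈) d≤b) , (λ q b<q → upper≤ q (≤-<-trans d≤b b<q)) }
      where
      eq : ∀ b s → b * b - s * (1ℚ - b) ≡ (b * b + s * b) - s
      eq = solve-∀ ring
      above = upper⇒Above b∈
      traversal = dense⇒traversal s {b} (<⇒≤ (proj₁ above))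
        (subst (0ℚ <_) (sym (eq b (ι s))) (<⇒0<- (proj₂ above)))
      N = proj₁ traversal

    π⟶root : πᵣ ⟶ root
    π⟶root ε 0<ε =
      let a , b , a∈ , b∈ , b-a<ε = approximate root-isReal 0<ε
          N , bound = π-bound b∈
          q , b<q , q<a+ε = <-dense {b} {a + ε} (<-from (<⇒0<- b-a<ε) (eq₁ a b ε))
      -- `root≤π` asks for r ≥ 1, which N alone does not ensure. The point q lies strictly above b
      -- because the upper set of a supremum keeps a strict margin over the bounds.
      in suc N , λ r N<r →
        (q , (b , b<q , bound r (ℕ.<⇒≤ N<r)) , a , q - a , a∈ , <-from (<⇒0<- q<a+ε) (eq₂ a q ε) , eq₃ a q) ,
        (b , b∈ , a , b - a , proj₁ (root≤π r (ℕ.≤-trans (ℕ.s≤s ℕ.z≤n) N<r)) a a∈ , b-a<ε , eq₃ a b)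
      where
      eq₁ : ∀ a b ε → (a + ε) - b ≡ ε - (b - a)
      eq₁ = solve-∀ ring
      eq₂ : ∀ a q ε → ε - (q - a) ≡ (a + ε) - q
      eq₂ = solve-∀ ring
      eq₃ : ∀ a q → q ≡ a + (q - a)
      eq₃ = solve-∀ ring

open import Defs
open import Data.Nat.Base using (ℕ; suc; s≤s; z≤n; _≤_; _*_)
open import Data.Product.Base using (_×_; _,_)
open import Relation.Binary.PropositionalEquality using (subst; sym)
open RationalArithmetic using (ι; ι-mono-≤; /-*-cancel)
open PositiveRoot using (module Root)
open CriticalDensity using (module Critical)

theorem1p4 : ∀ (t : ℕ) (3≤t : 3 ≤ t) →
    (IsPositiveSolution t 3≤t (α t) × (∀ x → IsPositiveSolution t 3≤t x → x ≃ᶜ α t)) ×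
    (∀ r → 1 ≤ r → α t ≤ᶜ π (r * t) (r copiesOf K t)) ×
    ((λ r → π (r * t) (r copiesOf K t)) ⟶ α t)
theorem1p4 t@(suc (suc (suc n))) 3≤t@(s≤s (s≤s (s≤s z≤n))) = subst
  (λ x → (IsPositiveSolution t 3≤t x × (∀ y → IsPositiveSolution t 3≤t y → y ≃ᶜ x)) ×
         (∀ r → 1 ≤ r → x ≤ᶜ π (r * t) (r copiesOf K t)) ×
         ((λ r → π (r * t) (r copiesOf K t)) ⟶ x))
  (sym α≡root)
  (((root-isReal , 0<root , root-solves) , (λ x (x-real , 0<x , x-solves) → root-unique x x-real 0<x x-solves)) ,
   root≤π , π⟶root)
  where
  c = 1/[ t -2] 3≤t
  open Critical n c (/-*-cancel 1 (suc n))
  open Root {ι (suc n)} {c} (ι-mono-≤ {1} {suc n} (s≤s z≤n)) (/-*-cancel 1 (suc n))
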